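{- The space $\mathrm{DQSym}$ of diagonally quasi-symmetric series, with the multiplication, unit, comultiplication $\Delta$, counit $\epsilon$ and bidegree described in the context, is a bigraded Hopf algebra over $\mathbb{Q}$, and the map $\pi\colon \mathrm{DQSym}\to\mathrm{QSym}$ induced by setting $y_i=x_i$ for all $i$ is a morphism of graded Hopf algebras, where $\mathrm{DQSym}$ is graded by total degree.
   Context: A bicomposition of length $\ell(\mathfrak a)=k$ is a sequence $\mathfrak a=(\alpha_1,\dots,\alpha_k)$ of nonzero vectors $\alpha_m=(a_m,b_m)\in\mathbb{N}\times\mathbb{N}$ (where $0\in\mathbb N$); the empty bicomposition, of length $0$, is also denoted $0$. We also write $\mathfrak a=(\mathbf a,\mathbf b)$ with $\mathbf a=(a_1,\dots,a_k)$, $\mathbf b=(b_1,\dots,b_k)$. The bidegree of $\mathfrak a$ is $d(\mathfrak a)=(a_1+\dots+a_k,\;b_1+\dots+b_k)$. The concatenation of $\mathfrak a=(\alpha_1,\dots,\alpha_k)$ and $\mathfrak b=(\beta_1,\dots,\beta_\ell)$ is $\mathfrak a\cdot\mathfrak b=(\alpha_1,\dots,\alpha_k,\beta_1,\dots,\beta_\ell)$. In two infinite sets of commuting variables $x_1,x_2,\dots$ and $y_1,y_2,\dots$, for each bicomposition $\mathfrak a$ define the formal series $$M_{\mathfrak a}=\sum_{i_1<i_2<\dots<i_k} x_{i_1}^{a_1}y_{i_1}^{b_1}x_{i_2}^{a_2}y_{i_2}^{b_2}\cdots x_{i_k}^{a_k}y_{i_k}^{b_k},\qquad k=\ell(\mathfrak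 a),$$ with $M_0=1$ for the empty bicomposition. $\mathrm{DQSym}$ is the $\mathbb{Q}$-vector space with basis $\{M_{\mathfrak a}\}$, $\mathfrak a$ running over all bicompositions. Its multiplication is the usual multiplication of formal series (under which it is closed), with unit $M_0=1$. Its comultiplication and counit are the linear maps given by $$\Delta(M_{\mathfrak a})=\sum_{\mathfrak a_1\cdot\mathfrak a_2=\mathfrak a}M_{\mathfrak a_1}\otimes M_{\mathfrak a_2},\qquad \epsilon(M_{\mathfrak a})=\begin{cases}1&\text{if }\mathfrak a=0,\\0&\text{otherwise},\end{cases}$$ where the sum is over all factorizations of $\mathfrak a$ as a concatenation, including those with an empty factor. The bidegree of $M_{\mathfrak a}$ is $d(\mathfrak a)$. The grading by total degree has degree-$n$ component $\bigoplus_{d_1+d_2=n}\mathrm{DQSym}^{(d_1,d_2)}$, where $\mathrm{DQSym}^{(d_1,d_2)}$ is the span of the $M_{\mathfrak a}$ with $d(\mathfrak a)=(d_1,d_2)$. $\mathrm{QSym}$ is the usual graded Hopf algebra of quasi-symmetric functions in $x_1,x_2,\dots$ over $\mathbb{Q}$, with monomial basis $M_{\mathbf c}=\sum_{i_1<\dots<i_k}x_{i_1}^{c_1}\cdots x_{i_k}^{c_k}$ indexed by compositions $\mathbf c=(c_1,\dots,c_k)$ of positive integers, multiplication of formal series, and comultiplication given by deconcatenation of compositions. The map $\pi$ satisfies $\pi(M_{(\mathbf a,\mathbf b)})=M_{\mathbf a+\mathbf b}$. -}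

module Defs where

open import Algebra.Bundles using (CommutativeRing)
open import Algebra.Core using (Op₂)
open import Algebra.Module.Bundles using (Module)
open import Algebra.Module.Structures.Biased using (IsModuleFromLeft)
open import Algebra.Module.Morphism.Structures using (module ModuleMorphisms)
import Algebra.Module.Construct.TensorUnit as TensorUnit
open import Algebra.Structures using (IsRing; IsCommutativeMonoid)
open import Data.Bool.Base using (if_then_else_)
open import Data.Fin.Base using (Fin; zero; suc)
open import Data.List.Base as List using (List; []; _∷_; _++_; length; cartesianProductWith)
import Data.List.Properties as List
open import Data.List.Membership.Propositional using (_∈_)
open import Data.List.Membership.Propositional.Properties
  using (∈-map⁺; ∈-map⁻; ∈-cartesianProductWith⁺; ∈-cartesianProductWith⁻; ∈-upTo⁺; ∈-upTo⁻)
open import Data.List.Relation.Unary.All using (All; []; _∷_)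
open import Data.List.Relation.Unary.AllPairs using (AllPairs; []; _∷_)
open import Data.List.Relation.Unary.Any using (here; there)
open import Data.List.Relation.Unary.Unique.Propositional using (Unique)
import Data.List.Relation.Unary.Unique.Propositional.Properties as Unique
open import Data.Nat.Base as ℕ using (ℕ; zero; suc)
import Data.Nat.Properties as ℕ
open import Data.Product.Base as Product using (Σ; Σ-syntax; ∃; _×_; _,_; proj₁; proj₂)
import Data.Product.Properties as Product
import Data.Rational.Properties as ℚ
open import Data.Vec.Base as Vec using (Vec; []; _∷_; _∷ʳ_; replicate; _[_]≔_)
import Data.Vec.Properties as Vec
open import Function.Base using (id; _∘_)
open import Function.Bundles using (_⇔_; mk⇔; Equivalence)
open import Level using (0ℓ)
open import Relation.Binary.Definitions using (DecidableEquality)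
open import Relation.Binary.PropositionalEquality as ≡
  using (_≡_; _≢_; refl; sym; trans; cong; cong₂; subst)
open import Relation.Nullary using (contradiction)
open import Relation.Nullary.Decidable using (Dec; does; yes; no; dec-true; dec-false)
open import Relation.Unary using (Pred)

------------------------------------------------------------------------
-- Linear algebra over a commutative ring

module LinearAlgebra (𝕜 : CommutativeRing 0ℓ 0ℓ) where

  open CommutativeRing 𝕜 using () renaming
    ( Carrier to K; _≈_ to _≈ᴷ_; _+_ to _+ᴷ_; _*_ to _*ᴷ_; -_ to -ᴷ_
    ; 0# to 0ᴷ; 1# to 1ᴷ )
  private module 𝕜 = CommutativeRing 𝕜

  Mod : Set₁
  Mod = Module 𝕜 0ℓ 0ℓ

  ∣_∣ : Mod → Set
  ∣ A ∣ = Module.Carrierᴹ A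

  𝟙 : Mod
  𝟙 = TensorUnit.⟨module⟩ {R = 𝕜}

  IsLinear : (A B : Mod) → (∣ A ∣ → ∣ B ∣) → Set
  IsLinear A B = ModuleMorphisms.IsModuleHomomorphism (Module.rawModule A) (Module.rawModule B)

  module _ (A : Mod) where
    open Module A

    sumᴹ : List ∣ A ∣ → ∣ A ∣
    sumᴹ = List.foldr _+ᴹ_ 0ᴹ

    data Span {I : Set} (v : I → ∣ A ∣) : Pred ∣ A ∣ 0ℓ where
      gen  : ∀ i → Span v (v i)
      zero : Span v 0ᴹ
      add  : ∀ {x y} → Span v x → Span v y → Span v (x +ᴹ y)
      mul  : ∀ r {x} → Span v x → Span v (r *ₗ x)
      resp : ∀ {x y} → x ≈ᴹ y → Span v x → Span v y

    neg∈Span : ∀ {I : Set} {v : I → ∣ A ∣} {x} → Span v x → Span v (-ᴹ x)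
    neg∈Span {x = x} s = resp (inverseʳ-uniqueᴹ x _ x-x≈0) (mul (-ᴷ 1ᴷ) s)
      where
      open import Algebra.Module.Properties.LeftModule leftModule using (inverseʳ-uniqueᴹ)
      x-x≈0 : x +ᴹ (-ᴷ 1ᴷ) *ₗ x ≈ᴹ 0ᴹ
      x-x≈0 = ≈ᴹ-trans (+ᴹ-cong (≈ᴹ-sym (*ₗ-identityˡ x)) ≈ᴹ-refl)
             (≈ᴹ-trans (≈ᴹ-sym (*ₗ-distribʳ x 1ᴷ (-ᴷ 1ᴷ)))
             (≈ᴹ-trans (*ₗ-cong (𝕜.-‿inverseʳ 1ᴷ) ≈ᴹ-refl) (*ₗ-zeroˡ x)))

    SpanModule : {I : Set} (v : I → ∣ A ∣) → Mod
    SpanModule v = record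
      { Carrierᴹ = ∃ (Span v)
      ; _≈ᴹ_     = λ x y → proj₁ x ≈ᴹ proj₁ y
      ; _+ᴹ_     = λ (x , s) (y , t) → x +ᴹ y , add s t
      ; _*ₗ_     = λ r (x , s) → r *ₗ x , mul r s
      ; 0ᴹ       = 0ᴹ , zero
      ; -ᴹ_      = λ (x , s) → -ᴹ x , neg∈Span s
      ; isModule = IsModuleFromLeft.isModule {commutativeRing = 𝕜} (record { isLeftModule = record
        { isLeftSemimodule = record
          { +ᴹ-isCommutativeMonoid = record
            { isMonoid = record
              { isSemigroup = record
                { isMagma = record
                  { isEquivalence = record
                    { refl = ≈ᴹ-refl ; sym = ≈ᴹ-sym ; trans = ≈ᴹ-trans }
                  ; ∙-cong = +ᴹ-cong }
                ; assoc = λ _ _ _ → +ᴹ-assoc _ _ _ }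
              ; identity = (λ _ → +ᴹ-identityˡ _) , (λ _ → +ᴹ-identityʳ _) }
            ; comm = λ _ _ → +ᴹ-comm _ _ }
          ; isPreleftSemimodule = record
            { *ₗ-cong = *ₗ-cong
            ; *ₗ-zeroˡ = λ _ → *ₗ-zeroˡ _
            ; *ₗ-distribʳ = λ _ _ _ → *ₗ-distribʳ _ _ _
            ; *ₗ-identityˡ = λ _ → *ₗ-identityˡ _
            ; *ₗ-assoc = λ _ _ _ → *ₗ-assoc _ _ _
            ; *ₗ-zeroʳ = λ _ → *ₗ-zeroʳ _
            ; *ₗ-distribˡ = λ _ _ _ → *ₗ-distribˡ _ _ _ } }
        ; -ᴹ‿cong = -ᴹ‿cong
        ; -ᴹ‿inverse = (λ _ → -ᴹ‿inverseˡ _) , (λ _ → -ᴹ‿inverseʳ _) } }) }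

    record IsSubmodule (P : Pred ∣ A ∣ 0ℓ) : Set where
      field
        P-resp : ∀ {x y} → x ≈ᴹ y → P x → P y
        P-zero : P 0ᴹ
        P-add  : ∀ {x y} → P x → P y → P (x +ᴹ y)
        P-mul  : ∀ r {x} → P x → P (r *ₗ x)

    record IsDirectSum {G : Set} (A₍_₎ : G → Pred ∣ A ∣ 0ℓ) : Set where
      Homogeneous : Set
      Homogeneous = Σ[ g ∈ G ] ∃ A₍ g ₎

      element : Homogeneous → ∣ A ∣
      element (_ , x , _) = x

      field
        isSubmodule : ∀ g → IsSubmodule A₍ g ₎
        exhaustive  : ∀ x → Span element x
        independent : (xs : List Homogeneous) →
                      AllPairs (λ x y → proj₁ x ≢ proj₁ y) xs →
                      sumᴹ (List.map element xs) ≈ᴹ 0ᴹ →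
                      All (λ x → element x ≈ᴹ 0ᴹ) xs

  -- The tensor product over 𝕜: the module generated by the symbols a ⊗ b,
  -- with equality the least congruence making it a module and _⊗_ bilinear.

  module _ (A B : Mod) where
    private
      module A = Module A
      module B = Module B

    infixl 6 _⊕_
    infixr 7 _⊙_
    infix  8 _⊗_

    data Tensor : Set where
      _⊗_ : ∣ A ∣ → ∣ B ∣ → Tensor
      𝟘   : Tensor
      _⊕_ : Tensor → Tensor → Tensor
      _⊙_ : K → Tensor → Tensor

    infix 4 _≈ᵀ_

    data _≈ᵀ_ : Tensor → Tensor → Set where
      ≈-refl      : ∀ {t} → t ≈ᵀ t
      ≈-sym       : ∀ {t u} → t ≈ᵀ u → u ≈ᵀ t
      ≈-trans     : ∀ {t u v} → t ≈ᵀ u → u ≈ᵀ v → t ≈ᵀ v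
      ⊕-cong      : ∀ {t t′ u u′} → t ≈ᵀ t′ → u ≈ᵀ u′ → t ⊕ u ≈ᵀ t′ ⊕ u′
      ⊙-cong      : ∀ {r r′ t t′} → r ≈ᴷ r′ → t ≈ᵀ t′ → r ⊙ t ≈ᵀ r′ ⊙ t′
      ⊗-cong      : ∀ {a a′ b b′} → a A.≈ᴹ a′ → b B.≈ᴹ b′ → a ⊗ b ≈ᵀ a′ ⊗ b′
      ⊕-assoc     : ∀ t u v → (t ⊕ u) ⊕ v ≈ᵀ t ⊕ (u ⊕ v)
      ⊕-comm      : ∀ t u → t ⊕ u ≈ᵀ u ⊕ t
      ⊕-identityˡ : ∀ t → 𝟘 ⊕ t ≈ᵀ t
      ⊙-zeroˡ     : ∀ t → 0ᴷ ⊙ t ≈ᵀ 𝟘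
      ⊙-identityˡ : ∀ t → 1ᴷ ⊙ t ≈ᵀ t
      ⊙-assoc     : ∀ r s t → (r *ᴷ s) ⊙ t ≈ᵀ r ⊙ (s ⊙ t)
      ⊙-distribˡ  : ∀ r t u → r ⊙ (t ⊕ u) ≈ᵀ r ⊙ t ⊕ r ⊙ u
      ⊙-distribʳ  : ∀ t r s → (r +ᴷ s) ⊙ t ≈ᵀ r ⊙ t ⊕ s ⊙ t
      ⊗-distribˡ  : ∀ a b b′ → a ⊗ (b B.+ᴹ b′) ≈ᵀ a ⊗ b ⊕ a ⊗ b′
      ⊗-distribʳ  : ∀ b a a′ → (a A.+ᴹ a′) ⊗ b ≈ᵀ a ⊗ b ⊕ a′ ⊗ b
      ⊗-scaleˡ    : ∀ r a b → (r A.*ₗ a) ⊗ b ≈ᵀ r ⊙ (a ⊗ b)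
      ⊗-scaleʳ    : ∀ r a b → a ⊗ (r B.*ₗ b) ≈ᵀ r ⊙ (a ⊗ b)

    ⊙-zeroʳ : ∀ r → r ⊙ 𝟘 ≈ᵀ 𝟘
    ⊙-zeroʳ r = ≈-trans (⊙-cong 𝕜.refl (≈-sym (⊙-zeroˡ 𝟘)))
               (≈-trans (≈-sym (⊙-assoc r 0ᴷ 𝟘))
               (≈-trans (⊙-cong (𝕜.zeroʳ r) ≈-refl) (⊙-zeroˡ 𝟘)))

    ⊕-inverseˡ : ∀ t → (-ᴷ 1ᴷ) ⊙ t ⊕ t ≈ᵀ 𝟘
    ⊕-inverseˡ t = ≈-trans (⊕-cong ≈-refl (≈-sym (⊙-identityˡ t)))
                  (≈-trans (≈-sym (⊙-distribʳ t (-ᴷ 1ᴷ) 1ᴷ))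
                  (≈-trans (⊙-cong (𝕜.-‿inverseˡ 1ᴷ) ≈-refl) (⊙-zeroˡ t)))

  infixr 7 _⊗ᴹ_

  _⊗ᴹ_ : Mod → Mod → Mod
  A ⊗ᴹ B = record
    { Carrierᴹ = Tensor A B
    ; _≈ᴹ_     = _≈ᵀ_ A B
    ; _+ᴹ_     = _⊕_
    ; _*ₗ_     = _⊙_
    ; 0ᴹ       = 𝟘
    ; -ᴹ_      = (-ᴷ 1ᴷ) ⊙_
    ; isModule = IsModuleFromLeft.isModule {commutativeRing = 𝕜} (record { isLeftModule = record
      { isLeftSemimodule = record
        { +ᴹ-isCommutativeMonoid = record
          { isMonoid = record
            { isSemigroup = record
              { isMagma = record
                { isEquivalence = record { refl = ≈-refl ; sym = ≈-sym ; trans = ≈-trans }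
                ; ∙-cong = ⊕-cong }
              ; assoc = ⊕-assoc }
            ; identity = ⊕-identityˡ , λ t → ≈-trans (⊕-comm t 𝟘) (⊕-identityˡ t) }
          ; comm = ⊕-comm }
        ; isPreleftSemimodule = record
          { *ₗ-cong = ⊙-cong
          ; *ₗ-zeroˡ = ⊙-zeroˡ
          ; *ₗ-distribʳ = ⊙-distribʳ
          ; *ₗ-identityˡ = ⊙-identityˡ
          ; *ₗ-assoc = ⊙-assoc
          ; *ₗ-zeroʳ = ⊙-zeroʳ A B
          ; *ₗ-distribˡ = ⊙-distribˡ } }
      ; -ᴹ‿cong = ⊙-cong 𝕜.refl
      ; -ᴹ‿inverse = ⊕-inverseˡ A B
                   , λ t → ≈-trans (⊕-comm t _) (⊕-inverseˡ A B t) } }) }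

  module _ {A B : Mod} where

    -- The linear map A ⊗ B → C induced by h, respecting equality when h is
    -- bilinear, as in every use below.
    lift : (C : Mod) → (∣ A ∣ → ∣ B ∣ → ∣ C ∣) → Tensor A B → ∣ C ∣
    lift C h (a ⊗ b) = h a b
    lift C h 𝟘       = Module.0ᴹ C
    lift C h (t ⊕ u) = Module._+ᴹ_ C (lift C h t) (lift C h u)
    lift C h (r ⊙ t) = Module._*ₗ_ C r (lift C h t)

    map⊗ : {C D : Mod} → (∣ A ∣ → ∣ C ∣) → (∣ B ∣ → ∣ D ∣) → Tensor A B → Tensor C D
    map⊗ {C} {D} f g = lift (C ⊗ᴹ D) (λ a b → f a ⊗ g b)

  assoc⊗ : {A B C : Mod} → Tensor (A ⊗ᴹ B) C → Tensor A (B ⊗ᴹ C)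
  assoc⊗ {A} {B} {C} =
    lift (A ⊗ᴹ (B ⊗ᴹ C)) (λ t c → lift (A ⊗ᴹ (B ⊗ᴹ C)) (λ a b → a ⊗ (b ⊗ c)) t)

  record HopfStructure (A : Mod) : Set where
    open Module A
    infixl 7 _·_ _·⊗_

    field
      _·_ : ∣ A ∣ → ∣ A ∣ → ∣ A ∣
      𝟏   : ∣ A ∣
      Δ   : ∣ A ∣ → ∣ A ⊗ᴹ A ∣
      ε   : ∣ A ∣ → K
      S   : ∣ A ∣ → ∣ A ∣

    _·⊗_ : ∣ A ⊗ᴹ A ∣ → ∣ A ⊗ᴹ A ∣ → ∣ A ⊗ᴹ A ∣
    t ·⊗ u = lift (A ⊗ᴹ A) (λ a b → lift (A ⊗ᴹ A) (λ c d → (a · c) ⊗ (b · d)) u) t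

    field
      ·-isRing  : IsRing _≈ᴹ_ _+ᴹ_ _·_ -ᴹ_ 0ᴹ 𝟏
      ·-scaleˡ  : ∀ r x y → (r *ₗ x) · y ≈ᴹ r *ₗ (x · y)
      ·-scaleʳ  : ∀ r x y → x · (r *ₗ y) ≈ᴹ r *ₗ (x · y)

      Δ-linear  : IsLinear A (A ⊗ᴹ A) Δ
      ε-linear  : IsLinear A 𝟙 ε
      coassoc   : ∀ x → _≈ᵀ_ A (A ⊗ᴹ A) (assoc⊗ (map⊗ Δ id (Δ x))) (map⊗ id Δ (Δ x))
      counitˡ   : ∀ x → lift A (λ a b → ε a *ₗ b) (Δ x) ≈ᴹ x
      counitʳ   : ∀ x → lift A (λ a b → ε b *ₗ a) (Δ x) ≈ᴹ x

      Δ-·       : ∀ x y → _≈ᵀ_ A A (Δ (x · y)) (Δ x ·⊗ Δ y)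
      Δ-𝟏       : _≈ᵀ_ A A (Δ 𝟏) (𝟏 ⊗ 𝟏)
      ε-·       : ∀ x y → ε (x · y) ≈ᴷ ε x *ᴷ ε y
      ε-𝟏       : ε 𝟏 ≈ᴷ 1ᴷ

      S-linear  : IsLinear A A S
      antipodeˡ : ∀ x → lift A (λ a b → S a · b) (Δ x) ≈ᴹ ε x *ₗ 𝟏
      antipodeʳ : ∀ x → lift A (λ a b → a · S b) (Δ x) ≈ᴹ ε x *ₗ 𝟏

  -- A grading of a Hopf algebra by a monoid (G , _∙_ , 0ᴳ).
  record IsGradedHopf {A : Mod} (H : HopfStructure A)
                      {G : Set} (_∙_ : Op₂ G) (0ᴳ : G)
                      (A₍_₎ : G → Pred ∣ A ∣ 0ℓ) : Set where
    open HopfStructure H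

    -- Pure tensors from A₍ d₁ ₎ ⊗ A₍ d₂ ₎ with d₁ ∙ d₂ = d.
    Pure : G → Set
    Pure d = Σ[ (d₁ , d₂) ∈ G × G ] (d₁ ∙ d₂ ≡ d) × ∃ A₍ d₁ ₎ × ∃ A₍ d₂ ₎

    tensor : ∀ {d} → Pure d → ∣ A ⊗ᴹ A ∣
    tensor (_ , _ , (a , _) , (b , _)) = a ⊗ b

    field
      isDirectSum : IsDirectSum A A₍_₎
      ·-graded    : ∀ {d e x y} → A₍ d ₎ x → A₍ e ₎ y → A₍ d ∙ e ₎ (x · y)
      𝟏-graded    : A₍ 0ᴳ ₎ 𝟏
      Δ-graded    : ∀ {d x} → A₍ d ₎ x → Span (A ⊗ᴹ A) (tensor {d}) (Δ x)
      ε-graded    : ∀ {d x} → d ≢ 0ᴳ → A₍ d ₎ x → ε x ≈ᴷ 0ᴷ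
      S-graded    : ∀ {d x} → A₍ d ₎ x → A₍ d ₎ (S x)

  record IsGradedHopfMorphism {A B : Mod} (H : HopfStructure A) (H′ : HopfStructure B)
                              {G : Set} (A₍_₎ : G → Pred ∣ A ∣ 0ℓ) (B₍_₎ : G → Pred ∣ B ∣ 0ℓ)
                              (φ : ∣ A ∣ → ∣ B ∣) : Set where
    open Module B using (_≈ᴹ_)
    private
      module H  = HopfStructure H
      module H′ = HopfStructure H′

    field
      linear    : IsLinear A B φ
      ·-homo    : ∀ x y → φ (x H.· y) ≈ᴹ φ x H′.· φ y
      𝟏-homo    : φ H.𝟏 ≈ᴹ H′.𝟏
      Δ-homo    : ∀ x → _≈ᵀ_ B B (H′.Δ (φ x)) (map⊗ φ φ (H.Δ x))
      ε-homo    : ∀ x → H′.ε (φ x) ≈ᴷ H.ε x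
      S-homo    : ∀ x → φ (H.S x) ≈ᴹ H′.S (φ x)
      preserves : ∀ {d x} → A₍ d ₎ x → B₍ d ₎ (φ x)

------------------------------------------------------------------------
-- Exponents

-- The possible exponents of the variables with a given index: ℕ for a single
-- family x₁, x₂, …, and ℕ × ℕ for two families x₁, x₂, … and y₁, y₂, …, where
-- (a , b) stands for xᵢᵃ yᵢᵇ.  Indices of variables start at 0 below.

record Exponents : Set₁ where
  infixl 6 _+_
  infix  4 _≟_
  field
    Exp                   : Set
    _+_                   : Op₂ Exp
    𝟎                     : Exp
    +-isCommutativeMonoid : IsCommutativeMonoid _≡_ _+_ 𝟎
    +-conical             : ∀ p q → p + q ≡ 𝟎 → p ≡ 𝟎 × q ≡ 𝟎
    _≟_                   : DecidableEquality Exp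
    splits                : Exp → List (Exp × Exp)
    splits-unique         : ∀ e → Unique (splits e)
    ∈-splits              : ∀ {e p q} → ((p , q) ∈ splits e) ⇔ (p + q ≡ e)

  open IsCommutativeMonoid +-isCommutativeMonoid public
    using () renaming (identityˡ to +-identityˡ; identityʳ to +-identityʳ)

  splits-𝟎 : splits 𝟎 ≡ (𝟎 , 𝟎) ∷ []
  splits-𝟎 = only (splits 𝟎) (splits-unique 𝟎)
                  (Equivalence.from ∈-splits (+-identityˡ 𝟎))
                  (λ {(p , q)} i → let (p≡𝟎 , q≡𝟎) = +-conical p q (Equivalence.to ∈-splits i)
                                   in cong₂ _,_ p≡𝟎 q≡𝟎)
    where
    only : ∀ {X : Set} {z : X} (xs : List X) → Unique xs → z ∈ xs →
           (∀ {x} → x ∈ xs → x ≡ z) → xs ≡ z ∷ []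
    only (x ∷ [])      _                 _ f = cong (_∷ []) (f (here refl))
    only (x ∷ y ∷ xs) ((x≢y ∷ _) ∷ _)    _ f =
      contradiction (trans (f (here refl)) (sym (f (there (here refl))))) x≢y

  -- Monomials in the variables of index < n, written multiplicatively.

  Monomial : ℕ → Set
  Monomial = Vec Exp

  𝟏ᵐ : ∀ {n} → Monomial n
  𝟏ᵐ = replicate _ 𝟎

  _^_ : ∀ {n} → Fin n → Exp → Monomial n
  i ^ α = 𝟏ᵐ [ i ]≔ α

  _·ᵐ_ : ∀ {n} → Monomial n → Monomial n → Monomial n
  _·ᵐ_ = Vec.zipWith _+_

  _≟ᵐ_ : ∀ {n} → DecidableEquality (Monomial n)
  _≟ᵐ_ = Vec.≡-dec _≟_

  -- All pairs (p , q) with p ·ᵐ q ≡ m.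
  factorisations : ∀ {n} → Monomial n → List (Monomial n × Monomial n)
  factorisations []      = ([] , []) ∷ []
  factorisations (e ∷ m) =
    cartesianProductWith (λ (p , q) (ps , qs) → p ∷ ps , q ∷ qs) (splits e) (factorisations m)

  factorisations-∷ʳ : ∀ {n} (m : Monomial n) →
    factorisations (m ∷ʳ 𝟎) ≡ List.map (Product.map (_∷ʳ 𝟎) (_∷ʳ 𝟎)) (factorisations m)
  factorisations-∷ʳ []      rewrite splits-𝟎 = refl
  factorisations-∷ʳ (e ∷ m) rewrite factorisations-∷ʳ m = go (splits e)
    where
    go : ∀ ss → cartesianProductWith _ ss
                  (List.map (Product.map (_∷ʳ 𝟎) (_∷ʳ 𝟎)) (factorisations m))
              ≡ List.map (Product.map (_∷ʳ 𝟎) (_∷ʳ 𝟎)) (cartesianProductWith _ ss (factorisations m))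
    go []       = refl
    go (s ∷ ss) = trans
      (cong₂ _++_ (trans (sym (List.map-∘ (factorisations m))) (List.map-∘ (factorisations m))) (go ss))
      (sym (List.map-++ _ (List.map _ (factorisations m)) _))

ℕ-exponents : Exponents
ℕ-exponents = record
  { Exp = ℕ ; _+_ = ℕ._+_ ; 𝟎 = 0
  ; +-isCommutativeMonoid = ℕ.+-0-isCommutativeMonoid
  ; +-conical = λ p q eq → ℕ.m+n≡0⇒m≡0 p eq , ℕ.m+n≡0⇒n≡0 p eq
  ; _≟_ = ℕ._≟_
  ; splits = λ e → List.map (λ i → i , e ℕ.∸ i) (List.upTo (suc e))
  ; splits-unique = λ e → Unique.map⁺ (cong proj₁) (Unique.upTo⁺ (suc e))
  ; ∈-splits = mk⇔ to from
  }
  where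
  to : ∀ {e p q} → (p , q) ∈ List.map (λ i → i , e ℕ.∸ i) (List.upTo (suc e)) → p ℕ.+ q ≡ e
  to i with ∈-map⁻ _ i
  ... | _ , j , refl = ℕ.m+[n∸m]≡n (ℕ.s≤s⁻¹ (∈-upTo⁻ j))
  from : ∀ {e p q} → p ℕ.+ q ≡ e → (p , q) ∈ List.map (λ i → i , e ℕ.∸ i) (List.upTo (suc e))
  from {e} {p} {q} refl =
    subst (λ r → (p , r) ∈ List.map (λ i → i , e ℕ.∸ i) (List.upTo (suc e))) (ℕ.m+n∸m≡n p q)
          (∈-map⁺ _ (∈-upTo⁺ (ℕ.s≤s (ℕ.m≤m+n p q))))

ℕ²-exponents : Exponents
ℕ²-exponents = record
  { Exp = ℕ × ℕ ; _+_ = Product.zip ℕ._+_ ℕ._+_ ; 𝟎 = 0 , 0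
  ; +-isCommutativeMonoid = record
    { isMonoid = record
      { isSemigroup = record
        { isMagma = record { isEquivalence = ≡.isEquivalence ; ∙-cong = cong₂ _ }
        ; assoc = λ (a , b) (c , d) (e , f) → cong₂ _,_ (ℕ.+-assoc a c e) (ℕ.+-assoc b d f) }
      ; identity = (λ _ → refl)
                 , (λ (a , b) → cong₂ _,_ (ℕ.+-identityʳ a) (ℕ.+-identityʳ b)) }
    ; comm = λ (a , b) (c , d) → cong₂ _,_ (ℕ.+-comm a c) (ℕ.+-comm b d) }
  ; +-conical = λ (a , b) (c , d) eq →
      cong₂ _,_ (ℕ.m+n≡0⇒m≡0 a (cong proj₁ eq)) (ℕ.m+n≡0⇒m≡0 b (cong proj₂ eq)) ,
      cong₂ _,_ (ℕ.m+n≡0⇒n≡0 a (cong proj₁ eq)) (ℕ.m+n≡0⇒n≡0 b (cong proj₂ eq))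
  ; _≟_ = Product.≡-dec ℕ._≟_ ℕ._≟_
  ; splits = λ (c , d) → cartesianProductWith pair (N.splits c) (N.splits d)
  ; splits-unique = λ (c , d) →
      Unique.cartesianProductWith⁺ pair
        (λ eq → cong₂ _,_ (cong (proj₁ ∘ proj₁) eq) (cong (proj₁ ∘ proj₂) eq)
              , cong₂ _,_ (cong (proj₂ ∘ proj₁) eq) (cong (proj₂ ∘ proj₂) eq))
        (N.splits-unique c) (N.splits-unique d)
  ; ∈-splits = mk⇔ to from
  }
  where
  module N = Exponents ℕ-exponents
  pair : ℕ × ℕ → ℕ × ℕ → (ℕ × ℕ) × (ℕ × ℕ)
  pair (a , a′) (b , b′) = (a , b) , (a′ , b′)
  to : ∀ {e p q} → (p , q) ∈ cartesianProductWith pair (N.splits (proj₁ e)) (N.splits (proj₂ e)) →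
       Product.zip ℕ._+_ ℕ._+_ p q ≡ e
  to {c , d} i with ∈-cartesianProductWith⁻ pair (N.splits c) (N.splits d) i
  ... | _ , _ , j , k , refl =
    cong₂ _,_ (Equivalence.to N.∈-splits j) (Equivalence.to N.∈-splits k)
  from : ∀ {e p q} → Product.zip ℕ._+_ ℕ._+_ p q ≡ e →
         (p , q) ∈ cartesianProductWith pair (N.splits (proj₁ e)) (N.splits (proj₂ e))
  from refl = ∈-cartesianProductWith⁺ pair (Equivalence.from N.∈-splits refl)
                                           (Equivalence.from N.∈-splits refl)

------------------------------------------------------------------------
-- Formal series and the series M

module QuasiSymmetric (𝕜 : CommutativeRing 0ℓ 0ℓ) (E : Exponents) where

  open LinearAlgebra 𝕜
  open Exponents E
  open CommutativeRing 𝕜 using () renaming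
    ( Carrier to K; _≈_ to _≈ᴷ_; _+_ to _+ᴷ_; _*_ to _*ᴷ_; -_ to -ᴷ_
    ; 0# to 0ᴷ; 1# to 1ᴷ )
  private module 𝕜 = CommutativeRing 𝕜

  sumᴷ : List K → K
  sumᴷ = List.foldr _+ᴷ_ 0ᴷ

  ⟦_⟧ : ∀ {P : Set} → Dec P → K
  ⟦ d ⟧ = if does d then 1ᴷ else 0ᴷ

  -- A formal series in infinitely many variables is given by its coefficients
  -- at the monomials in the variables of index < n, for all n; a monomial
  -- does not change when it is regarded as one in n + 1 variables.
  record Series : Set where
    field
      coeff    : ∀ {n} → Monomial n → K
      coeff-∷ʳ : ∀ {n} (m : Monomial n) → coeff (m ∷ʳ 𝟎) ≈ᴷ coeff m

  open Series public

  SeriesModule : Mod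
  SeriesModule = record
    { Carrierᴹ = Series
    ; _≈ᴹ_     = λ f g → ∀ {n} (m : Monomial n) → coeff f m ≈ᴷ coeff g m
    ; _+ᴹ_     = λ f g → record
      { coeff    = λ m → coeff f m +ᴷ coeff g m
      ; coeff-∷ʳ = λ m → 𝕜.+-cong (coeff-∷ʳ f m) (coeff-∷ʳ g m) }
    ; _*ₗ_     = λ r f → record
      { coeff    = λ m → r *ᴷ coeff f m
      ; coeff-∷ʳ = λ m → 𝕜.*-congˡ (coeff-∷ʳ f m) }
    ; 0ᴹ       = record { coeff = λ _ → 0ᴷ ; coeff-∷ʳ = λ _ → 𝕜.refl }
    ; -ᴹ_      = λ f → record
      { coeff    = λ m → -ᴷ coeff f m
      ; coeff-∷ʳ = λ m → 𝕜.-‿cong (coeff-∷ʳ f m) }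
    ; isModule = IsModuleFromLeft.isModule {commutativeRing = 𝕜} (record { isLeftModule = record
      { isLeftSemimodule = record
        { +ᴹ-isCommutativeMonoid = record
          { isMonoid = record
            { isSemigroup = record
              { isMagma = record
                { isEquivalence = record
                  { refl  = λ _ → 𝕜.refl
                  ; sym   = λ p m → 𝕜.sym (p m)
                  ; trans = λ p q m → 𝕜.trans (p m) (q m) }
                ; ∙-cong = λ p q m → 𝕜.+-cong (p m) (q m) }
              ; assoc = λ _ _ _ _ → 𝕜.+-assoc _ _ _ }
            ; identity = (λ _ _ → 𝕜.+-identityˡ _) , (λ _ _ → 𝕜.+-identityʳ _) }
          ; comm = λ _ _ _ → 𝕜.+-comm _ _ }
        ; isPreleftSemimodule = record
          { *ₗ-cong = λ p q m → 𝕜.*-cong p (q m)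
          ; *ₗ-zeroˡ = λ _ _ → 𝕜.zeroˡ _
          ; *ₗ-distribʳ = λ _ _ _ _ → 𝕜.distribʳ _ _ _
          ; *ₗ-identityˡ = λ _ _ → 𝕜.*-identityˡ _
          ; *ₗ-assoc = λ _ _ _ _ → 𝕜.*-assoc _ _ _
          ; *ₗ-zeroʳ = λ _ _ → 𝕜.zeroʳ _
          ; *ₗ-distribˡ = λ _ _ _ _ → 𝕜.distribˡ _ _ _ } }
      ; -ᴹ‿cong = λ p m → 𝕜.-‿cong (p m)
      ; -ᴹ‿inverse = (λ _ _ → 𝕜.-‿inverseˡ _) , (λ _ _ → 𝕜.-‿inverseʳ _) } }) }

  sum-map-cong : ∀ {X : Set} {f g : X → K} → (∀ x → f x ≈ᴷ g x) →
                 ∀ xs → sumᴷ (List.map f xs) ≈ᴷ sumᴷ (List.map g xs)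
  sum-map-cong p []       = 𝕜.refl
  sum-map-cong p (x ∷ xs) = 𝕜.+-cong (p x) (sum-map-cong p xs)

  sumOverFactorisations :
    ∀ {n} → (Monomial n → Monomial n → K) → Monomial n → K
  sumOverFactorisations c m = sumᴷ (List.map (λ (p , q) → c p q) (factorisations m))

  sumOverFactorisations-∷ʳ : (c : ∀ {n} → Monomial n → Monomial n → K) →
    (∀ {n} (p q : Monomial n) → c (p ∷ʳ 𝟎) (q ∷ʳ 𝟎) ≈ᴷ c p q) →
    ∀ {n} (m : Monomial n) →
    sumOverFactorisations c (m ∷ʳ 𝟎) ≈ᴷ sumOverFactorisations c m
  sumOverFactorisations-∷ʳ c p m rewrite factorisations-∷ʳ m =
    𝕜.trans (𝕜.reflexive (cong sumᴷ (sym (List.map-∘ (factorisations m)))))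
            (sum-map-cong (λ (q , r) → p q r) (factorisations m))

  infixl 7 _·ˢ_

  _·ˢ_ : Series → Series → Series
  f ·ˢ g = record
    { coeff    = sumOverFactorisations (λ p q → coeff f p *ᴷ coeff g q)
    ; coeff-∷ʳ = sumOverFactorisations-∷ʳ (λ p q → coeff f p *ᴷ coeff g q)
                   (λ p q → 𝕜.*-cong (coeff-∷ʳ f p) (coeff-∷ʳ g q)) }

  -- All sequences i₁ < … < iₖ of elements of Fin n; for k > 0 and n > 0, those
  -- with i₁ = 0 come first.
  increasing : ∀ k n → List (Vec (Fin n) k)
  increasing zero    n       = [] ∷ []
  increasing (suc k) zero    = []
  increasing (suc k) (suc n) =
    List.map (λ is → zero ∷ Vec.map suc is) (increasing k n) ++
    List.map (Vec.map suc) (increasing (suc k) n)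

  -- i₁ ^ α₁ ·ᵐ … ·ᵐ iₖ ^ αₖ
  term : ∀ {k n} → Vec (Fin n) k → Vec Exp k → Monomial n
  term is αs = Vec.foldr′ _·ᵐ_ 𝟏ᵐ (Vec.zipWith _^_ is αs)

  -- Since all αⱼ are nonzero, the terms of M that are monomials in the
  -- variables of index < n are those with iₖ < n.
  coeffM : ∀ {k n} → Vec Exp k → Monomial n → K
  coeffM {k} {n} αs m = sumᴷ (List.map (λ is → ⟦ term is αs ≟ᵐ m ⟧) (increasing k n))

  -- Compositions for exponents in ℕ, bicompositions for exponents in ℕ × ℕ.

  NonzeroExp : Set
  NonzeroExp = Σ[ α ∈ Exp ] α ≢ 𝟎

  Composition : Set
  Composition = List NonzeroExp

  deg : Composition → Exp
  deg []            = 𝟎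
  deg ((α , _) ∷ 𝔞) = α + deg 𝔞

  deconcatenations : Composition → List (Composition × Composition)
  deconcatenations []      = ([] , []) ∷ []
  deconcatenations (α ∷ 𝔞) = ([] , α ∷ 𝔞) ∷ List.map (Product.map₁ (α ∷_)) (deconcatenations 𝔞)

  parts : (𝔞 : Composition) → Vec Exp (length 𝔞)
  parts 𝔞 = Vec.map proj₁ (Vec.fromList 𝔞)

  private
    sum-++ : ∀ xs ys → sumᴷ (xs ++ ys) ≈ᴷ sumᴷ xs +ᴷ sumᴷ ys
    sum-++ []       ys = 𝕜.sym (𝕜.+-identityˡ _)
    sum-++ (x ∷ xs) ys = 𝕜.trans (𝕜.+-congˡ (sum-++ xs ys)) (𝕜.sym (𝕜.+-assoc _ _ _))

    sum-*ˡ : ∀ {X : Set} r (f : X → K) xs →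
             sumᴷ (List.map (λ x → r *ᴷ f x) xs) ≈ᴷ r *ᴷ sumᴷ (List.map f xs)
    sum-*ˡ r f []       = 𝕜.sym (𝕜.zeroʳ r)
    sum-*ˡ r f (x ∷ xs) = 𝕜.trans (𝕜.+-congˡ (sum-*ˡ r f xs)) (𝕜.sym (𝕜.distribˡ _ _ _))

    ⟦∷⟧ : ∀ {n} a b (p q : Monomial n) → ⟦ (a ∷ p) ≟ᵐ (b ∷ q) ⟧ ≈ᴷ ⟦ a ≟ b ⟧ *ᴷ ⟦ p ≟ᵐ q ⟧
    ⟦∷⟧ a b p q with a ≟ b | p ≟ᵐ q
    ... | yes _ | yes _ = 𝕜.sym (𝕜.*-identityˡ _)
    ... | yes _ | no  _ = 𝕜.sym (𝕜.*-identityˡ _)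
    ... | no  _ | yes _ = 𝕜.sym (𝕜.zeroˡ _)
    ... | no  _ | no  _ = 𝕜.sym (𝕜.zeroˡ _)

    term-suc : ∀ {k n} (is : Vec (Fin n) k) αs → term (Vec.map suc is) αs ≡ 𝟎 ∷ term is αs
    term-suc []       []       = refl
    term-suc (i ∷ is) (α ∷ αs) rewrite term-suc is αs =
      cong (_∷ term (i ∷ is) (α ∷ αs)) (+-identityˡ 𝟎)

    term-zero : ∀ {k n} (is : Vec (Fin n) k) α αs →
                term (zero ∷ Vec.map suc is) (α ∷ αs) ≡ α ∷ term is αs
    term-zero is α αs rewrite term-suc is αs =
      cong₂ _∷_ (+-identityʳ α) (Vec.zipWith-identityˡ +-identityˡ (term is αs))

  -- Distinguishing the sequences with i₁ = 0 from those with i₁ > 0.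
  coeffM-∷-∷ : ∀ {k n} α (αs : Vec Exp k) e (m : Monomial n) →
    coeffM (α ∷ αs) (e ∷ m) ≈ᴷ ⟦ α ≟ e ⟧ *ᴷ coeffM αs m +ᴷ ⟦ 𝟎 ≟ e ⟧ *ᴷ coeffM (α ∷ αs) m
  coeffM-∷-∷ {k} {n} α αs e m =
    𝕜.trans (𝕜.reflexive (cong sumᴷ (List.map-++ g (List.map z (increasing k n)) _)))
    (𝕜.trans (sum-++ (List.map g (List.map z (increasing k n))) _)
    (𝕜.+-cong
      (𝕜.trans (𝕜.reflexive (cong sumᴷ (sym (List.map-∘ (increasing k n)))))
      (𝕜.trans (sum-map-cong
                 (λ is → 𝕜.trans (𝕜.reflexive (cong (λ t → ⟦ t ≟ᵐ (e ∷ m) ⟧) (term-zero is α αs)))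
                                 (⟦∷⟧ α e (term is αs) m))
                 (increasing k n))
               (sum-*ˡ ⟦ α ≟ e ⟧ _ (increasing k n))))
      (𝕜.trans (𝕜.reflexive (cong sumᴷ (sym (List.map-∘ (increasing (suc k) n)))))
      (𝕜.trans (sum-map-cong
                 (λ is → 𝕜.trans (𝕜.reflexive (cong (λ t → ⟦ t ≟ᵐ (e ∷ m) ⟧) (term-suc is (α ∷ αs))))
                                 (⟦∷⟧ 𝟎 e (term is (α ∷ αs)) m))
                 (increasing (suc k) n))
               (sum-*ˡ ⟦ 𝟎 ≟ e ⟧ _ (increasing (suc k) n))))))
    where
    g : Vec (Fin (suc n)) (suc k) → K
    g is = ⟦ term is (α ∷ αs) ≟ᵐ (e ∷ m) ⟧
    z : Vec (Fin n) k → Vec (Fin (suc n)) (suc k)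
    z is = zero ∷ Vec.map suc is

  coeffM-[]-∷ : ∀ {n} e (m : Monomial n) → coeffM [] (e ∷ m) ≈ᴷ ⟦ 𝟎 ≟ e ⟧ *ᴷ coeffM [] m
  coeffM-[]-∷ e m =
    𝕜.trans (𝕜.+-congʳ (⟦∷⟧ 𝟎 e 𝟏ᵐ m))
    (𝕜.trans (𝕜.+-identityʳ _) (𝕜.*-congˡ (𝕜.sym (𝕜.+-identityʳ _))))

  coeffM-∷ʳ : ∀ 𝔞 {n} (m : Monomial n) → coeffM (parts 𝔞) (m ∷ʳ 𝟎) ≈ᴷ coeffM (parts 𝔞) m
  coeffM-∷ʳ [] [] =
    𝕜.trans (coeffM-[]-∷ 𝟎 [])
    (𝕜.trans (𝕜.*-congʳ (𝕜.reflexive (cong (if_then 1ᴷ else 0ᴷ) (dec-true (𝟎 ≟ 𝟎) refl))))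
             (𝕜.*-identityˡ _))
  coeffM-∷ʳ [] (e ∷ m) =
    𝕜.trans (coeffM-[]-∷ e (m ∷ʳ 𝟎))
    (𝕜.trans (𝕜.*-congˡ (coeffM-∷ʳ [] m)) (𝕜.sym (coeffM-[]-∷ e m)))
  coeffM-∷ʳ ((α , α≢𝟎) ∷ 𝔞) [] =
    𝕜.trans (coeffM-∷-∷ α (parts 𝔞) 𝟎 [])
    (𝕜.trans (𝕜.+-cong
               (𝕜.*-congʳ (𝕜.reflexive (cong (if_then 1ᴷ else 0ᴷ) (dec-false (α ≟ 𝟎) α≢𝟎))))
               (𝕜.zeroʳ _))
    (𝕜.trans (𝕜.+-identityʳ _) (𝕜.zeroˡ _)))
  coeffM-∷ʳ (α ∷ 𝔞) (e ∷ m) =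
    𝕜.trans (coeffM-∷-∷ (proj₁ α) (parts 𝔞) e (m ∷ʳ 𝟎))
    (𝕜.trans (𝕜.+-cong (𝕜.*-congˡ (coeffM-∷ʳ 𝔞 m)) (𝕜.*-congˡ (coeffM-∷ʳ (α ∷ 𝔞) m)))
             (𝕜.sym (coeffM-∷-∷ (proj₁ α) (parts 𝔞) e m)))

  Mˢ : Composition → Series
  Mˢ 𝔞 = record { coeff = coeffM (parts 𝔞) ; coeff-∷ʳ = coeffM-∷ʳ 𝔞 }

  -- The space spanned by the series Mˢ 𝔞, as a subspace of all formal series.
  -- Hence equality in QS is equality of series.
  QS : Mod
  QS = SpanModule SeriesModule Mˢ

  series : ∣ QS ∣ → Series
  series = proj₁

  M : Composition → ∣ QS ∣
  M 𝔞 = Mˢ 𝔞 , gen 𝔞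

  QS₍_₎ : Exp → Pred ∣ QS ∣ 0ℓ
  QS₍ d ₎ = Span QS {I = Σ[ 𝔞 ∈ Composition ] deg 𝔞 ≡ d} (M ∘ proj₁)

  δ₀ : Composition → K
  δ₀ []      = 1ᴷ
  δ₀ (_ ∷ _) = 0ᴷ

  record IsQuasiSymmetricHopf (H : HopfStructure QS) : Set where
    open HopfStructure H
    open Module SeriesModule using () renaming (_≈ᴹ_ to _≈ˢ_)
    open Module QS using (_≈ᴹ_)

    field
      ·-series : ∀ x y → series (x · y) ≈ˢ series x ·ˢ series y
      𝟏-M      : 𝟏 ≈ᴹ M []
      Δ-M      : ∀ 𝔞 → _≈ᵀ_ QS QS (Δ (M 𝔞))
                   (sumᴹ (QS ⊗ᴹ QS)
                     (List.map (λ (𝔞₁ , 𝔞₂) → M 𝔞₁ ⊗ M 𝔞₂) (deconcatenations 𝔞)))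
      ε-M      : ∀ 𝔞 → ε (M 𝔞) ≈ᴷ δ₀ 𝔞

------------------------------------------------------------------------
-- DQSym and QSym over ℚ

open LinearAlgebra ℚ.+-*-commutativeRing public

module DQ = QuasiSymmetric ℚ.+-*-commutativeRing ℕ²-exponents
module Q  = QuasiSymmetric ℚ.+-*-commutativeRing ℕ-exponents

module ℕ² = Exponents ℕ²-exponents

DQSym : Mod
DQSym = DQ.QS

QSym : Mod
QSym = Q.QS

DQSymTotal₍_₎ : ℕ → Pred ∣ DQSym ∣ 0ℓ
DQSymTotal₍ n ₎ =
  Span DQSym {I = Σ[ (d₁ , d₂) ∈ ℕ × ℕ ] (d₁ ℕ.+ d₂ ≡ n) × ∃ DQ.QS₍ d₁ , d₂ ₎}
             (λ (_ , _ , x , _) → x)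

-- The substitution yᵢ = xᵢ: the coefficient of x^c is the sum of the
-- coefficients of x^a y^b over all a + b = c.
setEqual : DQ.Series → Q.Series
setEqual f = record
  { coeff    = Q.sumOverFactorisations (λ p q → DQ.coeff f (Vec.zip p q))
  ; coeff-∷ʳ = Q.sumOverFactorisations-∷ʳ (λ p q → DQ.coeff f (Vec.zip p q))
      (λ p q → trans (cong (DQ.coeff f) (zip-∷ʳ p q)) (DQ.coeff-∷ʳ f (Vec.zip p q))) }
  where
  zip-∷ʳ : ∀ {n} (p q : Vec ℕ n) → Vec.zip (p ∷ʳ 0) (q ∷ʳ 0) ≡ Vec.zip p q ∷ʳ (0 , 0)
  zip-∷ʳ []      []      = refl
  zip-∷ʳ (a ∷ p) (b ∷ q) = cong (_ ∷_) (zip-∷ʳ p q)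

{-# OPTIONS --safe #-}
module Submission where

-- The proof treats DQSym and QSym at once, as the module QS of quasi-symmetric
-- series for an arbitrary kind of exponents over a commutative ring K.
--
-- The series M 𝔞 are linearly independent, because the coefficient of M 𝔞 at
-- the monomial whose exponents are the parts of 𝔟 is 1 if 𝔞 = 𝔟 and 0 otherwise
-- (coeff-parts-∼ and coeff-parts-≁).  Hence a linear map from QS may be defined
-- by its values on the M 𝔞 (Extension), and two linear maps are equal if they
-- agree there (linear-unique).  All identities are thereby reduced to the M 𝔞,
-- where they become identities between sums over deconcatenations and sums over
-- quasi-shuffles.
--
-- The product of M 𝔞 and M 𝔟 is the sum of M 𝔠 over the quasi-shuffles 𝔠 of 𝔞
-- and 𝔟 (cM-✶): consider which of the two factors contribute to the variables
-- of smallest index.  So QS is a subring of the formal series, associative by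
-- Σqsh-assoc.  Coassociativity is Σdecon-assoc, and the comultiplication is
-- multiplicative by Σqsh-Σdecon: to cut a quasi-shuffle is to cut 𝔞 and 𝔟 and
-- to quasi-shuffle their beginnings and their ends.
--
-- The antipode is the inverse of M for the convolution of maps from
-- compositions to QS.  A map f with f [] = M [] has a right inverse, obtained
-- by recursion on the length (⋆-inverseʳ); applying this twice shows that it is
-- also a left inverse (⋆-inverseˡ).
--
-- All structure maps respect degrees because deconcatenation and
-- quasi-shuffling do (Σdecon-deg and Σqsh-deg), and the sum of the homogeneous
-- components is direct because a homogeneous series only has coefficients at
-- monomials of its degree (homogeneous-coeff).  The bidegree, the total degree
-- and the degree on QSym are images of the degree of compositions under
-- homomorphisms of monoids.
--
-- The map (a , b) ↦ a + b on exponents is additive and kills no nonzero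
-- exponent, so that applying it to the parts of compositions commutes with
-- deconcatenations and quasi-shuffles and yields a morphism π of Hopf algebras.
-- It is the substitution of x for y by diagonal-M.

open import Defs
  using (Exponents; module Exponents; ℕ-exponents; ℕ²-exponents; module LinearAlgebra; module QuasiSymmetric)
open import Algebra.Bundles using (CommutativeMonoid; CommutativeRing; CommutativeSemigroup)
open import Algebra.Core using (Op₂)
open import Algebra.Module.Bundles using (Module)
open import Algebra.Module.Morphism.Structures using (module ModuleMorphisms)
import Algebra.Properties.AbelianGroup as AbelianGroupProperties
import Algebra.Properties.CommutativeSemigroup as CommutativeSemigroupProperties
import Algebra.Solver.CommutativeMonoid as CommutativeMonoidSolver
open import Algebra.Structures using (IsCommutativeMonoid; IsRing)
open import Data.Bool.Base using (if_then_else_)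
open import Data.Empty using (⊥)
open import Data.List.Base as List using (List; []; _∷_; _++_; cartesianProductWith)
open import Data.List.Membership.Propositional using (_∈_)
open import Data.List.Membership.Setoid.Properties using (∈-deduplicate⁺)
import Data.List.Properties as List
open import Data.List.Relation.Binary.Pointwise as Pointwise using (Pointwise; []; _∷_)
open import Data.List.Relation.Unary.All as All using (All; []; _∷_)
import Data.List.Relation.Unary.All.Properties as All
open import Data.List.Relation.Unary.AllPairs using (AllPairs; []; _∷_)
open import Data.List.Relation.Unary.Any using (Any; here; there)
open import Data.List.Relation.Unary.Unique.DecSetoid using (Unique)
open import Data.List.Relation.Unary.Unique.DecSetoid.Properties using (deduplicate-!)
open import Data.List.Relation.Unary.Unique.Propositional using () renaming (Unique to Unique≡)
open import Data.Nat.Base as ℕ using (ℕ; suc)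
import Data.Nat.Properties as ℕ
open import Data.Product.Base using (Σ-syntax; ∃; _×_; _,_; proj₁; proj₂)
import Data.Rational.Properties as ℚ
open import Data.Vec.Base as Vec using ([]; _∷_)
open import Function.Base using (id; _∘_)
open import Function.Bundles using (Equivalence)
open import Level using (0ℓ)
open import Relation.Binary.Bundles using (DecSetoid)
import Relation.Binary.Construct.On as On
open import Relation.Binary.Definitions using (DecidableEquality)
open import Relation.Binary.PropositionalEquality as ≡
  using (_≡_; _≢_; refl; sym; trans; cong; cong₂; subst)
import Relation.Binary.Reasoning.Setoid as SetoidReasoning
open import Relation.Nullary using (¬_; contradiction)
open import Relation.Nullary.Decidable using (Dec; yes; no; dec-true; dec-false)
open import Relation.Unary using (Pred)

-- Linear and bilinear maps

module LinearMaps (𝕜 : CommutativeRing 0ℓ 0ℓ) where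

  open LinearAlgebra 𝕜
  open CommutativeRing 𝕜 using () renaming
    ( Carrier to K; 0# to 0ᴷ )
  private module 𝕜 = CommutativeRing 𝕜

  module _ (A B : Mod) {φ : ∣ A ∣ → ∣ B ∣} where
    private
      module A = Module A
      module B = Module B

    -- Preservation of zero and of negatives follows from the other laws.
    linear : (∀ {x y} → x A.≈ᴹ y → φ x B.≈ᴹ φ y) →
             (∀ x y → φ (x A.+ᴹ y) B.≈ᴹ φ x B.+ᴹ φ y) →
             (∀ r x → φ (r A.*ₗ x) B.≈ᴹ r B.*ₗ φ x) →
             IsLinear A B φ
    linear φ-cong φ-+ φ-* = record { isBimoduleHomomorphism = record
      { +ᴹ-isGroupHomomorphism = record
        { isMonoidHomomorphism = record
          { isMagmaHomomorphism = record
            { isRelHomomorphism = record { cong = φ-cong } ; homo = φ-+ }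
          ; ε-homo = φ-0 }
        ; ⁻¹-homo = λ x → AbelianGroupProperties.inverseˡ-unique B.+ᴹ-abelianGroup _ _
            (B.≈ᴹ-trans (B.≈ᴹ-sym (φ-+ (A.-ᴹ x) x)) (B.≈ᴹ-trans (φ-cong (A.-ᴹ‿inverseˡ x)) φ-0)) }
      ; *ₗ-homo = φ-*
      ; *ᵣ-homo = λ r x → B.≈ᴹ-trans (φ-cong (A.≈ᴹ-sym (A.*ₗ-*ᵣ-coincident r x)))
                           (B.≈ᴹ-trans (φ-* r x) (B.*ₗ-*ᵣ-coincident r (φ x))) } }
      where
      φ-0 : φ A.0ᴹ B.≈ᴹ B.0ᴹ
      φ-0 = B.≈ᴹ-trans (φ-cong (A.≈ᴹ-sym (A.*ₗ-zeroˡ A.0ᴹ)))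
           (B.≈ᴹ-trans (φ-* 0ᴷ A.0ᴹ) (B.*ₗ-zeroˡ _))

  module Linear (A B : Mod) {φ : ∣ A ∣ → ∣ B ∣} (φ-linear : IsLinear A B φ) =
    ModuleMorphisms.IsModuleHomomorphism φ-linear

  id-linear : (A : Mod) → IsLinear A A id
  id-linear A = linear A A id (λ _ _ → ≈ᴹ-refl) (λ _ _ → ≈ᴹ-refl)
    where open Module A using (≈ᴹ-refl)

  ∘-linear : (A B C : Mod) {φ : ∣ A ∣ → ∣ B ∣} {ψ : ∣ B ∣ → ∣ C ∣} →
             IsLinear B C ψ → IsLinear A B φ → IsLinear A C (ψ ∘ φ)
  ∘-linear A B C ψ-linear φ-linear = linear A C
    (λ p → ψ.⟦⟧-cong (φ.⟦⟧-cong p))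
    (λ x y → C.≈ᴹ-trans (ψ.⟦⟧-cong (φ.+ᴹ-homo x y)) (ψ.+ᴹ-homo _ _))
    (λ r x → C.≈ᴹ-trans (ψ.⟦⟧-cong (φ.*ₗ-homo r x)) (ψ.*ₗ-homo r _))
    where
    module C = Module C
    module φ = Linear A B φ-linear
    module ψ = Linear B C ψ-linear

  -- Multiples of a fixed vector.
  *ₗ-linear : (A B : Mod) {φ : ∣ A ∣ → K} → IsLinear A 𝟙 φ →
              (b : ∣ B ∣) → IsLinear A B (λ a → Module._*ₗ_ B (φ a) b)
  *ₗ-linear A B φ-linear b = linear A B
    (λ p → B.*ₗ-cong (φ.⟦⟧-cong p) B.≈ᴹ-refl)
    (λ x y → B.≈ᴹ-trans (B.*ₗ-cong (φ.+ᴹ-homo x y) B.≈ᴹ-refl) (B.*ₗ-distribʳ b _ _))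
    (λ r x → B.≈ᴹ-trans (B.*ₗ-cong (φ.*ₗ-homo r x) B.≈ᴹ-refl) (B.*ₗ-assoc r _ b))
    where
    module B = Module B
    module φ = Linear A 𝟙 φ-linear

  scale-linear : (A : Mod) (r : K) → IsLinear A A (Module._*ₗ_ A r)
  scale-linear A r = linear A A (A.*ₗ-cong 𝕜.refl) (A.*ₗ-distribˡ r)
    (λ s x → A.≈ᴹ-trans (A.≈ᴹ-sym (A.*ₗ-assoc r s x))
            (A.≈ᴹ-trans (A.*ₗ-cong (𝕜.*-comm r s) A.≈ᴹ-refl) (A.*ₗ-assoc s r x)))
    where module A = Module A

  -- Linearity in each argument.
  record IsBilinear (A B C : Mod) (h : ∣ A ∣ → ∣ B ∣ → ∣ C ∣) : Set where
    field
      linearˡ : ∀ b → IsLinear A C (λ a → h a b)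
      linearʳ : ∀ a → IsLinear B C (h a)

    private
      module A = Module A
      module B = Module B
      module C = Module C

    cong₂ᴹ : ∀ {a a′ b b′} → a A.≈ᴹ a′ → b B.≈ᴹ b′ → h a b C.≈ᴹ h a′ b′
    cong₂ᴹ {a} {a′} {b} p q =
      C.≈ᴹ-trans (Linear.⟦⟧-cong A C (linearˡ b) p) (Linear.⟦⟧-cong B C (linearʳ a′) q)

  open IsBilinear public

  ⊗-bilinear : (A B : Mod) → IsBilinear A B (A ⊗ᴹ B) _⊗_
  ⊗-bilinear A B = record
    { linearˡ = λ b → linear A (A ⊗ᴹ B) (λ p → ⊗-cong p B.≈ᴹ-refl) (⊗-distribʳ b) (λ r a → ⊗-scaleˡ r a b)
    ; linearʳ = λ a → linear B (A ⊗ᴹ B) (⊗-cong A.≈ᴹ-refl) (⊗-distribˡ a) (λ r → ⊗-scaleʳ r a) }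
    where
    module A = Module A
    module B = Module B

  ∘-bilinear : (A B C D E : Mod) {φ : ∣ A ∣ → ∣ C ∣} {ψ : ∣ B ∣ → ∣ D ∣} {h : ∣ C ∣ → ∣ D ∣ → ∣ E ∣} →
               IsBilinear C D E h → IsLinear A C φ → IsLinear B D ψ →
               IsBilinear A B E (λ a b → h (φ a) (ψ b))
  ∘-bilinear A B C D E h-bilinear φ-linear ψ-linear = record
    { linearˡ = λ b → ∘-linear A C E (linearˡ h-bilinear _) φ-linear
    ; linearʳ = λ a → ∘-linear B D E (linearʳ h-bilinear _) ψ-linear }

  -- A bilinear map induces a linear map on the tensor product.
  module _ {A B : Mod} (C : Mod) {h : ∣ A ∣ → ∣ B ∣ → ∣ C ∣} (h-bilinear : IsBilinear A B C h) where
    private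
      module C = Module C
      module hˡ b = Linear A C (linearˡ h-bilinear b)
      module hʳ a = Linear B C (linearʳ h-bilinear a)

    lift-cong : ∀ {t u} → _≈ᵀ_ A B t u → lift C h t C.≈ᴹ lift C h u
    lift-cong ≈-refl              = C.≈ᴹ-refl
    lift-cong (≈-sym p)           = C.≈ᴹ-sym (lift-cong p)
    lift-cong (≈-trans p q)       = C.≈ᴹ-trans (lift-cong p) (lift-cong q)
    lift-cong (⊕-cong p q)        = C.+ᴹ-cong (lift-cong p) (lift-cong q)
    lift-cong (⊙-cong r p)        = C.*ₗ-cong r (lift-cong p)
    lift-cong (⊗-cong p q)        = cong₂ᴹ h-bilinear p q
    lift-cong (⊕-assoc t u v)     = C.+ᴹ-assoc _ _ _
    lift-cong (⊕-comm t u)        = C.+ᴹ-comm _ _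
    lift-cong (⊕-identityˡ t)     = C.+ᴹ-identityˡ _
    lift-cong (⊙-zeroˡ t)         = C.*ₗ-zeroˡ _
    lift-cong (⊙-identityˡ t)     = C.*ₗ-identityˡ _
    lift-cong (⊙-assoc r s t)     = C.*ₗ-assoc _ _ _
    lift-cong (⊙-distribˡ r t u)  = C.*ₗ-distribˡ _ _ _
    lift-cong (⊙-distribʳ t r s)  = C.*ₗ-distribʳ _ _ _
    lift-cong (⊗-distribˡ a b b′) = hʳ.+ᴹ-homo a b b′
    lift-cong (⊗-distribʳ b a a′) = hˡ.+ᴹ-homo b a a′
    lift-cong (⊗-scaleˡ r a b)    = hˡ.*ₗ-homo b r a
    lift-cong (⊗-scaleʳ r a b)    = hʳ.*ₗ-homo a r b

    lift-linear : IsLinear (A ⊗ᴹ B) C (lift C h)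
    lift-linear = linear (A ⊗ᴹ B) C lift-cong (λ _ _ → C.≈ᴹ-refl) (λ _ _ → C.≈ᴹ-refl)

  -- If h d a b depends linearly on d, then so does the value of lift (h d) at a
  -- tensor.
  lift-parameter : {A B : Mod} (C D : Mod) {h : ∣ D ∣ → ∣ A ∣ → ∣ B ∣ → ∣ C ∣} →
                   (∀ a b → IsLinear D C (λ d → h d a b)) →
                   ∀ (t : Tensor A B) → IsLinear D C (λ d → lift C (h d) t)
  lift-parameter C D h-linear (a ⊗ b) = h-linear a b
  lift-parameter C D h-linear 𝟘       =
    linear D C (λ _ → C.≈ᴹ-refl) (λ _ _ → C.≈ᴹ-sym (C.+ᴹ-identityˡ _)) (λ r _ → C.≈ᴹ-sym (C.*ₗ-zeroʳ r))
    where module C = Module C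
  lift-parameter C D h-linear (t ⊕ u) = linear D C
    (λ p → C.+ᴹ-cong (t.⟦⟧-cong p) (u.⟦⟧-cong p))
    (λ x y → C.≈ᴹ-trans (C.+ᴹ-cong (t.+ᴹ-homo x y) (u.+ᴹ-homo x y)) (interchange _ _ _ _))
    (λ r x → C.≈ᴹ-trans (C.+ᴹ-cong (t.*ₗ-homo r x) (u.*ₗ-homo r x)) (C.≈ᴹ-sym (C.*ₗ-distribˡ r _ _)))
    where
    module C = Module C
    module t = Linear D C (lift-parameter C D h-linear t)
    module u = Linear D C (lift-parameter C D h-linear u)
    open CommutativeSemigroupProperties (CommutativeMonoid.commutativeSemigroup C.+ᴹ-commutativeMonoid)
      using (interchange)
  lift-parameter C D h-linear (r ⊙ t) =
    ∘-linear D C C (scale-linear C r) (lift-parameter C D h-linear t)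

  map⊗-linear : (A B C D : Mod) {φ : ∣ A ∣ → ∣ C ∣} {ψ : ∣ B ∣ → ∣ D ∣} →
                IsLinear A C φ → IsLinear B D ψ →
                IsLinear (A ⊗ᴹ B) (C ⊗ᴹ D) (map⊗ {A} {B} {C} {D} φ ψ)
  map⊗-linear A B C D φ-linear ψ-linear =
    lift-linear (C ⊗ᴹ D) (∘-bilinear A B C D (C ⊗ᴹ D) (⊗-bilinear C D) φ-linear ψ-linear)

  assoc⊗-linear : (A B C : Mod) →
                  IsLinear ((A ⊗ᴹ B) ⊗ᴹ C) (A ⊗ᴹ (B ⊗ᴹ C)) (assoc⊗ {A} {B} {C})
  assoc⊗-linear A B C = lift-linear ABC (record
    { linearˡ = λ c → lift-linear ABC (record
      { linearˡ = λ b → linearˡ (⊗-bilinear A (B ⊗ᴹ C)) (b ⊗ c)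
      ; linearʳ = λ a → ∘-linear B (B ⊗ᴹ C) ABC (linearʳ (⊗-bilinear A (B ⊗ᴹ C)) a)
                                                (linearˡ (⊗-bilinear B C) c) })
    ; linearʳ = lift-parameter ABC C
        (λ a b → ∘-linear C (B ⊗ᴹ C) ABC (linearʳ (⊗-bilinear A (B ⊗ᴹ C)) a)
                                         (linearʳ (⊗-bilinear B C) b)) })
    where
    ABC : Mod
    ABC = A ⊗ᴹ (B ⊗ᴹ C)

-- Sums over deconcatenations and quasi-shuffles

module CompositionSums (𝕜 : CommutativeRing 0ℓ 0ℓ) (E : Exponents) where

  open LinearAlgebra 𝕜
  open LinearMaps 𝕜
  open Exponents E using (_+_; +-conical; +-isCommutativeMonoid)
  open QuasiSymmetric 𝕜 E using (NonzeroExp; Composition; deconcatenations)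
  private module +ᴱ = IsCommutativeMonoid +-isCommutativeMonoid

  infix 4 _∼_

  -- Equality of compositions, disregarding the proofs that the parts are
  -- nonzero.
  _∼_ : Composition → Composition → Set
  _∼_ = Pointwise (λ α β → proj₁ α ≡ proj₁ β)

  ∼-refl : ∀ {𝔞} → 𝔞 ∼ 𝔞
  ∼-refl = Pointwise.refl refl

  infixl 6 _⊞_

  -- Addition of nonzero exponents.
  _⊞_ : NonzeroExp → NonzeroExp → NonzeroExp
  (α , α≢𝟎) ⊞ (β , _) = α + β , λ eq → α≢𝟎 (proj₁ (+-conical α β eq))

  -- Sums over deconcatenations and over quasi-shuffles, with values in a
  -- module B.

  module Sums (B : Mod) where
    open Module B
    open SetoidReasoning ≈ᴹ-setoid
    open CommutativeSemigroupProperties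
      (CommutativeMonoid.commutativeSemigroup +ᴹ-commutativeMonoid) using (interchange)
    open CommutativeMonoidSolver +ᴹ-commutativeMonoid using (solve; _⊜_) renaming (_⊕_ to _⊕ᵉ_)

    -- The sum of F 𝔞₁ 𝔞₂ over all 𝔞₁ · 𝔞₂ = 𝔞.
    Σdecon : (Composition → Composition → ∣ B ∣) → Composition → ∣ B ∣
    Σdecon F []      = F [] []
    Σdecon F (α ∷ 𝔞) = F [] (α ∷ 𝔞) +ᴹ Σdecon (λ 𝔞₁ → F (α ∷ 𝔞₁)) 𝔞

    -- The sum of F 𝔠 over the quasi-shuffles 𝔠 of 𝔞 and 𝔟, with multiplicities:
    -- the first part of 𝔠 is the first part of 𝔞, that of 𝔟, or their sum.
    Σqsh : (Composition → ∣ B ∣) → Composition → Composition → ∣ B ∣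
    Σqsh F []      𝔟       = F 𝔟
    Σqsh F (α ∷ 𝔞) []      = F (α ∷ 𝔞)
    Σqsh F (α ∷ 𝔞) (β ∷ 𝔟) =
      Σqsh (λ 𝔠 → F (α ∷ 𝔠)) 𝔞 (β ∷ 𝔟) +ᴹ
      (Σqsh (λ 𝔠 → F (β ∷ 𝔠)) (α ∷ 𝔞) 𝔟 +ᴹ Σqsh (λ 𝔠 → F (α ⊞ β ∷ 𝔠)) 𝔞 𝔟)

    -- F 𝔞 depends only on the parts of 𝔞.
    Respects∼ : (Composition → ∣ B ∣) → Set
    Respects∼ F = ∀ {𝔞 𝔞′} → 𝔞 ∼ 𝔞′ → F 𝔞 ≈ᴹ F 𝔞′

    +-cong₃ : ∀ {x x′ y y′ z z′} → x ≈ᴹ x′ → y ≈ᴹ y′ → z ≈ᴹ z′ →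
              x +ᴹ (y +ᴹ z) ≈ᴹ x′ +ᴹ (y′ +ᴹ z′)
    +-cong₃ p q r = +ᴹ-cong p (+ᴹ-cong q r)

    Σdecon-∼ : ∀ {F G} →
               (∀ {𝔞₁ 𝔞₁′ 𝔞₂ 𝔞₂′} → 𝔞₁ ∼ 𝔞₁′ → 𝔞₂ ∼ 𝔞₂′ → F 𝔞₁ 𝔞₂ ≈ᴹ G 𝔞₁′ 𝔞₂′) →
               ∀ {𝔞 𝔞′} → 𝔞 ∼ 𝔞′ → Σdecon F 𝔞 ≈ᴹ Σdecon G 𝔞′
    Σdecon-∼ F≈G []      = F≈G [] []
    Σdecon-∼ F≈G (p ∷ q) = +ᴹ-cong (F≈G [] (p ∷ q)) (Σdecon-∼ (λ r → F≈G (p ∷ r)) q)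

    Σdecon-cong : ∀ {F G} → (∀ 𝔞₁ 𝔞₂ → F 𝔞₁ 𝔞₂ ≈ᴹ G 𝔞₁ 𝔞₂) → ∀ 𝔞 → Σdecon F 𝔞 ≈ᴹ Σdecon G 𝔞
    Σdecon-cong F≈G []      = F≈G [] []
    Σdecon-cong F≈G (α ∷ 𝔞) = +ᴹ-cong (F≈G [] (α ∷ 𝔞)) (Σdecon-cong (λ 𝔞₁ → F≈G (α ∷ 𝔞₁)) 𝔞)

    Σdecon-+ : ∀ F G 𝔞 → Σdecon (λ 𝔞₁ 𝔞₂ → F 𝔞₁ 𝔞₂ +ᴹ G 𝔞₁ 𝔞₂) 𝔞 ≈ᴹ Σdecon F 𝔞 +ᴹ Σdecon G 𝔞
    Σdecon-+ F G []      = ≈ᴹ-refl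
    Σdecon-+ F G (α ∷ 𝔞) = ≈ᴹ-trans
      (+ᴹ-cong ≈ᴹ-refl (Σdecon-+ (λ 𝔞₁ → F (α ∷ 𝔞₁)) (λ 𝔞₁ → G (α ∷ 𝔞₁)) 𝔞))
      (interchange _ _ _ _)

    Σdecon-zero : ∀ {F} → (∀ 𝔞₁ 𝔞₂ → F 𝔞₁ 𝔞₂ ≈ᴹ 0ᴹ) → ∀ 𝔞 → Σdecon F 𝔞 ≈ᴹ 0ᴹ
    Σdecon-zero F≈0 []      = F≈0 [] []
    Σdecon-zero F≈0 (α ∷ 𝔞) = ≈ᴹ-trans
      (+ᴹ-cong (F≈0 [] (α ∷ 𝔞)) (Σdecon-zero (λ 𝔞₁ → F≈0 (α ∷ 𝔞₁)) 𝔞)) (+ᴹ-identityˡ 0ᴹ)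

    -- Both sides sum F over all 𝔞₁ · 𝔞₂ · 𝔞₃ = 𝔞.
    Σdecon-assoc : ∀ F 𝔞 →
      Σdecon (λ 𝔞₁₂ 𝔞₃ → Σdecon (λ 𝔞₁ 𝔞₂ → F 𝔞₁ 𝔞₂ 𝔞₃) 𝔞₁₂) 𝔞 ≈ᴹ
      Σdecon (λ 𝔞₁ 𝔞₂₃ → Σdecon (F 𝔞₁) 𝔞₂₃) 𝔞
    Σdecon-assoc F []      = ≈ᴹ-refl
    Σdecon-assoc F (α ∷ 𝔞) = begin
      F [] [] (α ∷ 𝔞) +ᴹ Σdecon (λ 𝔞₁₂ 𝔞₃ → F [] (α ∷ 𝔞₁₂) 𝔞₃ +ᴹ
        Σdecon (λ 𝔞₁ 𝔞₂ → F (α ∷ 𝔞₁) 𝔞₂ 𝔞₃) 𝔞₁₂) 𝔞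
        ≈⟨ +ᴹ-cong ≈ᴹ-refl (Σdecon-+ (λ 𝔞₁₂ 𝔞₃ → F [] (α ∷ 𝔞₁₂) 𝔞₃) _ 𝔞) ⟩
      F [] [] (α ∷ 𝔞) +ᴹ (Σdecon (λ 𝔞₁₂ 𝔞₃ → F [] (α ∷ 𝔞₁₂) 𝔞₃) 𝔞 +ᴹ
        Σdecon (λ 𝔞₁₂ 𝔞₃ → Σdecon (λ 𝔞₁ 𝔞₂ → F (α ∷ 𝔞₁) 𝔞₂ 𝔞₃) 𝔞₁₂) 𝔞)
        ≈⟨ +ᴹ-assoc _ _ _ ⟨
      Σdecon (F []) (α ∷ 𝔞) +ᴹ
        Σdecon (λ 𝔞₁₂ 𝔞₃ → Σdecon (λ 𝔞₁ 𝔞₂ → F (α ∷ 𝔞₁) 𝔞₂ 𝔞₃) 𝔞₁₂) 𝔞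
        ≈⟨ +ᴹ-cong ≈ᴹ-refl (Σdecon-assoc (λ 𝔞₁ → F (α ∷ 𝔞₁)) 𝔞) ⟩
      Σdecon (F []) (α ∷ 𝔞) +ᴹ Σdecon (λ 𝔞₁ 𝔞₂₃ → Σdecon (F (α ∷ 𝔞₁)) 𝔞₂₃) 𝔞 ∎

    Σdecon-deconcatenations : ∀ F 𝔞 →
      sumᴹ B (List.map (λ (𝔞₁ , 𝔞₂) → F 𝔞₁ 𝔞₂) (deconcatenations 𝔞)) ≈ᴹ Σdecon F 𝔞
    Σdecon-deconcatenations F []      = +ᴹ-identityʳ _
    Σdecon-deconcatenations F (α ∷ 𝔞) = +ᴹ-cong ≈ᴹ-refl (≈ᴹ-trans
      (≈ᴹ-reflexive (cong (sumᴹ B) (sym (List.map-∘ (deconcatenations 𝔞)))))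
      (Σdecon-deconcatenations (λ 𝔞₁ → F (α ∷ 𝔞₁)) 𝔞))

    Σqsh-∼ : ∀ {F G} → (∀ {𝔠 𝔠′} → 𝔠 ∼ 𝔠′ → F 𝔠 ≈ᴹ G 𝔠′) →
             ∀ {𝔞 𝔞′ 𝔟 𝔟′} → 𝔞 ∼ 𝔞′ → 𝔟 ∼ 𝔟′ → Σqsh F 𝔞 𝔟 ≈ᴹ Σqsh G 𝔞′ 𝔟′
    Σqsh-∼ F≈G []      r       = F≈G r
    Σqsh-∼ F≈G (p ∷ q) []      = F≈G (p ∷ q)
    Σqsh-∼ F≈G (p ∷ q) (r ∷ s) = +-cong₃
      (Σqsh-∼ (λ t → F≈G (p ∷ t)) q (r ∷ s))
      (Σqsh-∼ (λ t → F≈G (r ∷ t)) (p ∷ q) s)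
      (Σqsh-∼ (λ t → F≈G (cong₂ _+_ p r ∷ t)) q s)

    Σqsh-cong : ∀ {F G} → (∀ 𝔠 → F 𝔠 ≈ᴹ G 𝔠) → ∀ 𝔞 𝔟 → Σqsh F 𝔞 𝔟 ≈ᴹ Σqsh G 𝔞 𝔟
    Σqsh-cong F≈G []      𝔟       = F≈G 𝔟
    Σqsh-cong F≈G (α ∷ 𝔞) []      = F≈G (α ∷ 𝔞)
    Σqsh-cong F≈G (α ∷ 𝔞) (β ∷ 𝔟) = +-cong₃
      (Σqsh-cong (λ 𝔠 → F≈G (α ∷ 𝔠)) 𝔞 (β ∷ 𝔟))
      (Σqsh-cong (λ 𝔠 → F≈G (β ∷ 𝔠)) (α ∷ 𝔞) 𝔟)
      (Σqsh-cong (λ 𝔠 → F≈G (α ⊞ β ∷ 𝔠)) 𝔞 𝔟)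

    Σqsh-zero : ∀ {F} → (∀ 𝔠 → F 𝔠 ≈ᴹ 0ᴹ) → ∀ 𝔞 𝔟 → Σqsh F 𝔞 𝔟 ≈ᴹ 0ᴹ
    Σqsh-zero F≈0 []      𝔟       = F≈0 𝔟
    Σqsh-zero F≈0 (α ∷ 𝔞) []      = F≈0 (α ∷ 𝔞)
    Σqsh-zero F≈0 (α ∷ 𝔞) (β ∷ 𝔟) = ≈ᴹ-trans
      (+-cong₃ (Σqsh-zero (λ 𝔠 → F≈0 (α ∷ 𝔠)) 𝔞 (β ∷ 𝔟))
               (Σqsh-zero (λ 𝔠 → F≈0 (β ∷ 𝔠)) (α ∷ 𝔞) 𝔟)
               (Σqsh-zero (λ 𝔠 → F≈0 (α ⊞ β ∷ 𝔠)) 𝔞 𝔟))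
      (≈ᴹ-trans (+ᴹ-identityˡ _) (+ᴹ-identityˡ 0ᴹ))

    Σqsh-identityʳ : ∀ F 𝔞 → Σqsh F 𝔞 [] ≈ᴹ F 𝔞
    Σqsh-identityʳ F []      = ≈ᴹ-refl
    Σqsh-identityʳ F (α ∷ 𝔞) = ≈ᴹ-refl

    Σqsh-+ : ∀ F G 𝔞 𝔟 → Σqsh (λ 𝔠 → F 𝔠 +ᴹ G 𝔠) 𝔞 𝔟 ≈ᴹ Σqsh F 𝔞 𝔟 +ᴹ Σqsh G 𝔞 𝔟
    Σqsh-+ F G []      𝔟       = ≈ᴹ-refl
    Σqsh-+ F G (α ∷ 𝔞) []      = ≈ᴹ-refl
    Σqsh-+ F G (α ∷ 𝔞) (β ∷ 𝔟) = ≈ᴹ-trans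
      (+-cong₃ (Σqsh-+ (λ 𝔠 → F (α ∷ 𝔠)) (λ 𝔠 → G (α ∷ 𝔠)) 𝔞 (β ∷ 𝔟))
               (Σqsh-+ (λ 𝔠 → F (β ∷ 𝔠)) (λ 𝔠 → G (β ∷ 𝔠)) (α ∷ 𝔞) 𝔟)
               (Σqsh-+ (λ 𝔠 → F (α ⊞ β ∷ 𝔠)) (λ 𝔠 → G (α ⊞ β ∷ 𝔠)) 𝔞 𝔟))
      (≈ᴹ-trans (+ᴹ-cong ≈ᴹ-refl (interchange _ _ _ _)) (interchange _ _ _ _))

    Σqsh-+₃ : ∀ F G H 𝔞 𝔟 → Σqsh (λ 𝔠 → F 𝔠 +ᴹ (G 𝔠 +ᴹ H 𝔠)) 𝔞 𝔟 ≈ᴹ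
                            Σqsh F 𝔞 𝔟 +ᴹ (Σqsh G 𝔞 𝔟 +ᴹ Σqsh H 𝔞 𝔟)
    Σqsh-+₃ F G H 𝔞 𝔟 = ≈ᴹ-trans (Σqsh-+ F (λ 𝔠 → G 𝔠 +ᴹ H 𝔠) 𝔞 𝔟) (+ᴹ-cong ≈ᴹ-refl (Σqsh-+ G H 𝔞 𝔟))

    -- The quasi-shuffle product is associative.  For nonempty 𝔞, 𝔟, 𝔠 both
    -- sides split into seven sums, according to the nonempty set of those
    -- among 𝔞, 𝔟, 𝔠 that contribute their first part to the first part of the
    -- result.
    Σqsh-assoc : ∀ F → Respects∼ F → ∀ 𝔞 𝔟 𝔠 →
      Σqsh (λ 𝔡 → Σqsh F 𝔡 𝔠) 𝔞 𝔟 ≈ᴹ Σqsh (Σqsh F 𝔞) 𝔟 𝔠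
    Σqsh-assoc F F-∼ []      𝔟       𝔠       = ≈ᴹ-refl
    Σqsh-assoc F F-∼ (α ∷ 𝔞) []      𝔠       = ≈ᴹ-refl
    Σqsh-assoc F F-∼ (α ∷ 𝔞) (β ∷ 𝔟) []      = Σqsh-cong (Σqsh-identityʳ F) (α ∷ 𝔞) (β ∷ 𝔟)
    Σqsh-assoc F F-∼ (α ∷ 𝔞) (β ∷ 𝔟) (γ ∷ 𝔠) = begin
      Σqsh (λ 𝔡 → Σqsh F 𝔡 (γ ∷ 𝔠)) (α ∷ 𝔞) (β ∷ 𝔟)
        ≈⟨ +-cong₃ (Σqsh-+₃ (λ 𝔡 → Σqsh (F ∘ (α ∷_)) 𝔡 (γ ∷ 𝔠))
                            (λ 𝔡 → Σqsh (F ∘ (γ ∷_)) (α ∷ 𝔡) 𝔠)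
                            (λ 𝔡 → Σqsh (F ∘ (α ⊞ γ ∷_)) 𝔡 𝔠) 𝔞 (β ∷ 𝔟))
                   (Σqsh-+₃ (λ 𝔡 → Σqsh (F ∘ (β ∷_)) 𝔡 (γ ∷ 𝔠))
                            (λ 𝔡 → Σqsh (F ∘ (γ ∷_)) (β ∷ 𝔡) 𝔠)
                            (λ 𝔡 → Σqsh (F ∘ (β ⊞ γ ∷_)) 𝔡 𝔠) (α ∷ 𝔞) 𝔟)
                   (Σqsh-+₃ (λ 𝔡 → Σqsh (F ∘ (α ⊞ β ∷_)) 𝔡 (γ ∷ 𝔠))
                            (λ 𝔡 → Σqsh (F ∘ (γ ∷_)) (α ⊞ β ∷ 𝔡) 𝔠)
                            (λ 𝔡 → Σqsh (F ∘ (α ⊞ β ⊞ γ ∷_)) 𝔡 𝔠) 𝔞 𝔟) ⟩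
      _ ≈⟨ solve 9 (λ α αγ β βγ αβ αβγ γ₁ γ₂ γ₃ →
             (α ⊕ᵉ (γ₁ ⊕ᵉ αγ)) ⊕ᵉ ((β ⊕ᵉ (γ₂ ⊕ᵉ βγ)) ⊕ᵉ (αβ ⊕ᵉ (γ₃ ⊕ᵉ αβγ))) ⊜
             α ⊕ᵉ (β ⊕ᵉ ((γ₁ ⊕ᵉ (γ₂ ⊕ᵉ γ₃)) ⊕ᵉ (αβ ⊕ᵉ (αγ ⊕ᵉ (βγ ⊕ᵉ αβγ))))))
             ≈ᴹ-refl _ _ _ _ _ _ _ _ _ ⟩
      _ ≈⟨ +ᴹ-cong (Σqsh-assoc (F ∘ (α ∷_)) (F-∼ ∘ (refl ∷_)) 𝔞 (β ∷ 𝔟) (γ ∷ 𝔠))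
          (+ᴹ-cong (Σqsh-assoc (F ∘ (β ∷_)) (F-∼ ∘ (refl ∷_)) (α ∷ 𝔞) 𝔟 (γ ∷ 𝔠))
          (+ᴹ-cong (Σqsh-assoc (F ∘ (γ ∷_)) (F-∼ ∘ (refl ∷_)) (α ∷ 𝔞) (β ∷ 𝔟) 𝔠)
          (+ᴹ-cong (Σqsh-assoc (F ∘ (α ⊞ β ∷_)) (F-∼ ∘ (refl ∷_)) 𝔞 𝔟 (γ ∷ 𝔠))
          (+ᴹ-cong (Σqsh-assoc (F ∘ (α ⊞ γ ∷_)) (F-∼ ∘ (refl ∷_)) 𝔞 (β ∷ 𝔟) 𝔠)
          (+ᴹ-cong (Σqsh-assoc (F ∘ (β ⊞ γ ∷_)) (F-∼ ∘ (refl ∷_)) (α ∷ 𝔞) 𝔟 𝔠)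
                   (≈ᴹ-trans (Σqsh-assoc (F ∘ (α ⊞ β ⊞ γ ∷_)) (F-∼ ∘ (refl ∷_)) 𝔞 𝔟 𝔠)
                     (Σqsh-∼ (λ p → Σqsh-∼ (λ q → F-∼ (+ᴱ.assoc _ _ _ ∷ q)) (∼-refl {𝔞}) p)
                             (∼-refl {𝔟}) (∼-refl {𝔠})))))))) ⟩
      _ ≈⟨ solve 9 (λ β αβ γ αγ βγ αβγ α₁ α₂ α₃ →
             (α₁ ⊕ᵉ (α₂ ⊕ᵉ α₃)) ⊕ᵉ (β ⊕ᵉ (γ ⊕ᵉ (αβ ⊕ᵉ (αγ ⊕ᵉ (βγ ⊕ᵉ αβγ))))) ⊜
             (α₁ ⊕ᵉ (β ⊕ᵉ αβ)) ⊕ᵉ ((α₂ ⊕ᵉ (γ ⊕ᵉ αγ)) ⊕ᵉ (α₃ ⊕ᵉ (βγ ⊕ᵉ αβγ))))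
             ≈ᴹ-refl _ _ _ _ _ _ _ _ _ ⟩
      _ ≈⟨ +-cong₃ (Σqsh-+₃ (λ 𝔡 → Σqsh (F ∘ (α ∷_)) 𝔞 (β ∷ 𝔡))
                            (λ 𝔡 → Σqsh (F ∘ (β ∷_)) (α ∷ 𝔞) 𝔡)
                            (λ 𝔡 → Σqsh (F ∘ (α ⊞ β ∷_)) 𝔞 𝔡) 𝔟 (γ ∷ 𝔠))
                   (Σqsh-+₃ (λ 𝔡 → Σqsh (F ∘ (α ∷_)) 𝔞 (γ ∷ 𝔡))
                            (λ 𝔡 → Σqsh (F ∘ (γ ∷_)) (α ∷ 𝔞) 𝔡)
                            (λ 𝔡 → Σqsh (F ∘ (α ⊞ γ ∷_)) 𝔞 𝔡) (β ∷ 𝔟) 𝔠)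
                   (Σqsh-+₃ (λ 𝔡 → Σqsh (F ∘ (α ∷_)) 𝔞 (β ⊞ γ ∷ 𝔡))
                            (λ 𝔡 → Σqsh (F ∘ (β ⊞ γ ∷_)) (α ∷ 𝔞) 𝔡)
                            (λ 𝔡 → Σqsh (F ∘ (α ⊞ (β ⊞ γ) ∷_)) 𝔞 𝔡) 𝔟 𝔠) ⟨
      Σqsh (Σqsh F (α ∷ 𝔞)) (β ∷ 𝔟) (γ ∷ 𝔠) ∎

    -- Deconcatenation is multiplicative for quasi-shuffles: cutting a
    -- quasi-shuffle of 𝔞 and 𝔟 amounts to cutting 𝔞 and 𝔟 and quasi-shuffling
    -- the beginnings and the ends.
    Σqsh-Σdecon : ∀ F 𝔞 𝔟 →
      Σqsh (Σdecon F) 𝔞 𝔟 ≈ᴹ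
      Σdecon (λ 𝔞₁ 𝔞₂ → Σdecon (λ 𝔟₁ 𝔟₂ → Σqsh (λ 𝔠₁ → Σqsh (F 𝔠₁) 𝔞₂ 𝔟₂) 𝔞₁ 𝔟₁) 𝔟) 𝔞
    Σqsh-Σdecon F []      𝔟       = ≈ᴹ-refl
    Σqsh-Σdecon F (α ∷ 𝔞) []      = Σdecon-cong (λ 𝔞₁ 𝔞₂ → ≈ᴹ-sym (≈ᴹ-trans
      (Σqsh-identityʳ (λ 𝔠₁ → Σqsh (F 𝔠₁) 𝔞₂ []) 𝔞₁) (Σqsh-identityʳ (F 𝔞₁) 𝔞₂))) (α ∷ 𝔞)
    Σqsh-Σdecon F (α ∷ 𝔞) (β ∷ 𝔟) = begin
      Σqsh (Σdecon F) (α ∷ 𝔞) (β ∷ 𝔟)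
        ≈⟨ +-cong₃
             (Σqsh-+ (λ 𝔠 → F [] (α ∷ 𝔠)) (Σdecon (λ 𝔠₁ → F (α ∷ 𝔠₁))) 𝔞 (β ∷ 𝔟))
             (Σqsh-+ (λ 𝔠 → F [] (β ∷ 𝔠)) (Σdecon (λ 𝔠₁ → F (β ∷ 𝔠₁))) (α ∷ 𝔞) 𝔟)
             (Σqsh-+ (λ 𝔠 → F [] (α ⊞ β ∷ 𝔠)) (Σdecon (λ 𝔠₁ → F (α ⊞ β ∷ 𝔠₁))) 𝔞 𝔟) ⟩
      _ ≈⟨ solve 6 (λ x₁ x₂ x₃ y₁ y₂ y₃ →
             (x₁ ⊕ᵉ y₁) ⊕ᵉ ((x₂ ⊕ᵉ y₂) ⊕ᵉ (x₃ ⊕ᵉ y₃)) ⊜ (x₁ ⊕ᵉ (x₂ ⊕ᵉ x₃)) ⊕ᵉ (y₁ ⊕ᵉ (y₂ ⊕ᵉ y₃)))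
             ≈ᴹ-refl _ _ _ _ _ _ ⟩
      Σqsh (F []) (α ∷ 𝔞) (β ∷ 𝔟) +ᴹ
        (Σqsh (Σdecon (F ∘ (α ∷_))) 𝔞 (β ∷ 𝔟) +ᴹ
        (Σqsh (Σdecon (F ∘ (β ∷_))) (α ∷ 𝔞) 𝔟 +ᴹ Σqsh (Σdecon (F ∘ (α ⊞ β ∷_))) 𝔞 𝔟))
        ≈⟨ +ᴹ-cong ≈ᴹ-refl (+-cong₃
             (≈ᴹ-trans (Σqsh-Σdecon (F ∘ (α ∷_)) 𝔞 (β ∷ 𝔟))
               (≈ᴹ-trans (Σdecon-+ (λ 𝔞₁ 𝔞₂ → Σqsh (λ 𝔠₁ → Σqsh (F (α ∷ 𝔠₁)) 𝔞₂ (β ∷ 𝔟)) 𝔞₁ []) _ 𝔞)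
                 (+ᴹ-cong (Σdecon-cong (λ 𝔞₁ 𝔞₂ →
                   Σqsh-identityʳ (λ 𝔠₁ → Σqsh (F (α ∷ 𝔠₁)) 𝔞₂ (β ∷ 𝔟)) 𝔞₁) 𝔞) ≈ᴹ-refl)))
             (Σqsh-Σdecon (F ∘ (β ∷_)) (α ∷ 𝔞) 𝔟)
             (Σqsh-Σdecon (F ∘ (α ⊞ β ∷_)) 𝔞 𝔟)) ⟩
      P +ᴹ ((U +ᴹ Σdecon S₁ 𝔞) +ᴹ ((V +ᴹ Σdecon S₂ 𝔞) +ᴹ Σdecon S₃ 𝔞))
        ≈⟨ solve 6 (λ p u v s₁ s₂ s₃ →
             p ⊕ᵉ ((u ⊕ᵉ s₁) ⊕ᵉ ((v ⊕ᵉ s₂) ⊕ᵉ s₃)) ⊜ (p ⊕ᵉ v) ⊕ᵉ (u ⊕ᵉ (s₁ ⊕ᵉ (s₂ ⊕ᵉ s₃))))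
             ≈ᴹ-refl _ _ _ _ _ _ ⟩
      (P +ᴹ V) +ᴹ (U +ᴹ (Σdecon S₁ 𝔞 +ᴹ (Σdecon S₂ 𝔞 +ᴹ Σdecon S₃ 𝔞)))
        ≈⟨ +ᴹ-cong ≈ᴹ-refl (+ᴹ-cong ≈ᴹ-refl (≈ᴹ-trans
             (Σdecon-cong (λ 𝔞₁ 𝔞₂ → Σdecon-+₃ (s₁ 𝔞₁ 𝔞₂) (s₂ 𝔞₁ 𝔞₂) (s₃ 𝔞₁ 𝔞₂) 𝔟) 𝔞)
             (Σdecon-+₃ S₁ S₂ S₃ 𝔞))) ⟨
      (P +ᴹ V) +ᴹ (U +ᴹ Σdecon (λ 𝔞₁ 𝔞₂ → Σdecon (λ 𝔟₁ 𝔟₂ →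
        s₁ 𝔞₁ 𝔞₂ 𝔟₁ 𝔟₂ +ᴹ (s₂ 𝔞₁ 𝔞₂ 𝔟₁ 𝔟₂ +ᴹ s₃ 𝔞₁ 𝔞₂ 𝔟₁ 𝔟₂)) 𝔟) 𝔞)
        ≈⟨ +ᴹ-cong ≈ᴹ-refl (Σdecon-+ u _ 𝔞) ⟨
      Σdecon (λ 𝔞₁ 𝔞₂ → Σdecon (λ 𝔟₁ 𝔟₂ → Σqsh (λ 𝔠₁ → Σqsh (F 𝔠₁) 𝔞₂ 𝔟₂) 𝔞₁ 𝔟₁) (β ∷ 𝔟)) (α ∷ 𝔞) ∎
      where
      Σdecon-+₃ : ∀ F G H 𝔞 → Σdecon (λ 𝔞₁ 𝔞₂ → F 𝔞₁ 𝔞₂ +ᴹ (G 𝔞₁ 𝔞₂ +ᴹ H 𝔞₁ 𝔞₂)) 𝔞 ≈ᴹ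
                              Σdecon F 𝔞 +ᴹ (Σdecon G 𝔞 +ᴹ Σdecon H 𝔞)
      Σdecon-+₃ F G H 𝔞 = ≈ᴹ-trans (Σdecon-+ F _ 𝔞) (+ᴹ-cong ≈ᴹ-refl (Σdecon-+ G H 𝔞))

      -- In u and V exactly one of the two beginnings is empty, in P both are.
      P U V : ∣ B ∣
      u S₁ S₂ S₃ : Composition → Composition → ∣ B ∣
      s₁ s₂ s₃ : Composition → Composition → Composition → Composition → ∣ B ∣
      P = Σqsh (F []) (α ∷ 𝔞) (β ∷ 𝔟)
      u 𝔞₁ 𝔞₂ = Σqsh (F (α ∷ 𝔞₁)) 𝔞₂ (β ∷ 𝔟)
      U = Σdecon u 𝔞
      V = Σdecon (λ 𝔟₁ 𝔟₂ → Σqsh (F (β ∷ 𝔟₁)) (α ∷ 𝔞) 𝔟₂) 𝔟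
      s₁ 𝔞₁ 𝔞₂ 𝔟₁ 𝔟₂ = Σqsh (λ 𝔠₁ → Σqsh (F (α ∷ 𝔠₁)) 𝔞₂ 𝔟₂) 𝔞₁ (β ∷ 𝔟₁)
      s₂ 𝔞₁ 𝔞₂ 𝔟₁ 𝔟₂ = Σqsh (λ 𝔠₁ → Σqsh (F (β ∷ 𝔠₁)) 𝔞₂ 𝔟₂) (α ∷ 𝔞₁) 𝔟₁
      s₃ 𝔞₁ 𝔞₂ 𝔟₁ 𝔟₂ = Σqsh (λ 𝔠₁ → Σqsh (F (α ⊞ β ∷ 𝔠₁)) 𝔞₂ 𝔟₂) 𝔞₁ 𝔟₁
      S₁ 𝔞₁ 𝔞₂ = Σdecon (s₁ 𝔞₁ 𝔞₂) 𝔟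
      S₂ 𝔞₁ 𝔞₂ = Σdecon (s₂ 𝔞₁ 𝔞₂) 𝔟
      S₃ 𝔞₁ 𝔞₂ = Σdecon (s₃ 𝔞₁ 𝔞₂) 𝔟

  -- Linear maps commute with both kinds of sums.
  module _ (A B : Mod) {φ : ∣ A ∣ → ∣ B ∣} (φ-linear : IsLinear A B φ) where
    private
      module A = Sums A
      module B = Sums B
      module φ = Linear A B φ-linear
    open Module B

    Σdecon-linear : ∀ F 𝔞 → φ (A.Σdecon F 𝔞) ≈ᴹ B.Σdecon (λ 𝔞₁ 𝔞₂ → φ (F 𝔞₁ 𝔞₂)) 𝔞
    Σdecon-linear F []      = ≈ᴹ-refl
    Σdecon-linear F (α ∷ 𝔞) =
      ≈ᴹ-trans (φ.+ᴹ-homo _ _) (+ᴹ-cong ≈ᴹ-refl (Σdecon-linear (λ 𝔞₁ → F (α ∷ 𝔞₁)) 𝔞))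

    Σqsh-linear : ∀ F 𝔞 𝔟 → φ (A.Σqsh F 𝔞 𝔟) ≈ᴹ B.Σqsh (λ 𝔠 → φ (F 𝔠)) 𝔞 𝔟
    Σqsh-linear F []      𝔟       = ≈ᴹ-refl
    Σqsh-linear F (α ∷ 𝔞) []      = ≈ᴹ-refl
    Σqsh-linear F (α ∷ 𝔞) (β ∷ 𝔟) = ≈ᴹ-trans (φ.+ᴹ-homo _ _) (≈ᴹ-trans (+ᴹ-cong ≈ᴹ-refl (φ.+ᴹ-homo _ _))
      (B.+-cong₃ (Σqsh-linear (λ 𝔠 → F (α ∷ 𝔠)) 𝔞 (β ∷ 𝔟))
                 (Σqsh-linear (λ 𝔠 → F (β ∷ 𝔠)) (α ∷ 𝔞) 𝔟)
                 (Σqsh-linear (λ 𝔠 → F (α ⊞ β ∷ 𝔠)) 𝔞 𝔟)))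

-- The basis of monomial quasi-symmetric functions

module Basis (𝕜 : CommutativeRing 0ℓ 0ℓ) (E : Exponents) where

  open LinearAlgebra 𝕜
  open LinearMaps 𝕜
  open Exponents E using (𝟎; _≟_; Monomial)
  open QuasiSymmetric 𝕜 E
  open CompositionSums 𝕜 E
  open CommutativeRing 𝕜 using () renaming
    ( _≈_ to _≈ᴷ_; _*_ to _*ᴷ_; 0# to 0ᴷ; 1# to 1ᴷ )
  private module 𝕜 = CommutativeRing 𝕜

  ⟦⟧-true : ∀ {P : Set} (d : Dec P) → P → ⟦ d ⟧ ≈ᴷ 1ᴷ
  ⟦⟧-true d p = 𝕜.reflexive (cong (if_then 1ᴷ else 0ᴷ) (dec-true d p))

  ⟦⟧-false : ∀ {P : Set} (d : Dec P) → ¬ P → ⟦ d ⟧ ≈ᴷ 0ᴷ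
  ⟦⟧-false d ¬p = 𝕜.reflexive (cong (if_then 1ᴷ else 0ᴷ) (dec-false d ¬p))

  -- The coefficients of M 𝔞 depend only on the parts of 𝔞.
  Mˢ-∼ : ∀ {𝔞 𝔞′} → 𝔞 ∼ 𝔞′ → ∀ {n} (m : Monomial n) → coeff (Mˢ 𝔞) m ≈ᴷ coeff (Mˢ 𝔞′) m
  Mˢ-∼ []         m       = 𝕜.refl
  Mˢ-∼ (p ∷ q)    []      = 𝕜.refl
  Mˢ-∼ {α ∷ 𝔞} {α′ ∷ 𝔞′} (p ∷ q) (e ∷ m) = 𝕜.trans (coeffM-∷-∷ (proj₁ α) (parts 𝔞) e m)
    (𝕜.trans (𝕜.+-cong (𝕜.*-cong (𝕜.reflexive (cong (λ γ → ⟦ γ ≟ e ⟧) p)) (Mˢ-∼ q m))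
                       (𝕜.*-congˡ (Mˢ-∼ {α ∷ 𝔞} {α′ ∷ 𝔞′} (p ∷ q) m)))
             (𝕜.sym (coeffM-∷-∷ (proj₁ α′) (parts 𝔞′) e m)))

  M-∼ : Sums.Respects∼ QS M
  M-∼ p = Mˢ-∼ p

  coeff-linear : ∀ {n} (m : Monomial n) → IsLinear QS 𝟙 (λ x → coeff (series x) m)
  coeff-linear m = linear QS 𝟙 (λ p → p m) (λ _ _ → 𝕜.refl) (λ _ _ → 𝕜.refl)

  private
    -- A monomial of M (α ∷ 𝔞) that involves the variables of index 0 has
    -- exponent α there.
    coeffM-∷-≢𝟎 : ∀ {n} α 𝔞 {e} (m : Monomial n) → e ≢ 𝟎 →
                  coeff (Mˢ (α ∷ 𝔞)) (e ∷ m) ≈ᴷ ⟦ proj₁ α ≟ e ⟧ *ᴷ coeff (Mˢ 𝔞) m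
    coeffM-∷-≢𝟎 α 𝔞 {e} m e≢𝟎 = 𝕜.trans (coeffM-∷-∷ (proj₁ α) (parts 𝔞) e m)
      (𝕜.trans (𝕜.+-congˡ (𝕜.trans (𝕜.*-congʳ (⟦⟧-false (𝟎 ≟ e) (e≢𝟎 ∘ sym))) (𝕜.zeroˡ _)))
               (𝕜.+-identityʳ _))

  -- The series M is dual to the monomials in an initial segment of the
  -- variables with nonzero exponents.
  coeff-parts-∼ : ∀ {𝔞 𝔟} → 𝔞 ∼ 𝔟 → coeff (Mˢ 𝔞) (parts 𝔟) ≈ᴷ 1ᴷ
  coeff-parts-∼ []      = 𝕜.+-identityʳ 1ᴷ
  coeff-parts-∼ {α ∷ 𝔞} {β ∷ 𝔟} (p ∷ q) = 𝕜.trans (coeffM-∷-≢𝟎 α 𝔞 (parts 𝔟) (proj₂ β))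
    (𝕜.trans (𝕜.*-cong (⟦⟧-true (proj₁ α ≟ proj₁ β) p) (coeff-parts-∼ q)) (𝕜.*-identityˡ 1ᴷ))

  coeff-parts-≁ : ∀ 𝔞 𝔟 → ¬ 𝔞 ∼ 𝔟 → coeff (Mˢ 𝔞) (parts 𝔟) ≈ᴷ 0ᴷ
  coeff-parts-≁ []      []      𝔞≁𝔟 = contradiction [] 𝔞≁𝔟
  coeff-parts-≁ []      (β ∷ 𝔟) 𝔞≁𝔟 = 𝕜.trans (coeffM-[]-∷ (proj₁ β) (parts 𝔟))
    (𝕜.trans (𝕜.*-congʳ (⟦⟧-false (𝟎 ≟ proj₁ β) (proj₂ β ∘ sym))) (𝕜.zeroˡ _))
  coeff-parts-≁ (α ∷ 𝔞) []      𝔞≁𝔟 = 𝕜.refl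
  coeff-parts-≁ (α ∷ 𝔞) (β ∷ 𝔟) 𝔞≁𝔟 = 𝕜.trans (coeffM-∷-≢𝟎 α 𝔞 (parts 𝔟) (proj₂ β))
    (0-if (proj₁ α ≟ proj₁ β))
    where
    0-if : (d : Dec (proj₁ α ≡ proj₁ β)) → ⟦ d ⟧ *ᴷ coeff (Mˢ 𝔞) (parts 𝔟) ≈ᴷ 0ᴷ
    0-if (no _)  = 𝕜.zeroˡ _
    0-if (yes p) = 𝕜.trans (𝕜.*-congˡ (coeff-parts-≁ 𝔞 𝔟 (λ q → 𝔞≁𝔟 (p ∷ q)))) (𝕜.zeroʳ _)

  private
    ∼-decSetoid : DecSetoid 0ℓ 0ℓ
    ∼-decSetoid = Pointwise.decSetoid (On.decSetoid (≡.decSetoid _≟_) (proj₁ {B = _≢ 𝟎}))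

  open DecSetoid ∼-decSetoid using ()
    renaming (_≟_ to _∼?_; setoid to ∼-setoid; sym to ∼-sym; trans to ∼-trans)

  private
    -- The compositions 𝔞 for which M 𝔞 occurs in an expression of f as a linear
    -- combination.
    support : ∀ {f} → Span SeriesModule Mˢ f → List Composition
    support (gen 𝔞)    = 𝔞 ∷ []
    support zero       = []
    support (add s t)  = support s ++ support t
    support (mul r s)  = support s
    support (resp p s) = support s

  -- A map from compositions to B extends to a linear map from QS: an element
  -- of QS comes with an expression as a linear combination of the M 𝔞, and its
  -- image does not depend on this expression because, by coeff-parts-∼ and
  -- coeff-parts-≁, the coefficients can be read off from the series.

  module Extension (B : Mod) (g : Composition → ∣ B ∣) (g-∼ : Sums.Respects∼ B g) where
    open Module B
    open CommutativeSemigroupProperties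
      (CommutativeMonoid.commutativeSemigroup +ᴹ-commutativeMonoid) using (interchange)

    private
      -- The image of f, computed from an expression of f as a linear
      -- combination.
      image : ∀ {f} → Span SeriesModule Mˢ f → ∣ B ∣
      image (gen 𝔞)    = g 𝔞
      image zero       = 0ᴹ
      image (add s t)  = image s +ᴹ image t
      image (mul r s)  = r *ₗ image s
      image (resp p s) = image s

      -- The same image computed from the coefficients of f, if the compositions
      -- that occur in f are among the pairwise distinct 𝔟s.
      combination : Series → List Composition → ∣ B ∣
      combination f []       = 0ᴹ
      combination f (𝔟 ∷ 𝔟s) = coeff f (parts 𝔟) *ₗ g 𝔟 +ᴹ combination f 𝔟s

      open Module SeriesModule using () renaming
        (_≈ᴹ_ to _≈ˢ_; _+ᴹ_ to _+ˢ_; _*ₗ_ to _*ˢ_; 0ᴹ to 0ˢ)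

      combination-cong : ∀ f f′ → f ≈ˢ f′ → ∀ 𝔟s → combination f 𝔟s ≈ᴹ combination f′ 𝔟s
      combination-cong f f′ p []       = ≈ᴹ-refl
      combination-cong f f′ p (𝔟 ∷ 𝔟s) = +ᴹ-cong (*ₗ-cong (p (parts 𝔟)) ≈ᴹ-refl) (combination-cong f f′ p 𝔟s)

      combination-0 : ∀ 𝔟s → combination 0ˢ 𝔟s ≈ᴹ 0ᴹ
      combination-0 []       = ≈ᴹ-refl
      combination-0 (𝔟 ∷ 𝔟s) = ≈ᴹ-trans (+ᴹ-cong (*ₗ-zeroˡ _) (combination-0 𝔟s)) (+ᴹ-identityˡ 0ᴹ)

      combination-+ : ∀ f f′ 𝔟s →
        combination (f +ˢ f′) 𝔟s ≈ᴹ combination f 𝔟s +ᴹ combination f′ 𝔟s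
      combination-+ f f′ []       = ≈ᴹ-sym (+ᴹ-identityˡ 0ᴹ)
      combination-+ f f′ (𝔟 ∷ 𝔟s) =
        ≈ᴹ-trans (+ᴹ-cong (*ₗ-distribʳ _ _ _) (combination-+ f f′ 𝔟s)) (interchange _ _ _ _)

      combination-* : ∀ r f 𝔟s → combination (r *ˢ f) 𝔟s ≈ᴹ r *ₗ combination f 𝔟s
      combination-* r f []       = ≈ᴹ-sym (*ₗ-zeroʳ r)
      combination-* r f (𝔟 ∷ 𝔟s) =
        ≈ᴹ-trans (+ᴹ-cong (*ₗ-assoc _ _ _) (combination-* r f 𝔟s)) (≈ᴹ-sym (*ₗ-distribˡ r _ _))

      combination-∉ : ∀ {𝔞 𝔟s} → All (λ 𝔟 → ¬ 𝔞 ∼ 𝔟) 𝔟s → combination (Mˢ 𝔞) 𝔟s ≈ᴹ 0ᴹ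
      combination-∉ []            = ≈ᴹ-refl
      combination-∉ {𝔞} {𝔟 ∷ _} (p ∷ ps) = ≈ᴹ-trans
        (+ᴹ-cong (≈ᴹ-trans (*ₗ-cong (coeff-parts-≁ 𝔞 𝔟 p) ≈ᴹ-refl) (*ₗ-zeroˡ _)) (combination-∉ ps))
        (+ᴹ-identityˡ 0ᴹ)

      combination-∈ : ∀ {𝔞 𝔟s} → Unique ∼-decSetoid 𝔟s → Any (𝔞 ∼_) 𝔟s →
                      combination (Mˢ 𝔞) 𝔟s ≈ᴹ g 𝔞
      combination-∈ (p ∷ _) (here q) = ≈ᴹ-trans
        (+ᴹ-cong (≈ᴹ-trans (*ₗ-cong (coeff-parts-∼ q) (g-∼ (∼-sym q))) (*ₗ-identityˡ _))
                 (combination-∉ (All.map (λ 𝔟≁𝔠 𝔞∼𝔠 → 𝔟≁𝔠 (∼-trans (∼-sym q) 𝔞∼𝔠)) p)))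
        (+ᴹ-identityʳ _)
      combination-∈ {𝔞} {𝔟 ∷ _} (p ∷ u) (there i) = ≈ᴹ-trans
        (+ᴹ-cong (≈ᴹ-trans (*ₗ-cong (coeff-parts-≁ 𝔞 𝔟 𝔞≁𝔟) ≈ᴹ-refl) (*ₗ-zeroˡ _))
                 (combination-∈ u i))
        (+ᴹ-identityˡ _)
        where
        𝔞≁𝔟 : ¬ 𝔞 ∼ 𝔟
        𝔞≁𝔟 𝔞∼𝔟 = All.lookupWith {R = λ _ → ⊥} (λ 𝔟≁𝔠 𝔞∼𝔠 → 𝔟≁𝔠 (∼-trans (∼-sym 𝔞∼𝔟) 𝔞∼𝔠)) p i

      image-combination : ∀ {f} (s : Span SeriesModule Mˢ f) {𝔟s} → Unique ∼-decSetoid 𝔟s →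
        All (λ 𝔞 → Any (𝔞 ∼_) 𝔟s) (support s) → image s ≈ᴹ combination f 𝔟s
      image-combination (gen 𝔞)    u (i ∷ []) = ≈ᴹ-sym (combination-∈ u i)
      image-combination zero       {𝔟s} u is = ≈ᴹ-sym (combination-0 𝔟s)
      image-combination (add {f} {f′} s t) {𝔟s} u is = ≈ᴹ-trans
        (+ᴹ-cong (image-combination s u (All.++⁻ˡ (support s) is))
                 (image-combination t u (All.++⁻ʳ (support s) is)))
        (≈ᴹ-sym (combination-+ f f′ 𝔟s))
      image-combination (mul r {f} s) {𝔟s} u is =
        ≈ᴹ-trans (*ₗ-cong 𝕜.refl (image-combination s u is)) (≈ᴹ-sym (combination-* r f 𝔟s))
      image-combination (resp {f} {f′} p s) {𝔟s} u is =
        ≈ᴹ-trans (image-combination s u is) (combination-cong f f′ p 𝔟s)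

      image-cong : ∀ f f′ → f ≈ˢ f′ → (s : Span SeriesModule Mˢ f) (t : Span SeriesModule Mˢ f′) →
                   image s ≈ᴹ image t
      image-cong f f′ p s t = ≈ᴹ-trans (image-combination s u (All.++⁻ˡ (support s) all∈))
        (≈ᴹ-trans (combination-cong f f′ p 𝔟s) (≈ᴹ-sym (image-combination t u (All.++⁻ʳ (support s) all∈))))
        where
        𝔟s : List Composition
        𝔟s = List.deduplicate _∼?_ (support s ++ support t)
        u : Unique ∼-decSetoid 𝔟s
        u = deduplicate-! ∼-decSetoid (support s ++ support t)
        all∈ : All (λ 𝔞 → Any (𝔞 ∼_) 𝔟s) (support s ++ support t)
        all∈ = All.tabulateₛ ∼-setoid (∈-deduplicate⁺ ∼-setoid _∼?_ (λ q r → ∼-trans r (∼-sym q)))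

    -- The linear extension of g, with extend (M 𝔞) = g 𝔞.
    extend : ∣ QS ∣ → ∣ B ∣
    extend (_ , s) = image s

    extend-linear : IsLinear QS B extend
    extend-linear = linear QS B (λ {(f , s)} {(f′ , t)} p → image-cong f f′ p s t)
                                (λ _ _ → ≈ᴹ-refl) (λ _ _ → ≈ᴹ-refl)

  -- Linear maps from QS that agree on all M 𝔞 are equal.
  linear-unique : (B : Mod) {φ ψ : ∣ QS ∣ → ∣ B ∣} → IsLinear QS B φ → IsLinear QS B ψ →
                  (∀ 𝔞 → Module._≈ᴹ_ B (φ (M 𝔞)) (ψ (M 𝔞))) → ∀ x → Module._≈ᴹ_ B (φ x) (ψ x)
  linear-unique B {φ} {ψ} φ-linear ψ-linear eq (_ , s) = go s
    where
    open Module B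
    module φ = Linear QS B φ-linear
    module ψ = Linear QS B ψ-linear
    go : ∀ {f} (s : Span SeriesModule Mˢ f) → φ (f , s) ≈ᴹ ψ (f , s)
    go (gen 𝔞)    = eq 𝔞
    go zero       = ≈ᴹ-trans φ.0ᴹ-homo (≈ᴹ-sym ψ.0ᴹ-homo)
    go (add s t)  = ≈ᴹ-trans (φ.+ᴹ-homo (_ , s) (_ , t))
                   (≈ᴹ-trans (+ᴹ-cong (go s) (go t)) (≈ᴹ-sym (ψ.+ᴹ-homo (_ , s) (_ , t))))
    go (mul r s)  = ≈ᴹ-trans (φ.*ₗ-homo r (_ , s))
                   (≈ᴹ-trans (*ₗ-cong 𝕜.refl (go s)) (≈ᴹ-sym (ψ.*ₗ-homo r (_ , s))))
    go (resp {f} {f′} p s) = ≈ᴹ-trans (φ.⟦⟧-cong {f′ , resp p s} {f , s} (λ m → 𝕜.sym (p m)))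
                            (≈ᴹ-trans (go s) (ψ.⟦⟧-cong {f , s} {f′ , resp p s} (λ m → p m)))

-- Products of series

module SeriesProducts (𝕜 : CommutativeRing 0ℓ 0ℓ) (E : Exponents) where

  open LinearAlgebra 𝕜
  open LinearMaps 𝕜
  open Exponents E
  open QuasiSymmetric 𝕜 E
  open CompositionSums 𝕜 E
  open Basis 𝕜 E
  open CommutativeRing 𝕜 using () renaming
    ( Carrier to K; _≈_ to _≈ᴷ_; _+_ to _+ᴷ_; _*_ to _*ᴷ_; 0# to 0ᴷ; 1# to 1ᴷ )
  private module 𝕜 = CommutativeRing 𝕜
  open SetoidReasoning 𝕜.setoid
  open CommutativeSemigroupProperties
    (CommutativeMonoid.commutativeSemigroup 𝕜.+-commutativeMonoid) using (interchange)

  -- Finite sums in K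

  sum-+ : ∀ {X : Set} (f g : X → K) xs →
          sumᴷ (List.map (λ x → f x +ᴷ g x) xs) ≈ᴷ sumᴷ (List.map f xs) +ᴷ sumᴷ (List.map g xs)
  sum-+ f g []       = 𝕜.sym (𝕜.+-identityˡ 0ᴷ)
  sum-+ f g (x ∷ xs) = 𝕜.trans (𝕜.+-congˡ (sum-+ f g xs)) (interchange _ _ _ _)

  sum-*ˡ : ∀ {X : Set} r (f : X → K) xs →
           sumᴷ (List.map (λ x → r *ᴷ f x) xs) ≈ᴷ r *ᴷ sumᴷ (List.map f xs)
  sum-*ˡ r f []       = 𝕜.sym (𝕜.zeroʳ r)
  sum-*ˡ r f (x ∷ xs) = 𝕜.trans (𝕜.+-congˡ (sum-*ˡ r f xs)) (𝕜.sym (𝕜.distribˡ _ _ _))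

  sum-*ʳ : ∀ {X : Set} (f : X → K) r xs →
           sumᴷ (List.map (λ x → f x *ᴷ r) xs) ≈ᴷ sumᴷ (List.map f xs) *ᴷ r
  sum-*ʳ f r xs = 𝕜.trans (sum-map-cong (λ x → 𝕜.*-comm (f x) r) xs)
                 (𝕜.trans (sum-*ˡ r f xs) (𝕜.*-comm r _))

  sum-++ : ∀ xs ys → sumᴷ (xs ++ ys) ≈ᴷ sumᴷ xs +ᴷ sumᴷ ys
  sum-++ []       ys = 𝕜.sym (𝕜.+-identityˡ _)
  sum-++ (x ∷ xs) ys = 𝕜.trans (𝕜.+-congˡ (sum-++ xs ys)) (𝕜.sym (𝕜.+-assoc _ _ _))

  sum-cartesianProductWith : ∀ {X Y Z : Set} (f : Z → K) (h : X → Y → Z) xs ys →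
    sumᴷ (List.map f (cartesianProductWith h xs ys)) ≈ᴷ
    sumᴷ (List.map (λ x → sumᴷ (List.map (λ y → f (h x y)) ys)) xs)
  sum-cartesianProductWith f h []       ys = 𝕜.refl
  sum-cartesianProductWith f h (x ∷ xs) ys = begin
    sumᴷ (List.map f (List.map (h x) ys ++ cartesianProductWith h xs ys))
      ≡⟨ cong sumᴷ (List.map-++ f (List.map (h x) ys) _) ⟩
    sumᴷ (List.map f (List.map (h x) ys) ++ List.map f (cartesianProductWith h xs ys))
      ≈⟨ sum-++ (List.map f (List.map (h x) ys)) _ ⟩
    sumᴷ (List.map f (List.map (h x) ys)) +ᴷ sumᴷ (List.map f (cartesianProductWith h xs ys))
      ≈⟨ 𝕜.+-cong (𝕜.reflexive (cong sumᴷ (sym (List.map-∘ ys)))) (sum-cartesianProductWith f h xs ys) ⟩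
    _ ∎

  sum-zero : ∀ {X : Set} {f : X → K} {xs} → All (λ x → f x ≈ᴷ 0ᴷ) xs → sumᴷ (List.map f xs) ≈ᴷ 0ᴷ
  sum-zero []       = 𝕜.refl
  sum-zero (p ∷ ps) = 𝕜.trans (𝕜.+-cong p (sum-zero ps)) (𝕜.+-identityˡ 0ᴷ)

  -- A sum with a single nonzero term.
  sum-single : ∀ {X : Set} {f : X → K} {x xs} → Unique≡ xs → x ∈ xs →
               (∀ {y} → x ≢ y → f y ≈ᴷ 0ᴷ) → sumᴷ (List.map f xs) ≈ᴷ f x
  sum-single (p ∷ _) (here refl) f≈0 =
    𝕜.trans (𝕜.+-congˡ (sum-zero (All.map f≈0 p))) (𝕜.+-identityʳ _)
  sum-single (p ∷ u) (there i)   f≈0 =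
    𝕜.trans (𝕜.+-cong (f≈0 (All.lookup p i ∘ sym)) (sum-single u i f≈0)) (𝕜.+-identityˡ _)

  -- Sums over the decompositions of an exponent

  sumOverSplits : (Exp → Exp → K) → Exp → K
  sumOverSplits c e = sumᴷ (List.map (λ (p , q) → c p q) (splits e))

  sumOverSplits-indicator : ∀ α β e →
    sumOverSplits (λ p q → ⟦ α ≟ p ⟧ *ᴷ ⟦ β ≟ q ⟧) e ≈ᴷ ⟦ α + β ≟ e ⟧
  sumOverSplits-indicator α β e with α + β ≟ e
  ... | yes eq = 𝕜.trans
    (sum-single (splits-unique e) (Equivalence.from ∈-splits eq) off-diagonal)
    (𝕜.trans (𝕜.*-cong (⟦⟧-true (α ≟ α) refl) (⟦⟧-true (β ≟ β) refl)) (𝕜.*-identityˡ 1ᴷ))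
    where
    off-diagonal : ∀ {pq} → (α , β) ≢ pq → ⟦ α ≟ proj₁ pq ⟧ *ᴷ ⟦ β ≟ proj₂ pq ⟧ ≈ᴷ 0ᴷ
    off-diagonal {p , q} ≢pq with α ≟ p | β ≟ q
    ... | no _     | _        = 𝕜.zeroˡ _
    ... | yes _    | no _     = 𝕜.zeroʳ _
    ... | yes refl | yes refl = contradiction refl ≢pq
  ... | no neq = sum-zero (All.tabulate absent)
    where
    absent : ∀ {pq} → pq ∈ splits e → ⟦ α ≟ proj₁ pq ⟧ *ᴷ ⟦ β ≟ proj₂ pq ⟧ ≈ᴷ 0ᴷ
    absent {p , q} i with α ≟ p | β ≟ q
    ... | no _     | _        = 𝕜.zeroˡ _
    ... | yes _    | no _     = 𝕜.zeroʳ _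
    ... | yes refl | yes refl = contradiction (Equivalence.to ∈-splits i) neq

  -- Products of functions on monomials

  infixl 7 _✶_
  infixl 6 _⊹_
  infix  8 _◁_
  infix  4 _≗ᴷ_

  -- Pointwise equality.
  _≗ᴷ_ : ∀ {n} → (f g : Monomial n → K) → Set
  f ≗ᴷ g = ∀ m → f m ≈ᴷ g m

  _⊹_ : ∀ {n} → (f g : Monomial n → K) → Monomial n → K
  (f ⊹ g) m = f m +ᴷ g m

  -- The product of formal series, in terms of their coefficients.
  _✶_ : ∀ {n} → (f g : Monomial n → K) → Monomial n → K
  f ✶ g = sumOverFactorisations (λ p q → f p *ᴷ g q)

  -- The coefficients of the product of the variables of index 0 with exponent α
  -- and of the series with coefficients f in the variables of index > 0.
  _◁_ : ∀ {n} → Exp → (Monomial n → K) → Monomial (suc n) → K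
  (α ◁ f) (e ∷ m) = ⟦ α ≟ e ⟧ *ᴷ f m

  ✶-cong : ∀ {n} {f f′ g g′ : Monomial n → K} → f ≗ᴷ f′ → g ≗ᴷ g′ → f ✶ g ≗ᴷ f′ ✶ g′
  ✶-cong p q m = sum-map-cong (λ (r , s) → 𝕜.*-cong (p r) (q s)) (factorisations m)

  ✶-distribˡ : ∀ {n} (f g g′ : Monomial n → K) → f ✶ (g ⊹ g′) ≗ᴷ f ✶ g ⊹ f ✶ g′
  ✶-distribˡ f g g′ m = 𝕜.trans
    (sum-map-cong (λ (p , q) → 𝕜.distribˡ (f p) (g q) (g′ q)) (factorisations m))
    (sum-+ _ _ (factorisations m))

  ✶-distribʳ : ∀ {n} (g f f′ : Monomial n → K) → (f ⊹ f′) ✶ g ≗ᴷ f ✶ g ⊹ f′ ✶ g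
  ✶-distribʳ g f f′ m = 𝕜.trans
    (sum-map-cong (λ (p , q) → 𝕜.distribʳ (g q) (f p) (f′ p)) (factorisations m))
    (sum-+ _ _ (factorisations m))

  ◁-cong : ∀ {n} {α β} {f g : Monomial n → K} → α ≡ β → f ≗ᴷ g → α ◁ f ≗ᴷ β ◁ g
  ◁-cong refl p (e ∷ m) = 𝕜.*-congˡ (p m)

  ◁-✶-◁ : ∀ {n} α β (f g : Monomial n → K) → α ◁ f ✶ β ◁ g ≗ᴷ (α + β) ◁ (f ✶ g)
  ◁-✶-◁ α β f g (e ∷ m) = begin
    (α ◁ f ✶ β ◁ g) (e ∷ m)
      ≈⟨ sum-cartesianProductWith _ _ (splits e) (factorisations m) ⟩
    sumOverSplits (λ p q → sumOverFactorisations
      (λ ps qs → (⟦ α ≟ p ⟧ *ᴷ f ps) *ᴷ (⟦ β ≟ q ⟧ *ᴷ g qs)) m) e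
      ≈⟨ sum-map-cong (λ (p , q) → 𝕜.trans
           (sum-map-cong (λ (ps , qs) → *-interchange ⟦ α ≟ p ⟧ (f ps) ⟦ β ≟ q ⟧ (g qs)) (factorisations m))
           (sum-*ˡ (⟦ α ≟ p ⟧ *ᴷ ⟦ β ≟ q ⟧) _ (factorisations m))) (splits e) ⟩
    sumOverSplits (λ p q → (⟦ α ≟ p ⟧ *ᴷ ⟦ β ≟ q ⟧) *ᴷ (f ✶ g) m) e
      ≈⟨ sum-*ʳ (λ (p , q) → ⟦ α ≟ p ⟧ *ᴷ ⟦ β ≟ q ⟧) _ (splits e) ⟩
    sumOverSplits (λ p q → ⟦ α ≟ p ⟧ *ᴷ ⟦ β ≟ q ⟧) e *ᴷ (f ✶ g) m
      ≈⟨ 𝕜.*-congʳ (sumOverSplits-indicator α β e) ⟩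
    ((α + β) ◁ (f ✶ g)) (e ∷ m) ∎
    where
    open CommutativeSemigroupProperties
      (CommutativeMonoid.commutativeSemigroup 𝕜.*-commutativeMonoid)
      using () renaming (interchange to *-interchange)

  -- The coefficients of M 𝔞.  If 𝔞 is nonempty, its first part is the exponent
  -- of the variables of index 0 or of those of a higher index (cM-∷).
  cM : ∀ {n} → Composition → Monomial n → K
  cM 𝔞 = coeff (Mˢ 𝔞)

  cM-[] : ∀ {n} → cM {suc n} [] ≗ᴷ 𝟎 ◁ cM []
  cM-[] (e ∷ m) = coeffM-[]-∷ e m

  cM-∷ : ∀ {n} α 𝔞 → cM {suc n} (α ∷ 𝔞) ≗ᴷ proj₁ α ◁ cM 𝔞 ⊹ 𝟎 ◁ cM (α ∷ 𝔞)
  cM-∷ α 𝔞 (e ∷ m) = coeffM-∷-∷ (proj₁ α) (parts 𝔞) e m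

  open Sums 𝟙 using () renaming
    ( Σqsh to Σqshᴷ; Σqsh-cong to Σqshᴷ-cong; Σqsh-+ to Σqshᴷ-+; Σqsh-zero to Σqshᴷ-zero )

  -- The expansion cM-∷ summed over the quasi-shuffles of 𝔞 and 𝔟.
  cM-Σqsh-∷ : ∀ {n} γ 𝔞 𝔟 (m : Monomial (suc n)) →
    Σqshᴷ (λ 𝔠 → cM (γ ∷ 𝔠) m) 𝔞 𝔟 ≈ᴷ
    (proj₁ γ ◁ (λ m → Σqshᴷ (λ 𝔠 → cM 𝔠 m) 𝔞 𝔟)) m +ᴷ
    (𝟎 ◁ (λ m → Σqshᴷ (λ 𝔠 → cM (γ ∷ 𝔠) m) 𝔞 𝔟)) m
  cM-Σqsh-∷ γ 𝔞 𝔟 (e ∷ m) = 𝕜.trans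
    (Σqshᴷ-cong (λ 𝔠 → cM-∷ γ 𝔠 (e ∷ m)) 𝔞 𝔟)
    (𝕜.trans (Σqshᴷ-+ (λ 𝔠 → ⟦ proj₁ γ ≟ e ⟧ *ᴷ cM 𝔠 m) (λ 𝔠 → ⟦ 𝟎 ≟ e ⟧ *ᴷ cM (γ ∷ 𝔠) m) 𝔞 𝔟)
    (𝕜.+-cong
      (𝕜.sym (Σqsh-linear 𝟙 𝟙 (scale-linear 𝟙 ⟦ proj₁ γ ≟ e ⟧) (λ 𝔠 → cM 𝔠 m) 𝔞 𝔟))
      (𝕜.sym (Σqsh-linear 𝟙 𝟙 (scale-linear 𝟙 ⟦ 𝟎 ≟ e ⟧) (λ 𝔠 → cM (γ ∷ 𝔠) m) 𝔞 𝔟))))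

  -- The series M multiply by the quasi-shuffle product.  In a product of two
  -- monomials, the exponent of the variables of index 0 is contributed by the
  -- first factor, by the second factor, by both or by none of them.
  cM-✶ : ∀ 𝔞 𝔟 {n} (m : Monomial n) → (cM 𝔞 ✶ cM 𝔟) m ≈ᴷ Σqshᴷ (λ 𝔠 → cM 𝔠 m) 𝔞 𝔟
  cM-✶ []      []      [] = 𝕜.trans (𝕜.+-identityʳ _)
    (𝕜.trans (𝕜.*-congʳ (𝕜.+-identityʳ 1ᴷ)) (𝕜.*-identityˡ _))
  cM-✶ []      (β ∷ 𝔟) [] = 𝕜.trans (𝕜.+-identityʳ _) (𝕜.zeroʳ _)
  cM-✶ (α ∷ 𝔞) []      [] = 𝕜.trans (𝕜.+-identityʳ _) (𝕜.zeroˡ _)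
  cM-✶ (α ∷ 𝔞) (β ∷ 𝔟) [] = 𝕜.trans (𝕜.+-identityʳ _) (𝕜.trans (𝕜.zeroˡ 0ᴷ)
    (𝕜.sym (𝕜.trans (𝕜.+-cong (Σqshᴷ-zero (λ _ → 𝕜.refl) 𝔞 (β ∷ 𝔟))
      (𝕜.+-cong (Σqshᴷ-zero (λ _ → 𝕜.refl) (α ∷ 𝔞) 𝔟) (Σqshᴷ-zero (λ _ → 𝕜.refl) 𝔞 𝔟)))
      (𝕜.trans (𝕜.+-identityˡ _) (𝕜.+-identityˡ 0ᴷ)))))
  cM-✶ []      []      m@(_ ∷ _) = begin
    (cM [] ✶ cM []) m              ≈⟨ ✶-cong cM-[] cM-[] m ⟩
    (𝟎 ◁ cM [] ✶ 𝟎 ◁ cM []) m      ≈⟨ ◁-✶-◁ 𝟎 𝟎 (cM []) (cM []) m ⟩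
    ((𝟎 + 𝟎) ◁ (cM [] ✶ cM [])) m  ≈⟨ ◁-cong (+-identityˡ 𝟎) (cM-✶ [] []) m ⟩
    (𝟎 ◁ cM []) m                  ≈⟨ cM-[] m ⟨
    cM [] m                        ∎
  cM-✶ []      (β ∷ 𝔟) m@(_ ∷ _) = begin
    (cM [] ✶ cM (β ∷ 𝔟)) m
      ≈⟨ ✶-cong cM-[] (cM-∷ β 𝔟) m ⟩
    (𝟎 ◁ cM [] ✶ (proj₁ β ◁ cM 𝔟 ⊹ 𝟎 ◁ cM (β ∷ 𝔟))) m
      ≈⟨ ✶-distribˡ (𝟎 ◁ cM []) (proj₁ β ◁ cM 𝔟) (𝟎 ◁ cM (β ∷ 𝔟)) m ⟩
    (𝟎 ◁ cM [] ✶ proj₁ β ◁ cM 𝔟 ⊹ 𝟎 ◁ cM [] ✶ 𝟎 ◁ cM (β ∷ 𝔟)) m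
      ≈⟨ 𝕜.+-cong
           (𝕜.trans (◁-✶-◁ 𝟎 (proj₁ β) (cM []) (cM 𝔟) m) (◁-cong (+-identityˡ _) (cM-✶ [] 𝔟) m))
           (𝕜.trans (◁-✶-◁ 𝟎 𝟎 (cM []) (cM (β ∷ 𝔟)) m) (◁-cong (+-identityˡ 𝟎) (cM-✶ [] (β ∷ 𝔟)) m)) ⟩
    (proj₁ β ◁ cM 𝔟 ⊹ 𝟎 ◁ cM (β ∷ 𝔟)) m
      ≈⟨ cM-∷ β 𝔟 m ⟨
    cM (β ∷ 𝔟) m ∎
  cM-✶ (α ∷ 𝔞) []      m@(_ ∷ _) = begin
    (cM (α ∷ 𝔞) ✶ cM []) m
      ≈⟨ ✶-cong (cM-∷ α 𝔞) cM-[] m ⟩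
    ((proj₁ α ◁ cM 𝔞 ⊹ 𝟎 ◁ cM (α ∷ 𝔞)) ✶ 𝟎 ◁ cM []) m
      ≈⟨ ✶-distribʳ (𝟎 ◁ cM []) (proj₁ α ◁ cM 𝔞) (𝟎 ◁ cM (α ∷ 𝔞)) m ⟩
    (proj₁ α ◁ cM 𝔞 ✶ 𝟎 ◁ cM [] ⊹ 𝟎 ◁ cM (α ∷ 𝔞) ✶ 𝟎 ◁ cM []) m
      ≈⟨ 𝕜.+-cong
           (𝕜.trans (◁-✶-◁ (proj₁ α) 𝟎 (cM 𝔞) (cM []) m) (◁-cong (+-identityʳ _)
             (λ m → 𝕜.trans (cM-✶ 𝔞 [] m) (Sums.Σqsh-identityʳ 𝟙 (λ 𝔠 → cM 𝔠 m) 𝔞)) m))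
           (𝕜.trans (◁-✶-◁ 𝟎 𝟎 (cM (α ∷ 𝔞)) (cM []) m) (◁-cong (+-identityˡ 𝟎) (cM-✶ (α ∷ 𝔞) []) m)) ⟩
    (proj₁ α ◁ cM 𝔞 ⊹ 𝟎 ◁ cM (α ∷ 𝔞)) m
      ≈⟨ cM-∷ α 𝔞 m ⟨
    cM (α ∷ 𝔞) m ∎
  cM-✶ (α ∷ 𝔞) (β ∷ 𝔟) m@(e ∷ m′) = begin
    (cM (α ∷ 𝔞) ✶ cM (β ∷ 𝔟)) m
      ≈⟨ ✶-cong (cM-∷ α 𝔞) (cM-∷ β 𝔟) m ⟩
    ((α₀ ◁ cM 𝔞 ⊹ 𝟎 ◁ cM (α ∷ 𝔞)) ✶ (β₀ ◁ cM 𝔟 ⊹ 𝟎 ◁ cM (β ∷ 𝔟))) m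
      ≈⟨ 𝕜.trans (✶-distribʳ _ (α₀ ◁ cM 𝔞) (𝟎 ◁ cM (α ∷ 𝔞)) m)
           (𝕜.+-cong (✶-distribˡ (α₀ ◁ cM 𝔞) (β₀ ◁ cM 𝔟) (𝟎 ◁ cM (β ∷ 𝔟)) m)
                     (✶-distribˡ (𝟎 ◁ cM (α ∷ 𝔞)) (β₀ ◁ cM 𝔟) (𝟎 ◁ cM (β ∷ 𝔟)) m)) ⟩
    ((α₀ ◁ cM 𝔞 ✶ β₀ ◁ cM 𝔟 ⊹ α₀ ◁ cM 𝔞 ✶ 𝟎 ◁ cM (β ∷ 𝔟)) ⊹
      (𝟎 ◁ cM (α ∷ 𝔞) ✶ β₀ ◁ cM 𝔟 ⊹ 𝟎 ◁ cM (α ∷ 𝔞) ✶ 𝟎 ◁ cM (β ∷ 𝔟))) m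
      ≈⟨ 𝕜.+-cong
           (𝕜.+-cong
             (𝕜.trans (◁-✶-◁ α₀ β₀ (cM 𝔞) (cM 𝔟) m) (◁-cong refl (cM-✶ 𝔞 𝔟) m))
             (𝕜.trans (◁-✶-◁ α₀ 𝟎 (cM 𝔞) (cM (β ∷ 𝔟)) m) (◁-cong (+-identityʳ _) (cM-✶ 𝔞 (β ∷ 𝔟)) m)))
           (𝕜.+-cong
             (𝕜.trans (◁-✶-◁ 𝟎 β₀ (cM (α ∷ 𝔞)) (cM 𝔟) m) (◁-cong (+-identityˡ _) (cM-✶ (α ∷ 𝔞) 𝔟) m))
             (𝕜.trans (◁-✶-◁ 𝟎 𝟎 (cM (α ∷ 𝔞)) (cM (β ∷ 𝔟)) m)
               (𝕜.trans (◁-cong (+-identityˡ 𝟎) (cM-✶ (α ∷ 𝔞) (β ∷ 𝔟)) m)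
               (𝕜.trans (𝕜.distribˡ ⟦ 𝟎 ≟ e ⟧ _ _) (𝕜.+-congˡ (𝕜.distribˡ ⟦ 𝟎 ≟ e ⟧ _ _)))))) ⟩
    _ ≈⟨ solve 6 (λ x₁ x₂ x₃ y₁ y₂ y₃ →
           (x₃ ⊕ᵉ x₁) ⊕ᵉ (x₂ ⊕ᵉ (y₁ ⊕ᵉ (y₂ ⊕ᵉ y₃))) ⊜ (x₁ ⊕ᵉ y₁) ⊕ᵉ ((x₂ ⊕ᵉ y₂) ⊕ᵉ (x₃ ⊕ᵉ y₃)))
           𝕜.refl _ _ _ _ _ _ ⟩
    _ ≈⟨ Sums.+-cong₃ 𝟙 (cM-Σqsh-∷ α 𝔞 (β ∷ 𝔟) m) (cM-Σqsh-∷ β (α ∷ 𝔞) 𝔟 m)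
                        (cM-Σqsh-∷ (α ⊞ β) 𝔞 𝔟 m) ⟨
    Σqshᴷ (λ 𝔠 → cM 𝔠 m) (α ∷ 𝔞) (β ∷ 𝔟) ∎
    where
    α₀ β₀ : Exp
    α₀ = proj₁ α
    β₀ = proj₁ β
    open CommutativeMonoidSolver 𝕜.+-commutativeMonoid using (solve; _⊜_) renaming (_⊕_ to _⊕ᵉ_)

module QuasiSymmetricAlgebra (𝕜 : CommutativeRing 0ℓ 0ℓ) (E : Exponents) where

  open LinearAlgebra 𝕜
  open LinearMaps 𝕜
  open Exponents E
  open QuasiSymmetric 𝕜 E
  open CompositionSums 𝕜 E
  open Basis 𝕜 E
  open SeriesProducts 𝕜 E
  private module 𝕜 = CommutativeRing 𝕜

  private
    ·ˢ-bilinear : IsBilinear SeriesModule SeriesModule SeriesModule _·ˢ_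
    ·ˢ-bilinear = record
      { linearˡ = λ g → linear SeriesModule SeriesModule
          (λ p m → ✶-cong p (λ _ → 𝕜.refl) m)
          (λ f f′ m → ✶-distribʳ (coeff g) (coeff f) (coeff f′) m)
          (λ r f m → 𝕜.trans
            (sum-map-cong (λ (p , q) → 𝕜.*-assoc r (coeff f p) (coeff g q)) (factorisations m))
            (sum-*ˡ r _ (factorisations m)))
      ; linearʳ = λ f → linear SeriesModule SeriesModule
          (λ p m → ✶-cong (λ _ → 𝕜.refl) p m)
          (λ g g′ m → ✶-distribˡ (coeff f) (coeff g) (coeff g′) m)
          (λ r g m → 𝕜.trans
            (sum-map-cong (λ (p , q) → x∙yz≈y∙xz (coeff f p) r (coeff g q)) (factorisations m))
            (sum-*ˡ r _ (factorisations m))) }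
      where
      open CommutativeSemigroupProperties
        (CommutativeMonoid.commutativeSemigroup 𝕜.*-commutativeMonoid) using (x∙yz≈y∙xz)

    module ΣQS = Sums QS
    module S = Module SeriesModule

    Mˢ·Mˢ : ∀ 𝔞 𝔟 → series (ΣQS.Σqsh M 𝔞 𝔟) S.≈ᴹ Mˢ 𝔞 ·ˢ Mˢ 𝔟
    Mˢ·Mˢ 𝔞 𝔟 m = 𝕜.trans (Σqsh-linear QS 𝟙 (coeff-linear m) M 𝔞 𝔟) (𝕜.sym (cM-✶ 𝔞 𝔟 m))

    -- Products of quasi-symmetric series are quasi-symmetric.
    ·ˢ-closed : ∀ {f g} → Span SeriesModule Mˢ f → Span SeriesModule Mˢ g →
                Span SeriesModule Mˢ (f ·ˢ g)
    ·ˢ-closed (gen 𝔞) t = go t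
      where
      module L = Linear SeriesModule SeriesModule (linearʳ ·ˢ-bilinear (Mˢ 𝔞))
      go : ∀ {g} → Span SeriesModule Mˢ g → Span SeriesModule Mˢ (Mˢ 𝔞 ·ˢ g)
      go (gen 𝔟) = resp {x = series (ΣQS.Σqsh M 𝔞 𝔟)} {y = Mˢ 𝔞 ·ˢ Mˢ 𝔟} (Mˢ·Mˢ 𝔞 𝔟) (proj₂ (ΣQS.Σqsh M 𝔞 𝔟))
      go zero    = resp {x = S.0ᴹ} {y = Mˢ 𝔞 ·ˢ S.0ᴹ} (λ m → 𝕜.sym (L.0ᴹ-homo m)) zero
      go (add {g} {g′} s t) = resp {x = Mˢ 𝔞 ·ˢ g S.+ᴹ Mˢ 𝔞 ·ˢ g′} {y = Mˢ 𝔞 ·ˢ (g S.+ᴹ g′)}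
                                   (λ m → 𝕜.sym (L.+ᴹ-homo g g′ m)) (add (go s) (go t))
      go (mul r {g} s)      = resp {x = r S.*ₗ (Mˢ 𝔞 ·ˢ g)} {y = Mˢ 𝔞 ·ˢ (r S.*ₗ g)}
                                   (λ m → 𝕜.sym (L.*ₗ-homo r g m)) (mul r (go s))
      go (resp {g} {g′} p s) = resp {x = Mˢ 𝔞 ·ˢ g} {y = Mˢ 𝔞 ·ˢ g′} (L.⟦⟧-cong {g} {g′} p) (go s)
    ·ˢ-closed {g = g} zero t =
      resp {x = S.0ᴹ} {y = S.0ᴹ ·ˢ g}
           (λ m → 𝕜.sym (Linear.0ᴹ-homo SeriesModule SeriesModule (linearˡ ·ˢ-bilinear g) m)) zero
    ·ˢ-closed {g = g} (add {f} {f′} s s′) t =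
      resp {x = f ·ˢ g S.+ᴹ f′ ·ˢ g} {y = (f S.+ᴹ f′) ·ˢ g}
           (λ m → 𝕜.sym (Linear.+ᴹ-homo SeriesModule SeriesModule (linearˡ ·ˢ-bilinear g) f f′ m))
           (add (·ˢ-closed s t) (·ˢ-closed s′ t))
    ·ˢ-closed {g = g} (mul r {f} s) t =
      resp {x = r S.*ₗ (f ·ˢ g)} {y = (r S.*ₗ f) ·ˢ g}
           (λ m → 𝕜.sym (Linear.*ₗ-homo SeriesModule SeriesModule (linearˡ ·ˢ-bilinear g) r f m))
           (mul r (·ˢ-closed s t))
    ·ˢ-closed {g = g} (resp {f} {f′} p s) t =
      resp {x = f ·ˢ g} {y = f′ ·ˢ g}
           (Linear.⟦⟧-cong SeriesModule SeriesModule (linearˡ ·ˢ-bilinear g) {f} {f′} p)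
           (·ˢ-closed s t)

  open Module QS using (_≈ᴹ_; _+ᴹ_; 0ᴹ; -ᴹ_; ≈ᴹ-refl; ≈ᴹ-sym; ≈ᴹ-trans; +ᴹ-isAbelianGroup; ≈ᴹ-setoid)
  open SetoidReasoning ≈ᴹ-setoid

  infixl 7 _·_

  _·_ : ∣ QS ∣ → ∣ QS ∣ → ∣ QS ∣
  (f , s) · (g , t) = f ·ˢ g , ·ˢ-closed s t

  ·-bilinear : IsBilinear QS QS QS _·_
  ·-bilinear = record
    { linearˡ = λ (g , _) → let module L = Linear SeriesModule SeriesModule (linearˡ ·ˢ-bilinear g) in
        linear QS QS (λ {(f , _)} {(f′ , _)} p → L.⟦⟧-cong {f} {f′} p)
                     (λ (f , _) (f′ , _) → L.+ᴹ-homo f f′) (λ r (f , _) → L.*ₗ-homo r f)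
    ; linearʳ = λ (f , _) → let module L = Linear SeriesModule SeriesModule (linearʳ ·ˢ-bilinear f) in
        linear QS QS (λ {(g , _)} {(g′ , _)} p → L.⟦⟧-cong {g} {g′} p)
                     (λ (g , _) (g′ , _) → L.+ᴹ-homo g g′) (λ r (g , _) → L.*ₗ-homo r g) }

  M·M : ∀ 𝔞 𝔟 → M 𝔞 · M 𝔟 ≈ᴹ ΣQS.Σqsh M 𝔞 𝔟
  M·M 𝔞 𝔟 m = 𝕜.sym (Mˢ·Mˢ 𝔞 𝔟 m)

  ·-assoc : ∀ x y z → (x · y) · z ≈ᴹ x · (y · z)
  ·-assoc x y z =
    linear-unique QS (∘-linear QS QS QS (linearˡ ·-bilinear z) (linearˡ ·-bilinear y))
                     (linearˡ ·-bilinear (y · z)) (λ 𝔞 →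
    linear-unique QS (∘-linear QS QS QS (linearˡ ·-bilinear z) (linearʳ ·-bilinear (M 𝔞)))
                     (∘-linear QS QS QS (linearʳ ·-bilinear (M 𝔞)) (linearˡ ·-bilinear z)) (λ 𝔟 →
    linear-unique QS (linearʳ ·-bilinear (M 𝔞 · M 𝔟))
                     (∘-linear QS QS QS (linearʳ ·-bilinear (M 𝔞)) (linearʳ ·-bilinear (M 𝔟)))
                     (M-assoc 𝔞 𝔟) z) y) x
    where
    M-assoc : ∀ 𝔞 𝔟 𝔠 → (M 𝔞 · M 𝔟) · M 𝔠 ≈ᴹ M 𝔞 · (M 𝔟 · M 𝔠)
    M-assoc 𝔞 𝔟 𝔠 = begin
      (M 𝔞 · M 𝔟) · M 𝔠
        ≈⟨ Linear.⟦⟧-cong QS QS (linearˡ ·-bilinear (M 𝔠)) {M 𝔞 · M 𝔟} {ΣQS.Σqsh M 𝔞 𝔟} (M·M 𝔞 𝔟) ⟩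
      ΣQS.Σqsh M 𝔞 𝔟 · M 𝔠
        ≈⟨ Σqsh-linear QS QS (linearˡ ·-bilinear (M 𝔠)) M 𝔞 𝔟 ⟩
      ΣQS.Σqsh (λ 𝔡 → M 𝔡 · M 𝔠) 𝔞 𝔟
        ≈⟨ ΣQS.Σqsh-cong (λ 𝔡 → M·M 𝔡 𝔠) 𝔞 𝔟 ⟩
      ΣQS.Σqsh (λ 𝔡 → ΣQS.Σqsh M 𝔡 𝔠) 𝔞 𝔟
        ≈⟨ ΣQS.Σqsh-assoc M (λ {𝔡} {𝔡′} → M-∼ {𝔡} {𝔡′}) 𝔞 𝔟 𝔠 ⟩
      ΣQS.Σqsh (ΣQS.Σqsh M 𝔞) 𝔟 𝔠
        ≈⟨ ΣQS.Σqsh-cong (λ 𝔡 → M·M 𝔞 𝔡) 𝔟 𝔠 ⟨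
      ΣQS.Σqsh (λ 𝔡 → M 𝔞 · M 𝔡) 𝔟 𝔠
        ≈⟨ Σqsh-linear QS QS (linearʳ ·-bilinear (M 𝔞)) M 𝔟 𝔠 ⟨
      M 𝔞 · ΣQS.Σqsh M 𝔟 𝔠
        ≈⟨ Linear.⟦⟧-cong QS QS (linearʳ ·-bilinear (M 𝔞)) {M 𝔟 · M 𝔠} {ΣQS.Σqsh M 𝔟 𝔠} (M·M 𝔟 𝔠) ⟨
      M 𝔞 · (M 𝔟 · M 𝔠) ∎

  ·-isRing : IsRing _≈ᴹ_ _+ᴹ_ _·_ -ᴹ_ 0ᴹ (M [])
  ·-isRing = record
    { +-isAbelianGroup = +ᴹ-isAbelianGroup
    ; *-cong           = λ {x} {y} {u} {v} → cong₂ᴹ ·-bilinear {x} {y} {u} {v}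
    ; *-assoc          = ·-assoc
    ; *-identity       =
        linear-unique QS (linearʳ ·-bilinear (M [])) (id-linear QS) (M·M [])
      , linear-unique QS (linearˡ ·-bilinear (M [])) (id-linear QS)
          (λ 𝔞 → ≈ᴹ-trans {M 𝔞 · M []} {ΣQS.Σqsh M 𝔞 []} {M 𝔞} (M·M 𝔞 []) (ΣQS.Σqsh-identityʳ M 𝔞))
    ; distrib          = (λ x y z → Linear.+ᴹ-homo QS QS (linearʳ ·-bilinear x) y z)
                       , (λ x y z → Linear.+ᴹ-homo QS QS (linearˡ ·-bilinear x) y z)
    }

-- Hopf algebras of quasi-symmetric functions

module QuasiSymmetricHopf (𝕜 : CommutativeRing 0ℓ 0ℓ) (E : Exponents) where

  open LinearAlgebra 𝕜
  open LinearMaps 𝕜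
  open QuasiSymmetric 𝕜 E
  open CompositionSums 𝕜 E
  open Basis 𝕜 E
  open QuasiSymmetricAlgebra 𝕜 E
  open CommutativeRing 𝕜 using () renaming
    ( Carrier to K; _≈_ to _≈ᴷ_; 0# to 0ᴷ; 1# to 1ᴷ )
  private
    module 𝕜 = CommutativeRing 𝕜
    module ΣQS = Sums QS
    module T = Sums (QS ⊗ᴹ QS)
    module R = IsRing ·-isRing
  open Module QS
  open SetoidReasoning ≈ᴹ-setoid

  infixl 7 _⋆_

  -- Convolution of maps from compositions to QS.
  _⋆_ : (f g : Composition → ∣ QS ∣) → Composition → ∣ QS ∣
  f ⋆ g = ΣQS.Σdecon (λ 𝔞₁ 𝔞₂ → f 𝔞₁ · g 𝔞₂)

  -- The unit for convolution.
  η : Composition → ∣ QS ∣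
  η []      = M []
  η (_ ∷ _) = 0ᴹ

  ⋆-cong : ∀ {f f′ g g′} → (∀ 𝔞 → f 𝔞 ≈ᴹ f′ 𝔞) → (∀ 𝔞 → g 𝔞 ≈ᴹ g′ 𝔞) →
           ∀ 𝔞 → (f ⋆ g) 𝔞 ≈ᴹ (f′ ⋆ g′) 𝔞
  ⋆-cong {f} {f′} {g} {g′} p q =
    ΣQS.Σdecon-cong (λ 𝔞₁ 𝔞₂ → R.*-cong {f 𝔞₁} {f′ 𝔞₁} {g 𝔞₂} {g′ 𝔞₂} (p 𝔞₁) (q 𝔞₂))

  ⋆-identityˡ : ∀ f 𝔞 → (η ⋆ f) 𝔞 ≈ᴹ f 𝔞
  ⋆-identityˡ f []      = R.*-identityˡ (f [])
  ⋆-identityˡ f (α ∷ 𝔞) = begin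
    M [] · f (α ∷ 𝔞) +ᴹ ΣQS.Σdecon (λ _ 𝔞₂ → 0ᴹ · f 𝔞₂) 𝔞
      ≈⟨ +ᴹ-cong {M [] · f (α ∷ 𝔞)} {f (α ∷ 𝔞)} {ΣQS.Σdecon (λ _ 𝔞₂ → 0ᴹ · f 𝔞₂) 𝔞} {0ᴹ}
                 (R.*-identityˡ (f (α ∷ 𝔞)))
                 (ΣQS.Σdecon-zero (λ _ 𝔞₂ → R.zeroˡ (f 𝔞₂)) 𝔞) ⟩
    f (α ∷ 𝔞) +ᴹ 0ᴹ
      ≈⟨ +ᴹ-identityʳ (f (α ∷ 𝔞)) ⟩
    f (α ∷ 𝔞) ∎

  ⋆-identityʳ : ∀ f 𝔞 → (f ⋆ η) 𝔞 ≈ᴹ f 𝔞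
  ⋆-identityʳ f []      = R.*-identityʳ (f [])
  ⋆-identityʳ f (α ∷ 𝔞) = begin
    f [] · 0ᴹ +ᴹ ((f ∘ (α ∷_)) ⋆ η) 𝔞
      ≈⟨ +ᴹ-cong {f [] · 0ᴹ} {0ᴹ} {((f ∘ (α ∷_)) ⋆ η) 𝔞} {f (α ∷ 𝔞)}
                 (R.zeroʳ (f [])) (⋆-identityʳ (f ∘ (α ∷_)) 𝔞) ⟩
    0ᴹ +ᴹ f (α ∷ 𝔞)
      ≈⟨ +ᴹ-identityˡ (f (α ∷ 𝔞)) ⟩
    f (α ∷ 𝔞) ∎

  ⋆-assoc : ∀ f g h 𝔞 → ((f ⋆ g) ⋆ h) 𝔞 ≈ᴹ (f ⋆ (g ⋆ h)) 𝔞
  ⋆-assoc f g h 𝔞 = begin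
    ((f ⋆ g) ⋆ h) 𝔞
      ≈⟨ ΣQS.Σdecon-cong (λ 𝔞₁₂ 𝔞₃ →
           Σdecon-linear QS QS (linearˡ ·-bilinear (h 𝔞₃)) (λ 𝔞₁ 𝔞₂ → f 𝔞₁ · g 𝔞₂) 𝔞₁₂) 𝔞 ⟩
    ΣQS.Σdecon (λ 𝔞₁₂ 𝔞₃ → ΣQS.Σdecon (λ 𝔞₁ 𝔞₂ → (f 𝔞₁ · g 𝔞₂) · h 𝔞₃) 𝔞₁₂) 𝔞
      ≈⟨ ΣQS.Σdecon-assoc (λ 𝔞₁ 𝔞₂ 𝔞₃ → (f 𝔞₁ · g 𝔞₂) · h 𝔞₃) 𝔞 ⟩
    ΣQS.Σdecon (λ 𝔞₁ 𝔞₂₃ → ΣQS.Σdecon (λ 𝔞₂ 𝔞₃ → (f 𝔞₁ · g 𝔞₂) · h 𝔞₃) 𝔞₂₃) 𝔞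
      ≈⟨ ΣQS.Σdecon-cong (λ 𝔞₁ 𝔞₂₃ →
           ΣQS.Σdecon-cong (λ 𝔞₂ 𝔞₃ → R.*-assoc (f 𝔞₁) (g 𝔞₂) (h 𝔞₃)) 𝔞₂₃) 𝔞 ⟩
    ΣQS.Σdecon (λ 𝔞₁ 𝔞₂₃ → ΣQS.Σdecon (λ 𝔞₂ 𝔞₃ → f 𝔞₁ · (g 𝔞₂ · h 𝔞₃)) 𝔞₂₃) 𝔞
      ≈⟨ ΣQS.Σdecon-cong (λ 𝔞₁ 𝔞₂₃ →
           Σdecon-linear QS QS (linearʳ ·-bilinear (f 𝔞₁)) (λ 𝔞₂ 𝔞₃ → g 𝔞₂ · h 𝔞₃) 𝔞₂₃) 𝔞 ⟨
    (f ⋆ (g ⋆ h)) 𝔞 ∎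

  -- The solution g of f ⋆ g = η for f with f [] = M [], by recursion on the
  -- length: the equation expresses g 𝔞 by the values of g at the proper final
  -- segments of 𝔞.  The auxiliary map divide f h is h ⋆ g; it is needed for the
  -- maps h obtained from f by fixing a beginning of the argument.
  inverse : (Composition → ∣ QS ∣) → Composition → ∣ QS ∣
  divide   : (f h : Composition → ∣ QS ∣) → Composition → ∣ QS ∣
  inverse f []      = M []
  inverse f (α ∷ 𝔞) = -ᴹ divide f (f ∘ (α ∷_)) 𝔞
  divide f h []      = h []
  divide f h (α ∷ 𝔞) = h [] · (-ᴹ divide f (f ∘ (α ∷_)) 𝔞) +ᴹ divide f (h ∘ (α ∷_)) 𝔞

  divide-⋆ : ∀ f h 𝔞 → divide f h 𝔞 ≈ᴹ (h ⋆ inverse f) 𝔞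
  divide-⋆ f h []      = ≈ᴹ-sym {h [] · M []} {h []} (R.*-identityʳ (h []))
  divide-⋆ f h (α ∷ 𝔞) =
    +ᴹ-cong {h [] · inverse f (α ∷ 𝔞)} {h [] · inverse f (α ∷ 𝔞)}
            {divide f (h ∘ (α ∷_)) 𝔞} {((h ∘ (α ∷_)) ⋆ inverse f) 𝔞}
            (≈ᴹ-refl {h [] · inverse f (α ∷ 𝔞)})
            (divide-⋆ f (h ∘ (α ∷_)) 𝔞)

  ⋆-inverseʳ : ∀ f → f [] ≈ᴹ M [] → ∀ 𝔞 → (f ⋆ inverse f) 𝔞 ≈ᴹ η 𝔞
  ⋆-inverseʳ f f[]≈1 []      = begin
    f [] · M []  ≈⟨ R.*-identityʳ (f []) ⟩
    f []         ≈⟨ f[]≈1 ⟩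
    M []         ∎
  ⋆-inverseʳ f f[]≈1 (α ∷ 𝔞) = begin
    f [] · -ᴹ s +ᴹ ((f ∘ (α ∷_)) ⋆ inverse f) 𝔞
      ≈⟨ +ᴹ-cong {f [] · -ᴹ s} {M [] · -ᴹ s} {((f ∘ (α ∷_)) ⋆ inverse f) 𝔞} {s}
                 (R.*-cong {f []} {M []} { -ᴹ s} { -ᴹ s} f[]≈1 (≈ᴹ-refl { -ᴹ s}))
                 (≈ᴹ-sym {s} {((f ∘ (α ∷_)) ⋆ inverse f) 𝔞} (divide-⋆ f (f ∘ (α ∷_)) 𝔞)) ⟩
    M [] · -ᴹ s +ᴹ s
      ≈⟨ +ᴹ-cong {M [] · -ᴹ s} { -ᴹ s} {s} {s} (R.*-identityˡ (-ᴹ s)) (≈ᴹ-refl {s}) ⟩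
    -ᴹ s +ᴹ s
      ≈⟨ -ᴹ‿inverseˡ s ⟩
    0ᴹ ∎
    where
    s : ∣ QS ∣
    s = divide f (f ∘ (α ∷_)) 𝔞

  -- The right inverse g of f is also a left inverse: g has itself a right
  -- inverse h, and f = f ⋆ (g ⋆ h) = (f ⋆ g) ⋆ h = h.
  ⋆-inverseˡ : ∀ f → f [] ≈ᴹ M [] → ∀ 𝔞 → (inverse f ⋆ f) 𝔞 ≈ᴹ η 𝔞
  ⋆-inverseˡ f f[]≈1 𝔞 = begin
    (g ⋆ f) 𝔞  ≈⟨ ⋆-cong {g} {g} {f} {h} (λ 𝔟 → ≈ᴹ-refl {g 𝔟}) f≈h 𝔞 ⟩
    (g ⋆ h) 𝔞  ≈⟨ ⋆-inverseʳ g (≈ᴹ-refl {M []}) 𝔞 ⟩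
    η 𝔞        ∎
    where
    g h : Composition → ∣ QS ∣
    g = inverse f
    h = inverse g
    f≈h : ∀ 𝔟 → f 𝔟 ≈ᴹ h 𝔟
    f≈h 𝔟 = begin
      f 𝔟              ≈⟨ ⋆-identityʳ f 𝔟 ⟨
      (f ⋆ η) 𝔟        ≈⟨ ⋆-cong {f} {f} {g ⋆ h} {η} (λ 𝔠 → ≈ᴹ-refl {f 𝔠})
                                 (⋆-inverseʳ g (≈ᴹ-refl {M []})) 𝔟 ⟨
      (f ⋆ (g ⋆ h)) 𝔟  ≈⟨ ⋆-assoc f g h 𝔟 ⟨
      ((f ⋆ g) ⋆ h) 𝔟  ≈⟨ ⋆-cong {f ⋆ g} {η} {h} {h} (⋆-inverseʳ f f[]≈1) (λ 𝔠 → ≈ᴹ-refl {h 𝔠}) 𝔟 ⟩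
      (η ⋆ h) 𝔟        ≈⟨ ⋆-identityˡ h 𝔟 ⟩
      h 𝔟              ∎

  divide-∼ : ∀ {f h h′} → ΣQS.Respects∼ f → (∀ {𝔞 𝔞′} → 𝔞 ∼ 𝔞′ → h 𝔞 ≈ᴹ h′ 𝔞′) →
            ∀ {𝔞 𝔞′} → 𝔞 ∼ 𝔞′ → divide f h 𝔞 ≈ᴹ divide f h′ 𝔞′
  divide-∼ f-∼ h-∼ []      = h-∼ []
  divide-∼ {f} {h} {h′} f-∼ h-∼ {α ∷ 𝔞} {α′ ∷ 𝔞′} (p ∷ q) =
    +ᴹ-cong {h [] · -ᴹ s} {h′ [] · -ᴹ s′} {divide f (h ∘ (α ∷_)) 𝔞} {divide f (h′ ∘ (α′ ∷_)) 𝔞′}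
      (R.*-cong {h []} {h′ []} { -ᴹ s} { -ᴹ s′} (h-∼ []) (-ᴹ‿cong {s} {s′}
        (divide-∼ {f} {f ∘ (α ∷_)} {f ∘ (α′ ∷_)} f-∼ (λ r → f-∼ (p ∷ r)) q)))
      (divide-∼ {f} {h ∘ (α ∷_)} {h′ ∘ (α′ ∷_)} f-∼ (λ r → h-∼ (p ∷ r)) q)
    where
    s s′ : ∣ QS ∣
    s  = divide f (f ∘ (α ∷_)) 𝔞
    s′ = divide f (f ∘ (α′ ∷_)) 𝔞′

  inverse-∼ : ∀ {f} → ΣQS.Respects∼ f → ΣQS.Respects∼ (inverse f)
  inverse-∼ f-∼ []      = ≈ᴹ-refl {M []}
  inverse-∼ {f} f-∼ {α ∷ 𝔞} {α′ ∷ 𝔞′} (p ∷ q) =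
    -ᴹ‿cong {divide f (f ∘ (α ∷_)) 𝔞} {divide f (f ∘ (α′ ∷_)) 𝔞′}
      (divide-∼ {f} {f ∘ (α ∷_)} {f ∘ (α′ ∷_)} f-∼ (λ r → f-∼ (p ∷ r)) q)

  -- A summand of the comultiplication.
  M⊗M : Composition → Composition → ∣ QS ⊗ᴹ QS ∣
  M⊗M 𝔞₁ 𝔞₂ = M 𝔞₁ ⊗ M 𝔞₂

  private
    module Δᴱ = Extension (QS ⊗ᴹ QS) (T.Σdecon M⊗M) (T.Σdecon-∼ (λ p q → ⊗-cong (M-∼ p) (M-∼ q)))
    module Sᴱ = Extension QS (inverse M) (λ {𝔞} {𝔞′} → inverse-∼ {M} M-∼ {𝔞} {𝔞′})

  -- Deconcatenation of the M 𝔞.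
  Δ : ∣ QS ∣ → ∣ QS ⊗ᴹ QS ∣
  Δ = Δᴱ.extend

  Δ-linear : IsLinear QS (QS ⊗ᴹ QS) Δ
  Δ-linear = Δᴱ.extend-linear

  -- The constant term.
  ε : ∣ QS ∣ → K
  ε x = coeff (series x) []

  ε-linear : IsLinear QS 𝟙 ε
  ε-linear = coeff-linear []

  ε-M : ∀ 𝔞 → ε (M 𝔞) ≈ᴷ δ₀ 𝔞
  ε-M []      = 𝕜.+-identityʳ 1ᴷ
  ε-M (α ∷ 𝔞) = 𝕜.refl

  -- The antipode, the linear extension of the convolution inverse of M.
  S : ∣ QS ∣ → ∣ QS ∣
  S = Sᴱ.extend

  S-linear : IsLinear QS QS S
  S-linear = Sᴱ.extend-linear

  εM*1≈η : ∀ 𝔞 → ε (M 𝔞) *ₗ M [] ≈ᴹ η 𝔞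
  εM*1≈η []      = begin
    ε (M []) *ₗ M []  ≈⟨ *ₗ-cong {ε (M [])} {1ᴷ} {M []} {M []} (ε-M []) (≈ᴹ-refl {M []}) ⟩
    1ᴷ *ₗ M []        ≈⟨ *ₗ-identityˡ (M []) ⟩
    M []              ∎
  εM*1≈η (α ∷ 𝔞) = *ₗ-zeroˡ (M [])

  antipodeˡ : ∀ x → lift QS (λ a b → S a · b) (Δ x) ≈ᴹ ε x *ₗ M []
  antipodeˡ = linear-unique QS
    (∘-linear QS (QS ⊗ᴹ QS) QS h-linear Δ-linear) (*ₗ-linear QS QS ε-linear (M [])) (λ 𝔞 → begin
      lift QS (λ a b → S a · b) (T.Σdecon M⊗M 𝔞)  ≈⟨ Σdecon-linear (QS ⊗ᴹ QS) QS h-linear M⊗M 𝔞 ⟩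
      (inverse M ⋆ M) 𝔞                           ≈⟨ ⋆-inverseˡ M (≈ᴹ-refl {M []}) 𝔞 ⟩
      η 𝔞                                         ≈⟨ εM*1≈η 𝔞 ⟨
      ε (M 𝔞) *ₗ M []                             ∎)
    where
    h-linear : IsLinear (QS ⊗ᴹ QS) QS (lift QS (λ a b → S a · b))
    h-linear = lift-linear QS (∘-bilinear QS QS QS QS QS ·-bilinear S-linear (id-linear QS))

  antipodeʳ : ∀ x → lift QS (λ a b → a · S b) (Δ x) ≈ᴹ ε x *ₗ M []
  antipodeʳ = linear-unique QS
    (∘-linear QS (QS ⊗ᴹ QS) QS h-linear Δ-linear) (*ₗ-linear QS QS ε-linear (M [])) (λ 𝔞 → begin
      lift QS (λ a b → a · S b) (T.Σdecon M⊗M 𝔞)  ≈⟨ Σdecon-linear (QS ⊗ᴹ QS) QS h-linear M⊗M 𝔞 ⟩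
      (M ⋆ inverse M) 𝔞                           ≈⟨ ⋆-inverseʳ M (≈ᴹ-refl {M []}) 𝔞 ⟩
      η 𝔞                                         ≈⟨ εM*1≈η 𝔞 ⟨
      ε (M 𝔞) *ₗ M []                             ∎)
    where
    h-linear : IsLinear (QS ⊗ᴹ QS) QS (lift QS (λ a b → a · S b))
    h-linear = lift-linear QS (∘-bilinear QS QS QS QS QS ·-bilinear (id-linear QS) S-linear)

  counitˡ : ∀ x → lift QS (λ a b → ε a *ₗ b) (Δ x) ≈ᴹ x
  counitˡ = linear-unique QS (∘-linear QS (QS ⊗ᴹ QS) QS h-linear Δ-linear) (id-linear QS) (λ 𝔞 → begin
      lift QS (λ a b → ε a *ₗ b) (T.Σdecon M⊗M 𝔞)       ≈⟨ Σdecon-linear (QS ⊗ᴹ QS) QS h-linear M⊗M 𝔞 ⟩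
      ΣQS.Σdecon (λ 𝔞₁ 𝔞₂ → ε (M 𝔞₁) *ₗ M 𝔞₂) 𝔞           ≈⟨ eq 𝔞 ⟩
      M 𝔞                                               ∎)
    where
    h-linear : IsLinear (QS ⊗ᴹ QS) QS (lift QS (λ a b → ε a *ₗ b))
    h-linear = lift-linear QS (record
      { linearˡ = *ₗ-linear QS QS ε-linear ; linearʳ = λ a → scale-linear QS (ε a) })
    1*M : ∀ 𝔞 → ε (M []) *ₗ M 𝔞 ≈ᴹ M 𝔞
    1*M 𝔞 = begin
      ε (M []) *ₗ M 𝔞  ≈⟨ *ₗ-cong {ε (M [])} {1ᴷ} {M 𝔞} {M 𝔞} (ε-M []) (≈ᴹ-refl {M 𝔞}) ⟩
      1ᴷ *ₗ M 𝔞        ≈⟨ *ₗ-identityˡ (M 𝔞) ⟩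
      M 𝔞              ∎
    eq : ∀ 𝔞 → ΣQS.Σdecon (λ 𝔞₁ 𝔞₂ → ε (M 𝔞₁) *ₗ M 𝔞₂) 𝔞 ≈ᴹ M 𝔞
    eq []      = 1*M []
    eq (α ∷ 𝔞) = begin
      ε (M []) *ₗ M (α ∷ 𝔞) +ᴹ ΣQS.Σdecon (λ _ 𝔞₂ → 0ᴷ *ₗ M 𝔞₂) 𝔞
        ≈⟨ +ᴹ-cong {ε (M []) *ₗ M (α ∷ 𝔞)} {M (α ∷ 𝔞)} {ΣQS.Σdecon (λ _ 𝔞₂ → 0ᴷ *ₗ M 𝔞₂) 𝔞} {0ᴹ}
                   (1*M (α ∷ 𝔞)) (ΣQS.Σdecon-zero (λ _ 𝔞₂ → *ₗ-zeroˡ (M 𝔞₂)) 𝔞) ⟩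
      M (α ∷ 𝔞) +ᴹ 0ᴹ
        ≈⟨ +ᴹ-identityʳ (M (α ∷ 𝔞)) ⟩
      M (α ∷ 𝔞) ∎

  counitʳ : ∀ x → lift QS (λ a b → ε b *ₗ a) (Δ x) ≈ᴹ x
  counitʳ = linear-unique QS (∘-linear QS (QS ⊗ᴹ QS) QS h-linear Δ-linear) (id-linear QS) (λ 𝔞 → begin
      lift QS (λ a b → ε b *ₗ a) (T.Σdecon M⊗M 𝔞)       ≈⟨ Σdecon-linear (QS ⊗ᴹ QS) QS h-linear M⊗M 𝔞 ⟩
      ΣQS.Σdecon (λ 𝔞₁ 𝔞₂ → ε (M 𝔞₂) *ₗ M 𝔞₁) 𝔞           ≈⟨ eq M 𝔞 ⟩
      M 𝔞                                               ∎)
    where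
    h-linear : IsLinear (QS ⊗ᴹ QS) QS (lift QS (λ a b → ε b *ₗ a))
    h-linear = lift-linear QS (record
      { linearˡ = λ b → scale-linear QS (ε b) ; linearʳ = *ₗ-linear QS QS ε-linear })
    eq : ∀ f 𝔞 → ΣQS.Σdecon (λ 𝔞₁ 𝔞₂ → ε (M 𝔞₂) *ₗ f 𝔞₁) 𝔞 ≈ᴹ f 𝔞
    eq f []      = begin
      ε (M []) *ₗ f []  ≈⟨ *ₗ-cong {ε (M [])} {1ᴷ} {f []} {f []} (ε-M []) (≈ᴹ-refl {f []}) ⟩
      1ᴷ *ₗ f []        ≈⟨ *ₗ-identityˡ (f []) ⟩
      f []              ∎
    eq f (α ∷ 𝔞) = begin
      0ᴷ *ₗ f [] +ᴹ ΣQS.Σdecon (λ 𝔞₁ 𝔞₂ → ε (M 𝔞₂) *ₗ f (α ∷ 𝔞₁)) 𝔞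
        ≈⟨ +ᴹ-cong {0ᴷ *ₗ f []} {0ᴹ} {ΣQS.Σdecon (λ 𝔞₁ 𝔞₂ → ε (M 𝔞₂) *ₗ f (α ∷ 𝔞₁)) 𝔞} {f (α ∷ 𝔞)}
                   (*ₗ-zeroˡ (f [])) (eq (f ∘ (α ∷_)) 𝔞) ⟩
      0ᴹ +ᴹ f (α ∷ 𝔞)
        ≈⟨ +ᴹ-identityˡ (f (α ∷ 𝔞)) ⟩
      f (α ∷ 𝔞) ∎

  module _ where
    private
      QQ QQQ : Mod
      QQ  = QS ⊗ᴹ QS
      QQQ = QS ⊗ᴹ QQ
      module Q₃ = Sums QQQ

    coassoc : ∀ x → _≈ᵀ_ QS QQ (assoc⊗ (map⊗ Δ id (Δ x))) (map⊗ id Δ (Δ x))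
    coassoc = linear-unique QQQ
      (∘-linear QS QQ QQQ left-linear Δ-linear)
      (∘-linear QS QQ QQQ right-linear Δ-linear)
      (λ 𝔞 → ≈-trans (Σdecon-linear QQ QQQ left-linear M⊗M 𝔞)
            (≈-trans (Q₃.Σdecon-cong (λ 𝔞₁₂ 𝔞₃ →
                       Σdecon-linear QQ QQQ (slot-linear (M 𝔞₃)) M⊗M 𝔞₁₂) 𝔞)
            (≈-trans (Q₃.Σdecon-assoc (λ 𝔞₁ 𝔞₂ 𝔞₃ → M 𝔞₁ ⊗ (M 𝔞₂ ⊗ M 𝔞₃)) 𝔞)
            (≈-sym
            (≈-trans (Σdecon-linear QQ QQQ right-linear M⊗M 𝔞)
                     (Q₃.Σdecon-cong (λ 𝔞₁ 𝔞₂₃ →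
                       Σdecon-linear QQ QQQ (linearʳ (⊗-bilinear QS QQ) (M 𝔞₁)) M⊗M 𝔞₂₃) 𝔞))))))
      where
      left-linear : IsLinear QQ QQQ (λ t → assoc⊗ (map⊗ Δ id t))
      left-linear = ∘-linear QQ (QQ ⊗ᴹ QS) QQQ (assoc⊗-linear QS QS QS)
                             (map⊗-linear QS QS QQ QS Δ-linear (id-linear QS))
      right-linear : IsLinear QQ QQQ (map⊗ id Δ)
      right-linear = map⊗-linear QS QS QS QQ (id-linear QS) Δ-linear
      slot-linear : ∀ c → IsLinear QQ QQQ (λ t → assoc⊗ (t ⊗ c))
      slot-linear c = ∘-linear QQ (QQ ⊗ᴹ QS) QQQ (assoc⊗-linear QS QS QS)
                               (linearˡ (⊗-bilinear QQ QS) c)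

    -- The product of QS ⊗ QS.
    infixl 7 _·⊗_

    _·⊗_ : ∣ QQ ∣ → ∣ QQ ∣ → ∣ QQ ∣
    t ·⊗ u = lift QQ (λ a b → lift QQ (λ c d → (a · c) ⊗ (b · d)) u) t

    ·⊗-bilinear : IsBilinear QQ QQ QQ _·⊗_
    ·⊗-bilinear = record
      { linearˡ = λ u → lift-linear QQ (record
          { linearˡ = λ b → lift-parameter QQ QS (λ c d → ∘-linear QS QS QQ
              (linearˡ (⊗-bilinear QS QS) (b · d)) (linearˡ ·-bilinear c)) u
          ; linearʳ = λ a → lift-parameter QQ QS (λ c d → ∘-linear QS QS QQ
              (linearʳ (⊗-bilinear QS QS) (a · c)) (linearˡ ·-bilinear d)) u })
      ; linearʳ = lift-parameter QQ QQ (λ a b → lift-linear QQ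
          (∘-bilinear QS QS QS QS QQ (⊗-bilinear QS QS) (linearʳ ·-bilinear a) (linearʳ ·-bilinear b))) }

    Δ-· : ∀ x y → _≈ᵀ_ QS QS (Δ (x · y)) (Δ x ·⊗ Δ y)
    Δ-· x y =
      linear-unique QQ (∘-linear QS QS QQ Δ-linear (linearˡ ·-bilinear y))
                       (∘-linear QS QQ QQ (linearˡ ·⊗-bilinear (Δ y)) Δ-linear) (λ 𝔞 →
      linear-unique QQ (∘-linear QS QS QQ Δ-linear (linearʳ ·-bilinear (M 𝔞)))
                       (∘-linear QS QQ QQ (linearʳ ·⊗-bilinear (Δ (M 𝔞))) Δ-linear)
                       (Δ-M·M 𝔞) y) x
      where
      M·M⊗M·M : ∀ 𝔞₁ 𝔞₂ 𝔟₁ 𝔟₂ → _≈ᵀ_ QS QS ((M 𝔞₁ · M 𝔟₁) ⊗ (M 𝔞₂ · M 𝔟₂))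
                  (T.Σqsh (λ 𝔠₁ → T.Σqsh (M⊗M 𝔠₁) 𝔞₂ 𝔟₂) 𝔞₁ 𝔟₁)
      M·M⊗M·M 𝔞₁ 𝔞₂ 𝔟₁ 𝔟₂ =
        ≈-trans (⊗-cong (M·M 𝔞₁ 𝔟₁) (M·M 𝔞₂ 𝔟₂))
       (≈-trans (Σqsh-linear QS QQ (linearˡ (⊗-bilinear QS QS) (ΣQS.Σqsh M 𝔞₂ 𝔟₂)) M 𝔞₁ 𝔟₁)
                (T.Σqsh-cong (λ 𝔠₁ →
                  Σqsh-linear QS QQ (linearʳ (⊗-bilinear QS QS) (M 𝔠₁)) M 𝔞₂ 𝔟₂) 𝔞₁ 𝔟₁))

      Δ-M·M : ∀ 𝔞 𝔟 → _≈ᵀ_ QS QS (Δ (M 𝔞 · M 𝔟)) (Δ (M 𝔞) ·⊗ Δ (M 𝔟))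
      Δ-M·M 𝔞 𝔟 =
        ≈-trans (Linear.⟦⟧-cong QS QQ Δ-linear {M 𝔞 · M 𝔟} {ΣQS.Σqsh M 𝔞 𝔟} (M·M 𝔞 𝔟))
       (≈-trans (Σqsh-linear QS QQ Δ-linear M 𝔞 𝔟)
       (≈-trans (T.Σqsh-Σdecon M⊗M 𝔞 𝔟)
       (≈-sym
       (≈-trans (Σdecon-linear QQ QQ (linearˡ ·⊗-bilinear (Δ (M 𝔟))) M⊗M 𝔞)
                (T.Σdecon-cong (λ 𝔞₁ 𝔞₂ →
                  ≈-trans (Σdecon-linear QQ QQ (linearʳ ·⊗-bilinear (M⊗M 𝔞₁ 𝔞₂)) M⊗M 𝔟)
                          (T.Σdecon-cong (M·M⊗M·M 𝔞₁ 𝔞₂) 𝔟)) 𝔞)))))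

  hopfStructure : HopfStructure QS
  hopfStructure = record
    { _·_       = _·_
    ; 𝟏         = M []
    ; Δ         = Δ
    ; ε         = ε
    ; S         = S
    ; ·-isRing  = ·-isRing
    ; ·-scaleˡ  = λ r x y → Linear.*ₗ-homo QS QS (linearˡ ·-bilinear y) r x
    ; ·-scaleʳ  = λ r x y → Linear.*ₗ-homo QS QS (linearʳ ·-bilinear x) r y
    ; Δ-linear  = Δ-linear
    ; ε-linear  = ε-linear
    ; coassoc   = coassoc
    ; counitˡ   = counitˡ
    ; counitʳ   = counitʳ
    ; Δ-·       = Δ-·
    ; Δ-𝟏       = ≈-refl
    ; ε-·       = λ x y → 𝕜.+-identityʳ _
    ; ε-𝟏       = ε-M []
    ; S-linear  = S-linear
    ; antipodeˡ = antipodeˡ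
    ; antipodeʳ = antipodeʳ
    }

  isQuasiSymmetricHopf : IsQuasiSymmetricHopf hopfStructure
  isQuasiSymmetricHopf = record
    { ·-series = λ _ _ _ → 𝕜.refl
    ; 𝟏-M      = λ _ → 𝕜.refl
    ; Δ-M      = λ 𝔞 → ≈-sym (T.Σdecon-deconcatenations M⊗M 𝔞)
    ; ε-M      = ε-M
    }

-- Gradings by degree

module Submodules (𝕜 : CommutativeRing 0ℓ 0ℓ) where

  open LinearAlgebra 𝕜
  open LinearMaps 𝕜
  open IsSubmodule
  private module 𝕜 = CommutativeRing 𝕜

  Span-isSubmodule : (A : Mod) {I : Set} (v : I → ∣ A ∣) → IsSubmodule A (Span A v)
  Span-isSubmodule A v = record { P-resp = resp ; P-zero = zero ; P-add = add ; P-mul = mul }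

  zero-isSubmodule : (A : Mod) → IsSubmodule A (λ x → Module._≈ᴹ_ A x (Module.0ᴹ A))
  zero-isSubmodule A = record
    { P-resp = λ p q → ≈ᴹ-trans (≈ᴹ-sym p) q
    ; P-zero = ≈ᴹ-refl
    ; P-add  = λ p q → ≈ᴹ-trans (+ᴹ-cong p q) (+ᴹ-identityˡ 0ᴹ)
    ; P-mul  = λ r p → ≈ᴹ-trans (*ₗ-cong 𝕜.refl p) (*ₗ-zeroʳ r) }
    where open Module A

  -- A linear map that sends generators into a submodule does so with their
  -- span.
  Span-image : (A B : Mod) {φ : ∣ A ∣ → ∣ B ∣} → IsLinear A B φ →
               {P : Pred ∣ B ∣ 0ℓ} → IsSubmodule B P →
               {I : Set} {v : I → ∣ A ∣} → (∀ i → P (φ (v i))) → ∀ {x} → Span A v x → P (φ x)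
  Span-image A B {φ} φ-linear {P} P-sub {v = v} Pφv = go
    where
    open Module B
    module φ = Linear A B φ-linear
    go : ∀ {x} → Span A v x → P (φ x)
    go (gen i)            = Pφv i
    go zero               = P-resp P-sub (≈ᴹ-sym φ.0ᴹ-homo) (P-zero P-sub)
    go (add {x} {y} s t)  = P-resp P-sub (≈ᴹ-sym (φ.+ᴹ-homo x y)) (P-add P-sub (go s) (go t))
    go (mul r {x} s)      = P-resp P-sub (≈ᴹ-sym (φ.*ₗ-homo r x)) (P-mul P-sub r (go s))
    go (resp {x} {y} p s) = P-resp P-sub (φ.⟦⟧-cong {x} {y} p) (go s)

module Gradings (𝕜 : CommutativeRing 0ℓ 0ℓ) (E : Exponents) where

  open LinearAlgebra 𝕜
  open LinearMaps 𝕜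
  open Submodules 𝕜
  open Exponents E
  open QuasiSymmetric 𝕜 E
  open CompositionSums 𝕜 E
  open Basis 𝕜 E
  open QuasiSymmetricAlgebra 𝕜 E
  open QuasiSymmetricHopf 𝕜 E
  open CommutativeRing 𝕜 using () renaming
    ( _≈_ to _≈ᴷ_; _*_ to _*ᴷ_; 0# to 0ᴷ )
  private
    module 𝕜 = CommutativeRing 𝕜
    module +ᴱ = IsCommutativeMonoid +-isCommutativeMonoid
    module ΣQS = Sums QS
    +ᴱ-commutativeSemigroup : CommutativeSemigroup 0ℓ 0ℓ
    +ᴱ-commutativeSemigroup = record { isCommutativeSemigroup = +ᴱ.isCommutativeSemigroup }
  open CommutativeSemigroupProperties +ᴱ-commutativeSemigroup using (x∙yz≈y∙xz; interchange)

  -- Deconcatenation and quasi-shuffling preserve the degree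

  module _ (B : Mod) {P : Pred ∣ B ∣ 0ℓ} (P-sub : IsSubmodule B P) where
    open Sums B
    open IsSubmodule P-sub

    Σdecon-deg : ∀ {F} 𝔞 → (∀ 𝔞₁ 𝔞₂ → deg 𝔞₁ + deg 𝔞₂ ≡ deg 𝔞 → P (F 𝔞₁ 𝔞₂)) → P (Σdecon F 𝔞)
    Σdecon-deg []      PF = PF [] [] (+-identityˡ 𝟎)
    Σdecon-deg (α ∷ 𝔞) PF = P-add (PF [] (α ∷ 𝔞) (+-identityˡ _))
      (Σdecon-deg 𝔞 (λ 𝔞₁ 𝔞₂ eq → PF (α ∷ 𝔞₁) 𝔞₂
        (trans (+ᴱ.assoc (proj₁ α) _ _) (cong (proj₁ α +_) eq))))

    Σqsh-deg : ∀ {F} 𝔞 𝔟 → (∀ 𝔠 → deg 𝔠 ≡ deg 𝔞 + deg 𝔟 → P (F 𝔠)) → P (Σqsh F 𝔞 𝔟)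
    Σqsh-deg []      𝔟       PF = PF 𝔟 (sym (+-identityˡ _))
    Σqsh-deg (α ∷ 𝔞) []      PF = PF (α ∷ 𝔞) (sym (+-identityʳ _))
    Σqsh-deg (α ∷ 𝔞) (β ∷ 𝔟) PF = P-add
      (Σqsh-deg 𝔞 (β ∷ 𝔟) (λ 𝔠 eq → PF (α ∷ 𝔠)
        (trans (cong (proj₁ α +_) eq) (sym (+ᴱ.assoc (proj₁ α) _ _)))))
      (P-add
      (Σqsh-deg (α ∷ 𝔞) 𝔟 (λ 𝔠 eq → PF (β ∷ 𝔠)
        (trans (cong (proj₁ β +_) eq) (x∙yz≈y∙xz (proj₁ β) _ _))))
      (Σqsh-deg 𝔞 𝔟 (λ 𝔠 eq → PF (α ⊞ β ∷ 𝔠)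
        (trans (cong (proj₁ α + proj₁ β +_) eq) (interchange (proj₁ α) (proj₁ β) _ _)))))

  -- The degree of a monomial, the sum of its exponents.
  degᵐ : ∀ {n} → Monomial n → Exp
  degᵐ []      = 𝟎
  degᵐ (e ∷ m) = e + degᵐ m

  coeff-deg : ∀ 𝔞 {n} (m : Monomial n) → deg 𝔞 ≢ degᵐ m → coeff (Mˢ 𝔞) m ≈ᴷ 0ᴷ
  coeff-deg []      []      ≢m = contradiction refl ≢m
  coeff-deg (α ∷ 𝔞) []      ≢m = 𝕜.refl
  coeff-deg []      (e ∷ m) ≢m = 𝕜.trans (coeffM-[]-∷ e m) (0-if (𝟎 ≟ e))
    where
    0-if : (d : Dec (𝟎 ≡ e)) → ⟦ d ⟧ *ᴷ coeff (Mˢ []) m ≈ᴷ 0ᴷ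
    0-if (no _)     = 𝕜.zeroˡ _
    0-if (yes refl) = 𝕜.trans (𝕜.*-congˡ (coeff-deg [] m (λ eq → ≢m (trans eq (sym (+-identityˡ _))))))
                              (𝕜.zeroʳ _)
  coeff-deg (α ∷ 𝔞) (e ∷ m) ≢m = 𝕜.trans (coeffM-∷-∷ (proj₁ α) (parts 𝔞) e m)
    (𝕜.trans (𝕜.+-cong (0-if-α (proj₁ α ≟ e)) (0-if-𝟎 (𝟎 ≟ e))) (𝕜.+-identityˡ 0ᴷ))
    where
    0-if-α : (d : Dec (proj₁ α ≡ e)) → ⟦ d ⟧ *ᴷ coeff (Mˢ 𝔞) m ≈ᴷ 0ᴷ
    0-if-α (no _)     = 𝕜.zeroˡ _
    0-if-α (yes refl) = 𝕜.trans (𝕜.*-congˡ (coeff-deg 𝔞 m (λ eq → ≢m (cong (proj₁ α +_) eq)))) (𝕜.zeroʳ _)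
    0-if-𝟎 : (d : Dec (𝟎 ≡ e)) → ⟦ d ⟧ *ᴷ coeff (Mˢ (α ∷ 𝔞)) m ≈ᴷ 0ᴷ
    0-if-𝟎 (no _)     = 𝕜.zeroˡ _
    0-if-𝟎 (yes refl) = 𝕜.trans
      (𝕜.*-congˡ (coeff-deg (α ∷ 𝔞) m (λ eq → ≢m (trans eq (sym (+-identityˡ _)))))) (𝕜.zeroʳ _)

  -- The grading of QS induced by a homomorphism w from exponents to G, a set
  -- with decidable equality, a binary operation and a distinguished element:
  -- M 𝔞 has degree w (deg 𝔞).

  module Graded {G : Set} (_≟ᴳ_ : DecidableEquality G) (_∙_ : Op₂ G) (0ᴳ : G)
                (w : Exp → G) (w-𝟎 : w 𝟎 ≡ 0ᴳ) (w-+ : ∀ p q → w (p + q) ≡ w p ∙ w q) where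

    -- The homogeneous elements of degree g.
    Homogeneous : G → Pred ∣ QS ∣ 0ℓ
    Homogeneous g = Span QS {I = Σ[ 𝔞 ∈ Composition ] w (deg 𝔞) ≡ g} (M ∘ proj₁)

    private
      Homogeneous-sub : ∀ g → IsSubmodule QS (Homogeneous g)
      Homogeneous-sub g = Span-isSubmodule QS _

    homogeneous-M : ∀ 𝔞 → Homogeneous (w (deg 𝔞)) (M 𝔞)
    homogeneous-M 𝔞 = gen (𝔞 , refl)

    homogeneous-· : ∀ {d e x y} → Homogeneous d x → Homogeneous e y → Homogeneous (d ∙ e) (x · y)
    homogeneous-· {d} {e} {y = y} s t =
      Span-image QS QS (linearˡ ·-bilinear y) (Homogeneous-sub (d ∙ e)) (λ (𝔞 , p) →
      Span-image QS QS (linearʳ ·-bilinear (M 𝔞)) (Homogeneous-sub (d ∙ e)) (λ (𝔟 , q) →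
        resp {x = ΣQS.Σqsh M 𝔞 𝔟} {y = M 𝔞 · M 𝔟} (λ m → 𝕜.sym (M·M 𝔞 𝔟 m))
          (Σqsh-deg QS (Homogeneous-sub (d ∙ e)) 𝔞 𝔟 (λ 𝔠 eq → gen (𝔠 ,
            trans (cong w eq) (trans (w-+ (deg 𝔞) (deg 𝔟)) (cong₂ _∙_ p q)))))) t) s

    homogeneous-divide : ∀ p {h} → (∀ 𝔞 → Homogeneous (w (p + deg 𝔞)) (h 𝔞)) →
                        ∀ 𝔞 → Homogeneous (w (p + deg 𝔞)) (divide M h 𝔞)
    homogeneous-divide p {h} hom []      = hom []
    homogeneous-divide p {h} hom (α ∷ 𝔞) = add
      (subst (λ g → Homogeneous g (h [] · (Module.-ᴹ QS) (divide M (M ∘ (α ∷_)) 𝔞))) degree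
        (homogeneous-· (hom []) (neg∈Span QS
          (homogeneous-divide (proj₁ α) (λ 𝔠 → homogeneous-M (α ∷ 𝔠)) 𝔞))))
      (subst (λ q → Homogeneous (w q) (divide M (h ∘ (α ∷_)) 𝔞)) (+ᴱ.assoc p (proj₁ α) (deg 𝔞))
        (homogeneous-divide (p + proj₁ α) (λ 𝔠 →
          subst (λ q → Homogeneous (w q) (h (α ∷ 𝔠))) (sym (+ᴱ.assoc p (proj₁ α) (deg 𝔠)))
                (hom (α ∷ 𝔠))) 𝔞))
      where
      degree : w (p + 𝟎) ∙ w (proj₁ α + deg 𝔞) ≡ w (p + (proj₁ α + deg 𝔞))
      degree = trans (cong (λ q → w q ∙ w (proj₁ α + deg 𝔞)) (+-identityʳ p))
                     (sym (w-+ p (proj₁ α + deg 𝔞)))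

    homogeneous-inverse : ∀ 𝔞 → Homogeneous (w (deg 𝔞)) (inverse M 𝔞)
    homogeneous-inverse []      = homogeneous-M []
    homogeneous-inverse (α ∷ 𝔞) =
      neg∈Span QS (homogeneous-divide (proj₁ α) (λ 𝔠 → homogeneous-M (α ∷ 𝔠)) 𝔞)

    homogeneous-S : ∀ {d x} → Homogeneous d x → Homogeneous d (S x)
    homogeneous-S {d} = Span-image QS QS S-linear (Homogeneous-sub d)
      (λ { (𝔞 , refl) → homogeneous-inverse 𝔞 })

    homogeneous-ε : ∀ {d x} → d ≢ 0ᴳ → Homogeneous d x → ε x ≈ᴷ 0ᴷ
    homogeneous-ε d≢0 = Span-image QS 𝟙 ε-linear (zero-isSubmodule 𝟙) (λ where
      ([]    , eq) → contradiction (trans (sym eq) w-𝟎) d≢0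
      (_ ∷ _ , eq) → 𝕜.refl)

    -- The coefficients of a homogeneous element vanish at all monomials of
    -- other degrees.
    homogeneous-coeff : ∀ {d x} → Homogeneous d x → ∀ {n} (m : Monomial n) →
                        d ≢ w (degᵐ m) → coeff (series x) m ≈ᴷ 0ᴷ
    homogeneous-coeff s m d≢m = Span-image QS 𝟙 (coeff-linear m) (zero-isSubmodule 𝟙)
      (λ (𝔞 , eq) → coeff-deg 𝔞 m (λ eq′ → d≢m (trans (sym eq) (cong w eq′)))) s

    -- The homogeneous elements may be given by any equivalent description A.
    module _ (A₍_₎ : G → Pred ∣ QS ∣ 0ℓ)
             (to   : ∀ {g x} → A₍ g ₎ x → Homogeneous g x)
             (from : ∀ {g x} → Homogeneous g x → A₍ g ₎ x) where

      open Module QS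

      private
        element : Σ[ g ∈ G ] ∃ A₍ g ₎ → ∣ QS ∣
        element (_ , x , _) = x

        exhaustive : ∀ x → Span QS element x
        exhaustive (_ , s) = go s
          where
          go : ∀ {f} (s : Span SeriesModule Mˢ f) → Span QS element (f , s)
          go (gen 𝔞)   = gen (_ , M 𝔞 , from (homogeneous-M 𝔞))
          go zero      = zero
          go (add s t) = add (go s) (go t)
          go (mul r s) = mul r (go s)
          go (resp {f} {f′} p s) = resp {x = f , s} {y = f′ , resp p s} (λ m → p m) (go s)

        -- At the monomial m, at most one of the xs has a nonzero coefficient.
        coeff-independent : ∀ {n} (m : Monomial n) (xs : List (Σ[ g ∈ G ] ∃ A₍ g ₎)) →
          AllPairs (λ x y → proj₁ x ≢ proj₁ y) xs →
          coeff (series (sumᴹ QS (List.map element xs))) m ≈ᴷ 0ᴷ →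
          All (λ x → coeff (series (element x)) m ≈ᴷ 0ᴷ) xs
        coeff-independent m []                 []       Σ≈0 = []
        coeff-independent m ((d , x , Ax) ∷ xs) (p ∷ ps) Σ≈0 with d ≟ᴳ w (degᵐ m)
        ... | no d≢m   = x≈0 ∷ coeff-independent m xs ps (𝕜.trans (𝕜.sym
          (𝕜.trans (𝕜.+-congʳ x≈0) (𝕜.+-identityˡ _))) Σ≈0)
          where
          x≈0 : coeff (series x) m ≈ᴷ 0ᴷ
          x≈0 = homogeneous-coeff (to Ax) m d≢m
        ... | yes refl = 𝕜.trans (𝕜.sym (𝕜.trans (𝕜.+-congˡ (sum-zero xs≈0)) (𝕜.+-identityʳ _))) Σ≈0 ∷ xs≈0
          where
          xs≈0 : All (λ y → coeff (series (element y)) m ≈ᴷ 0ᴷ) xs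
          xs≈0 = All.map (λ {(_ , _ , Ay)} d≢e → homogeneous-coeff (to Ay) m (d≢e ∘ sym)) p
          sum-zero : ∀ {xs} → All (λ y → coeff (series (element y)) m ≈ᴷ 0ᴷ) xs →
                     coeff (series (sumᴹ QS (List.map element xs))) m ≈ᴷ 0ᴷ
          sum-zero []       = 𝕜.refl
          sum-zero (q ∷ qs) = 𝕜.trans (𝕜.+-cong q (sum-zero qs)) (𝕜.+-identityˡ 0ᴷ)

      isGradedHopf : IsGradedHopf hopfStructure _∙_ 0ᴳ A₍_₎
      isGradedHopf = record
        { isDirectSum = record
          { isSubmodule = λ g → record
            { P-resp = λ {x} {y} p Ax → from (resp {x = x} {y = y} p (to Ax))
            ; P-zero = from zero
            ; P-add  = λ Ax Ay → from (add (to Ax) (to Ay))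
            ; P-mul  = λ r Ax → from (mul r (to Ax)) }
          ; exhaustive  = exhaustive
          ; independent = λ xs distinct Σ≈0 →
              All.tabulate (λ i m → All.lookup (coeff-independent m xs distinct (Σ≈0 m)) i) }
        ; ·-graded = λ Ax Ay → from (homogeneous-· (to Ax) (to Ay))
        ; 𝟏-graded = from (gen ([] , w-𝟎))
        ; Δ-graded = λ Ax → Span-image QS (QS ⊗ᴹ QS) Δ-linear (Span-isSubmodule (QS ⊗ᴹ QS) _)
            (λ (𝔞 , eq) → Σdecon-deg (QS ⊗ᴹ QS) (Span-isSubmodule (QS ⊗ᴹ QS) _) 𝔞 (λ 𝔞₁ 𝔞₂ eq′ →
              gen (_ , trans (sym (w-+ (deg 𝔞₁) (deg 𝔞₂))) (trans (cong w eq′) eq) ,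
                   (M 𝔞₁ , from (homogeneous-M 𝔞₁)) , (M 𝔞₂ , from (homogeneous-M 𝔞₂)))))
            (to Ax)
        ; ε-graded = λ d≢0 Ax → homogeneous-ε d≢0 (to Ax)
        ; S-graded = λ Ax → from (homogeneous-S (to Ax))
        }

-- The substitution as a morphism of Hopf algebras

-- An additive map σ between two kinds of exponents that preserves zero and sends
-- no nonzero exponent to zero induces a morphism π of Hopf algebras, by applying
-- σ to all parts of a composition.

module Functoriality (𝕜 : CommutativeRing 0ℓ 0ℓ) (E F : Exponents)
  (σ : Exponents.Exp E → Exponents.Exp F)
  (σ-𝟎 : σ (Exponents.𝟎 E) ≡ Exponents.𝟎 F)
  (σ-+ : ∀ α β → σ (Exponents._+_ E α β) ≡ Exponents._+_ F (σ α) (σ β))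
  (σ-≢𝟎 : ∀ {α} → α ≢ Exponents.𝟎 E → σ α ≢ Exponents.𝟎 F) where

  open LinearAlgebra 𝕜
  open LinearMaps 𝕜
  open CommutativeRing 𝕜 using () renaming (_≈_ to _≈ᴷ_)
  private
    module 𝕜  = CommutativeRing 𝕜
    module QE = QuasiSymmetric 𝕜 E
    module QF = QuasiSymmetric 𝕜 F
    module CE = CompositionSums 𝕜 E
    module CF = CompositionSums 𝕜 F
    module BE = Basis 𝕜 E
    module BF = Basis 𝕜 F
    module AE = QuasiSymmetricAlgebra 𝕜 E
    module AF = QuasiSymmetricAlgebra 𝕜 F
    module HE = QuasiSymmetricHopf 𝕜 E
    module HF = QuasiSymmetricHopf 𝕜 F
    module ΣF = CF.Sums QF.QS
    module RF = IsRing AF.·-isRing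
    T = QF.QS ⊗ᴹ QF.QS

  mapPart : QE.NonzeroExp → QF.NonzeroExp
  mapPart (α , α≢𝟎) = σ α , σ-≢𝟎 α≢𝟎

  mapParts : QE.Composition → QF.Composition
  mapParts = List.map mapPart

  mapParts-∼ : ∀ {𝔞 𝔞′} → 𝔞 CE.∼ 𝔞′ → mapParts 𝔞 CF.∼ mapParts 𝔞′
  mapParts-∼ []      = []
  mapParts-∼ (p ∷ q) = cong σ p ∷ mapParts-∼ q

  deg-mapParts : ∀ 𝔞 → QF.deg (mapParts 𝔞) ≡ σ (QE.deg 𝔞)
  deg-mapParts []      = sym σ-𝟎
  deg-mapParts (α ∷ 𝔞) = trans (cong (Exponents._+_ F (σ (proj₁ α))) (deg-mapParts 𝔞))
                               (sym (σ-+ (proj₁ α) (QE.deg 𝔞)))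

  module _ (B : Mod) where
    open Module B
    private
      module SE = CE.Sums B
      module SF = CF.Sums B

    Σdecon-mapParts : ∀ G 𝔞 → SF.Σdecon G (mapParts 𝔞) ≈ᴹ
                              SE.Σdecon (λ 𝔞₁ 𝔞₂ → G (mapParts 𝔞₁) (mapParts 𝔞₂)) 𝔞
    Σdecon-mapParts G []      = ≈ᴹ-refl
    Σdecon-mapParts G (α ∷ 𝔞) = +ᴹ-cong ≈ᴹ-refl (Σdecon-mapParts (G ∘ (mapPart α ∷_)) 𝔞)

    Σqsh-mapParts : ∀ G → SF.Respects∼ G → ∀ 𝔞 𝔟 → SF.Σqsh G (mapParts 𝔞) (mapParts 𝔟) ≈ᴹ
                                                   SE.Σqsh (λ 𝔠 → G (mapParts 𝔠)) 𝔞 𝔟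
    Σqsh-mapParts G G-∼ []      𝔟       = ≈ᴹ-refl
    Σqsh-mapParts G G-∼ (α ∷ 𝔞) []      = ≈ᴹ-refl
    Σqsh-mapParts G G-∼ (α ∷ 𝔞) (β ∷ 𝔟) = SF.+-cong₃
      (Σqsh-mapParts (G ∘ (mapPart α ∷_)) (G-∼ ∘ (refl ∷_)) 𝔞 (β ∷ 𝔟))
      (Σqsh-mapParts (G ∘ (mapPart β ∷_)) (G-∼ ∘ (refl ∷_)) (α ∷ 𝔞) 𝔟)
      (≈ᴹ-trans (Σqsh-mapParts (G ∘ (mapPart α CF.⊞ mapPart β ∷_)) (G-∼ ∘ (refl ∷_)) 𝔞 𝔟)
        (SE.Σqsh-cong (λ 𝔠 → G-∼ (sym (σ-+ (proj₁ α) (proj₁ β)) ∷ CF.∼-refl)) 𝔞 𝔟))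

  private
    module Extend = BE.Extension QF.QS (QF.M ∘ mapParts) (λ p → BF.M-∼ (mapParts-∼ p))

  -- The linear map with π (M 𝔞) = M (mapParts 𝔞).
  π : ∣ QE.QS ∣ → ∣ QF.QS ∣
  π = Extend.extend

  π-linear : IsLinear QE.QS QF.QS π
  π-linear = Extend.extend-linear

  open Module QF.QS
  open SetoidReasoning ≈ᴹ-setoid

  π-· : ∀ x y → π (x AE.· y) ≈ᴹ π x AF.· π y
  π-· x y =
    BE.linear-unique QF.QS (∘-linear QE.QS QE.QS QF.QS π-linear (linearˡ AE.·-bilinear y))
                           (∘-linear QE.QS QF.QS QF.QS (linearˡ AF.·-bilinear (π y)) π-linear) (λ 𝔞 →
    BE.linear-unique QF.QS (∘-linear QE.QS QE.QS QF.QS π-linear (linearʳ AE.·-bilinear (QE.M 𝔞)))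
                           (∘-linear QE.QS QF.QS QF.QS (linearʳ AF.·-bilinear (π (QE.M 𝔞))) π-linear)
                           (π-M·M 𝔞) y) x
    where
    π-M·M : ∀ 𝔞 𝔟 → π (QE.M 𝔞 AE.· QE.M 𝔟) ≈ᴹ QF.M (mapParts 𝔞) AF.· QF.M (mapParts 𝔟)
    π-M·M 𝔞 𝔟 = begin
      π (QE.M 𝔞 AE.· QE.M 𝔟)
        ≈⟨ Linear.⟦⟧-cong QE.QS QF.QS π-linear {QE.M 𝔞 AE.· QE.M 𝔟} {CE.Sums.Σqsh QE.QS QE.M 𝔞 𝔟}
             (AE.M·M 𝔞 𝔟) ⟩
      π (CE.Sums.Σqsh QE.QS QE.M 𝔞 𝔟)
        ≈⟨ CE.Σqsh-linear QE.QS QF.QS π-linear QE.M 𝔞 𝔟 ⟩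
      CE.Sums.Σqsh QF.QS (λ 𝔠 → QF.M (mapParts 𝔠)) 𝔞 𝔟
        ≈⟨ Σqsh-mapParts QF.QS QF.M (λ p → BF.M-∼ p) 𝔞 𝔟 ⟨
      CF.Sums.Σqsh QF.QS QF.M (mapParts 𝔞) (mapParts 𝔟)
        ≈⟨ AF.M·M (mapParts 𝔞) (mapParts 𝔟) ⟨
      QF.M (mapParts 𝔞) AF.· QF.M (mapParts 𝔟) ∎

  π-Δ : ∀ x → _≈ᵀ_ QF.QS QF.QS (HF.Δ (π x)) (map⊗ π π (HE.Δ x))
  π-Δ = BE.linear-unique T
    (∘-linear QE.QS QF.QS T HF.Δ-linear π-linear)
    (∘-linear QE.QS (QE.QS ⊗ᴹ QE.QS) T π⊗π-linear HE.Δ-linear)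
    (λ 𝔞 → ≈-trans (Σdecon-mapParts T HF.M⊗M 𝔞)
                   (≈-sym (CE.Σdecon-linear (QE.QS ⊗ᴹ QE.QS) T π⊗π-linear HE.M⊗M 𝔞)))
    where
    π⊗π-linear : IsLinear (QE.QS ⊗ᴹ QE.QS) T (map⊗ π π)
    π⊗π-linear = map⊗-linear QE.QS QE.QS QF.QS QF.QS π-linear π-linear

  π-ε : ∀ x → HF.ε (π x) ≈ᴷ HE.ε x
  π-ε = BE.linear-unique 𝟙 (∘-linear QE.QS QF.QS 𝟙 HF.ε-linear π-linear) HE.ε-linear
    (λ { [] → 𝕜.refl ; (_ ∷ _) → 𝕜.refl })

  π-divide : ∀ {h k} → (∀ 𝔞 → π (h 𝔞) ≈ᴹ k (mapParts 𝔞)) →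
            ∀ 𝔞 → π (HE.divide QE.M h 𝔞) ≈ᴹ HF.divide QF.M k (mapParts 𝔞)
  π-divide hk []      = hk []
  π-divide {h} {k} hk (α ∷ 𝔞) = begin
    π (h [] AE.· V.-ᴹ s V.+ᴹ t)
      ≈⟨ π.+ᴹ-homo (h [] AE.· V.-ᴹ s) t ⟩
    π (h [] AE.· V.-ᴹ s) +ᴹ π t
      ≈⟨ +ᴹ-cong {π (h [] AE.· V.-ᴹ s)} {k [] AF.· -ᴹ s′} {π t} {t′} (begin
           π (h [] AE.· V.-ᴹ s)
             ≈⟨ π-· (h []) (V.-ᴹ s) ⟩
           π (h []) AF.· π (V.-ᴹ s)
             ≈⟨ RF.*-cong {π (h [])} {k []} {π (V.-ᴹ s)} { -ᴹ s′} (hk []) (begin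
                  π (V.-ᴹ s)  ≈⟨ π.-ᴹ-homo s ⟩
                  -ᴹ π s      ≈⟨ -ᴹ‿cong {π s} {s′}
                                   (π-divide {QE.M ∘ (α ∷_)} (λ 𝔠 → ≈ᴹ-refl {QF.M (mapParts (α ∷ 𝔠))}) 𝔞) ⟩
                  -ᴹ s′       ∎) ⟩
           k [] AF.· -ᴹ s′ ∎)
         (π-divide {h ∘ (α ∷_)} {k ∘ (mapPart α ∷_)} (λ 𝔠 → hk (α ∷ 𝔠)) 𝔞) ⟩
    k [] AF.· -ᴹ s′ +ᴹ t′ ∎
    where
    module V = Module QE.QS
    module π = Linear QE.QS QF.QS π-linear
    s t : ∣ QE.QS ∣
    s = HE.divide QE.M (QE.M ∘ (α ∷_)) 𝔞
    t = HE.divide QE.M (h ∘ (α ∷_)) 𝔞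
    s′ t′ : ∣ QF.QS ∣
    s′ = HF.divide QF.M (QF.M ∘ (mapPart α ∷_)) (mapParts 𝔞)
    t′ = HF.divide QF.M (k ∘ (mapPart α ∷_)) (mapParts 𝔞)

  π-S : ∀ x → π (HE.S x) ≈ᴹ HF.S (π x)
  π-S = BE.linear-unique QF.QS (∘-linear QE.QS QE.QS QF.QS π-linear HE.S-linear)
                               (∘-linear QE.QS QF.QS QF.QS HF.S-linear π-linear) π-inverse
    where
    π-inverse : ∀ 𝔞 → π (HE.inverse QE.M 𝔞) ≈ᴹ HF.inverse QF.M (mapParts 𝔞)
    π-inverse []      = ≈ᴹ-refl {QF.M []}
    π-inverse (α ∷ 𝔞) = begin
      π (Module.-ᴹ_ QE.QS s)  ≈⟨ Linear.-ᴹ-homo QE.QS QF.QS π-linear s ⟩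
      -ᴹ π s                  ≈⟨ -ᴹ‿cong {π s} {s′} (π-divide {QE.M ∘ (α ∷_)} {QF.M ∘ (mapPart α ∷_)}
                                   (λ 𝔠 → ≈ᴹ-refl {QF.M (mapParts (α ∷ 𝔠))}) 𝔞) ⟩
      -ᴹ s′                   ∎
      where
      s : ∣ QE.QS ∣
      s = HE.divide QE.M (QE.M ∘ (α ∷_)) 𝔞
      s′ : ∣ QF.QS ∣
      s′ = HF.divide QF.M (QF.M ∘ (mapPart α ∷_)) (mapParts 𝔞)

-- The substitution yᵢ = xᵢ.

module Substitution (𝕜 : CommutativeRing 0ℓ 0ℓ) where

  open CommutativeRing 𝕜 using () renaming
    ( Carrier to K; _≈_ to _≈ᴷ_; _*_ to _*ᴷ_; 1# to 1ᴷ )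
  open LinearAlgebra 𝕜
  open LinearMaps 𝕜
  private
    module 𝕜  = CommutativeRing 𝕜
    module E₁ = Exponents ℕ-exponents
    module E₂ = Exponents ℕ²-exponents
    module Q₁ = QuasiSymmetric 𝕜 ℕ-exponents
    module Q₂ = QuasiSymmetric 𝕜 ℕ²-exponents
    module P₁ = SeriesProducts 𝕜 ℕ-exponents
    module P₂ = SeriesProducts 𝕜 ℕ²-exponents
    module B₂ = Basis 𝕜 ℕ²-exponents
    open P₁ using (_≗ᴷ_)
    open SetoidReasoning 𝕜.setoid

  -- The exponent of xᵢ after the substitution in xᵢᵃ yᵢᵇ.
  total : E₂.Exp → E₁.Exp
  total (a , b) = a ℕ.+ b

  total-+ : ∀ α β → total (α E₂.+ β) ≡ total α ℕ.+ total β
  total-+ (a , b) (c , d) = +-interchange a c b d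
    where open import Algebra.Properties.CommutativeSemigroup ℕ.+-commutativeSemigroup
            using () renaming (interchange to +-interchange)

  total-≢𝟎 : ∀ {α} → α ≢ E₂.𝟎 → total α ≢ 0
  total-≢𝟎 {a , b} α≢𝟎 eq = α≢𝟎 (cong₂ _,_ (ℕ.m+n≡0⇒m≡0 a eq) (ℕ.m+n≡0⇒n≡0 a eq))

  open Functoriality 𝕜 ℕ²-exponents ℕ-exponents total refl total-+ total-≢𝟎 public

  -- The coefficients after the substitution, where c are those before.
  diagonal : ∀ {n} → (E₂.Monomial n → K) → E₁.Monomial n → K
  diagonal c = Q₁.sumOverFactorisations (λ p q → c (Vec.zip p q))

  diagonal-cong : ∀ {n} {c d : E₂.Monomial n → K} → (∀ m → c m ≈ᴷ d m) → diagonal c ≗ᴷ diagonal d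
  diagonal-cong p m = Q₁.sum-map-cong (λ (r , s) → p (Vec.zip r s)) (E₁.factorisations m)

  diagonal-⊹ : ∀ {n} (c d : E₂.Monomial n → K) → diagonal (c P₂.⊹ d) ≗ᴷ diagonal c P₁.⊹ diagonal d
  diagonal-⊹ c d m = P₁.sum-+ _ _ (E₁.factorisations m)

  diagonal-◁ : ∀ {n} α (c : E₂.Monomial n → K) → diagonal (α P₂.◁ c) ≗ᴷ total α P₁.◁ diagonal c
  diagonal-◁ α@(a , b) c (e ∷ m) = begin
    diagonal (α P₂.◁ c) (e ∷ m)
      ≈⟨ P₁.sum-cartesianProductWith _ _ (E₁.splits e) (E₁.factorisations m) ⟩
    P₁.sumOverSplits (λ p q → Q₁.sumOverFactorisations
      (λ ps qs → Q₂.⟦ α E₂.≟ (p , q) ⟧ *ᴷ c (Vec.zip ps qs)) m) e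
      ≈⟨ Q₁.sum-map-cong (λ (p , q) → P₁.sum-*ˡ Q₂.⟦ α E₂.≟ (p , q) ⟧ _ (E₁.factorisations m)) (E₁.splits e) ⟩
    P₁.sumOverSplits (λ p q → Q₂.⟦ α E₂.≟ (p , q) ⟧ *ᴷ diagonal c m) e
      ≈⟨ P₁.sum-*ʳ _ (diagonal c m) (E₁.splits e) ⟩
    P₁.sumOverSplits (λ p q → Q₂.⟦ α E₂.≟ (p , q) ⟧) e *ᴷ diagonal c m
      ≈⟨ 𝕜.*-congʳ (Q₁.sum-map-cong (λ (p , q) →
           indicator (α E₂.≟ (p , q)) (a E₁.≟ p) (b E₁.≟ q)) (E₁.splits e)) ⟩
    P₁.sumOverSplits (λ p q → Q₁.⟦ a E₁.≟ p ⟧ *ᴷ Q₁.⟦ b E₁.≟ q ⟧) e *ᴷ diagonal c m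
      ≈⟨ 𝕜.*-congʳ (P₁.sumOverSplits-indicator a b e) ⟩
    (total α P₁.◁ diagonal c) (e ∷ m) ∎
    where
    indicator : ∀ {p q} (d : Dec (α ≡ (p , q))) (d₁ : Dec (a ≡ p)) (d₂ : Dec (b ≡ q)) →
                Q₂.⟦ d ⟧ ≈ᴷ Q₁.⟦ d₁ ⟧ *ᴷ Q₁.⟦ d₂ ⟧
    indicator d (yes refl) (yes refl) = 𝕜.trans (B₂.⟦⟧-true d refl) (𝕜.sym (𝕜.*-identityˡ 1ᴷ))
    indicator d (yes _)    (no b≢q)   = 𝕜.trans (B₂.⟦⟧-false d (b≢q ∘ cong proj₂)) (𝕜.sym (𝕜.zeroʳ _))
    indicator d (no a≢p)   _          = 𝕜.trans (B₂.⟦⟧-false d (a≢p ∘ cong proj₁)) (𝕜.sym (𝕜.zeroˡ _))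

  -- The substitution turns M 𝔞 into M (mapParts 𝔞).
  diagonal-M : ∀ 𝔞 {n} → diagonal {n} (P₂.cM 𝔞) ≗ᴷ P₁.cM (mapParts 𝔞)
  diagonal-M []      [] = 𝕜.+-identityʳ _
  diagonal-M (α ∷ 𝔞) [] = 𝕜.+-identityʳ _
  diagonal-M []      m@(_ ∷ _) = begin
    diagonal (P₂.cM []) m             ≈⟨ diagonal-cong P₂.cM-[] m ⟩
    diagonal (E₂.𝟎 P₂.◁ P₂.cM []) m   ≈⟨ diagonal-◁ E₂.𝟎 (P₂.cM []) m ⟩
    (0 P₁.◁ diagonal (P₂.cM [])) m    ≈⟨ P₁.◁-cong {α = 0} refl (diagonal-M []) m ⟩
    (0 P₁.◁ P₁.cM []) m               ≈⟨ P₁.cM-[] m ⟨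
    P₁.cM [] m                        ∎
  diagonal-M (α ∷ 𝔞) m@(_ ∷ _) = begin
    diagonal (P₂.cM (α ∷ 𝔞)) m
      ≈⟨ diagonal-cong (P₂.cM-∷ α 𝔞) m ⟩
    diagonal (proj₁ α P₂.◁ P₂.cM 𝔞 P₂.⊹ E₂.𝟎 P₂.◁ P₂.cM (α ∷ 𝔞)) m
      ≈⟨ diagonal-⊹ (proj₁ α P₂.◁ P₂.cM 𝔞) (E₂.𝟎 P₂.◁ P₂.cM (α ∷ 𝔞)) m ⟩
    (diagonal (proj₁ α P₂.◁ P₂.cM 𝔞) P₁.⊹ diagonal (E₂.𝟎 P₂.◁ P₂.cM (α ∷ 𝔞))) m
      ≈⟨ 𝕜.+-cong
           (𝕜.trans (diagonal-◁ (proj₁ α) (P₂.cM 𝔞) m) (P₁.◁-cong {α = total (proj₁ α)} refl (diagonal-M 𝔞) m))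
           (𝕜.trans (diagonal-◁ E₂.𝟎 (P₂.cM (α ∷ 𝔞)) m) (P₁.◁-cong {α = 0} refl (diagonal-M (α ∷ 𝔞)) m)) ⟩
    (proj₁ (mapPart α) P₁.◁ P₁.cM (mapParts 𝔞) P₁.⊹ 0 P₁.◁ P₁.cM (mapParts (α ∷ 𝔞))) m
      ≈⟨ P₁.cM-∷ (mapPart α) (mapParts 𝔞) m ⟨
    P₁.cM (mapParts (α ∷ 𝔞)) m ∎

  π-coeff : ∀ x {n} (m : E₁.Monomial n) →
    Q₁.coeff (Q₁.series (π x)) m ≈ᴷ diagonal (Q₂.coeff (Q₂.series x)) m
  π-coeff x m = Basis.linear-unique 𝕜 ℕ²-exponents 𝟙
    (linear Q₂.QS 𝟙 (λ {y} {z} p → Linear.⟦⟧-cong Q₂.QS Q₁.QS π-linear {y} {z} p m)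
                    (λ y z → Linear.+ᴹ-homo Q₂.QS Q₁.QS π-linear y z m)
                    (λ r y → Linear.*ₗ-homo Q₂.QS Q₁.QS π-linear r y m))
    (linear Q₂.QS 𝟙 {λ y → diagonal (Q₂.coeff (Q₂.series y)) m}
      (λ p → diagonal-cong (λ m′ → p m′) m)
      (λ y z → diagonal-⊹ (Q₂.coeff (Q₂.series y)) (Q₂.coeff (Q₂.series z)) m)
      (λ r y → P₁.sum-*ˡ r _ (E₁.factorisations m)))
    (λ 𝔞 → 𝕜.sym (diagonal-M 𝔞 m)) x

-- DQSym, QSym and the map between them

open import Defs
open import Data.Nat.Base using (ℕ; _+_)
open import Data.Product.Base using (Σ-syntax; _×_)
open import Algebra.Module.Bundles using (Module)

private
  module DG = Gradings ℚ.+-*-commutativeRing ℕ²-exponents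
  module QG = Gradings ℚ.+-*-commutativeRing ℕ-exponents
  module DH = QuasiSymmetricHopf ℚ.+-*-commutativeRing ℕ²-exponents
  module QH = QuasiSymmetricHopf ℚ.+-*-commutativeRing ℕ-exponents
  module S  = Substitution ℚ.+-*-commutativeRing
  open LinearMaps ℚ.+-*-commutativeRing
  open Submodules ℚ.+-*-commutativeRing
  module Bidegree    = DG.Graded ℕ²._≟_ ℕ²._+_ ℕ².𝟎 id refl (λ _ _ → refl)
  module TotalDegree = DG.Graded ℕ._≟_ _+_ 0 S.total refl S.total-+
  module Degree      = QG.Graded ℕ._≟_ _+_ 0 id refl (λ _ _ → refl)

  -- An element has total degree n if it is a linear combination of M 𝔞 such that
  -- the two components of deg 𝔞 have sum n.
  total→ : ∀ {n x} → DQSymTotal₍ n ₎ x → TotalDegree.Homogeneous n x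
  total→ = Span-image DQSym DQSym (id-linear DQSym) (Span-isSubmodule DQSym _)
    (λ (_ , eq , _ , s) → Span-image DQSym DQSym (id-linear DQSym) (Span-isSubmodule DQSym _)
      (λ (𝔞 , eq′) → gen (𝔞 , trans (cong S.total eq′) eq)) s)

  total← : ∀ {n x} → TotalDegree.Homogeneous n x → DQSymTotal₍ n ₎ x
  total← = Span-image DQSym DQSym (id-linear DQSym) (Span-isSubmodule DQSym _)
    (λ (𝔞 , eq) → gen (DQ.deg 𝔞 , eq , DQ.M 𝔞 , gen (𝔞 , refl)))

  π-preserves : ∀ {n x} → DQSymTotal₍ n ₎ x → Q.QS₍ n ₎ (S.π x)
  π-preserves s = Span-image DQSym QSym S.π-linear (Span-isSubmodule QSym _)
    (λ (𝔞 , eq) → gen (S.mapParts 𝔞 , trans (S.deg-mapParts 𝔞) eq)) (total→ s)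

theorem2p2 : Σ[ D ∈ HopfStructure DQSym ] Σ[ H ∈ HopfStructure QSym ]
    DQ.IsQuasiSymmetricHopf D
    × IsGradedHopf D ℕ²._+_ ℕ².𝟎 DQ.QS₍_₎
    × IsGradedHopf D _+_ 0 DQSymTotal₍_₎
    × Q.IsQuasiSymmetricHopf H
    × IsGradedHopf H _+_ 0 Q.QS₍_₎
    × (Σ[ π ∈ (∣ DQSym ∣ → ∣ QSym ∣) ]
    (∀ f → Module._≈ᴹ_ Q.SeriesModule (Q.series (π f)) (setEqual (DQ.series f)))
    × IsGradedHopfMorphism D H DQSymTotal₍_₎ Q.QS₍_₎ π)
theorem2p2 =
    DH.hopfStructure
  , QH.hopfStructure
  , DH.isQuasiSymmetricHopf
  , Bidegree.isGradedHopf DQ.QS₍_₎ id id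
  , TotalDegree.isGradedHopf DQSymTotal₍_₎ total→ total←
  , QH.isQuasiSymmetricHopf
  , Degree.isGradedHopf Q.QS₍_₎ id id
  , S.π
  , S.π-coeff
  , record
    { linear    = S.π-linear
    ; ·-homo    = S.π-·
    ; 𝟏-homo    = λ _ → refl
    ; Δ-homo    = S.π-Δ
    ; ε-homo    = S.π-ε
    ; S-homo    = S.π-S
    ; preserves = π-preserves
    }
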